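{- Let $p,q$ be odd primes with $q-p=2^m$ for an integer $m\ge 1$. Let $D=D_1D_2\cdots D_n$ ($n\ge1$) be a product of distinct odd primes, none equal to $p$ or $q$, numbered so that for some integer $0\le s\le n$ we have $\left(\frac{pq}{D_i}\right)=1$ for $1\le i\le s$ and $\left(\frac{pq}{D_j}\right)=-1$ for $s<j\le n$. Let $E: y^2=x(x+pD)(x+qD)$ and let $S^{(\varphi)}(E/\mathbb{Q})$ and the directed graph $G(+D)$ be as in the context. If $m,p,D$ satisfy one of the following conditions: (1) $m=1$, $pD\equiv 5 \pmod 8$ and $D\equiv 3\pmod 4$; (2) $m=1$, $pD\equiv 1\pmod 8$ and $D\equiv 1\pmod 4$; (3) $m=2$; (4) $pD\equiv 3\pmod 8$; (5) $m=3$, $pD\equiv 1\pmod 4$; (6) $m=4$, $pD\equiv 7\pmod 8$, then $$\sharp S^{(\varphi)}(E/\mathbb{Q})=\sharp\{(V_1,V_2) \text{ even partition of } G(+D):\ -1,p,q,D_k\notin V_1 \text{ for all } s<k\le n\}.$$ In all other cases, $$\sharp S^{(\varphi)}(E/\mathbb{Q})=\sharp\{(V_1,V_2)\text{ even partition of } G(+D):\ -1,p,q,D_k\in V_2 \ (s<k\le n)\}+\sharp\{(V_1,V_2)\text{ quasi-even partition of } G(+D):\ -1,p,q,D_k\notin V_1\ (s<k\le n)\}.$$ (Conditions on vertices not belonging to the graph, e.g. $-1$ when it is not a vertex, are vacuous.)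
   Context: $\left(\frac{\cdot}{\cdot}\right)$ denotes the Legendre symbol. Let $\mathbb{Q}(S,2)$ be the subgroup of $\mathbb{Q}^*/\mathbb{Q}^{*2}$ generated by $-1,2,p,q,D_1,\dots,D_n$. For $d\in\mathbb{Q}(S,2)$ let $C_d$ be the curve $d w^2=d^2-2(p+q)D d z^2+4^mD^2z^4$. The $\varphi$-Selmer group $S^{(\varphi)}(E/\mathbb{Q})$ (for the 2-isogeny $\varphi:E\to E'$, $E': y^2=x^3-2(p+q)Dx^2+4^mD^2x$, with kernel $\{O,(0,0)\}$) is the set of $d\in\mathbb{Q}(S,2)$ such that $C_d(\mathbb{Q}_v)\neq\emptyset$ for every place $v$ of $\mathbb{Q}$ (including $v=\infty$, $\mathbb{Q}_\infty=\mathbb{R}$). Directed graphs: a partition of the vertex set $V$ of a directed graph is an ordered pair $(V_1,V_2)$ of disjoint (possibly empty) subsets with $V_1\cup V_2=V$. It is even if for every vertex $P\in V_1$ the number of edges from $P$ to vertices of $V_2$ is even, and for every $P\in V_2$ the number of edges from $P$ to vertices of $V_1$ is even. It is quasi-even if for every $P\in V_1$ (resp. $P\in V_2$) the number of edges from $P$ to $V_2$ (resp. to $V_1$) is $\equiv 0\pmod 2$ if $\left(\frac{2}{P}\right)=1$ and $\equiv1\pmod 2$ if $\left(\frac{2}{P}\right)=-1$. Here for an odd prime $P$, $\left(\frac2P\right)$ is the Legendre symbol, and for the vertex $P=-1$ one sets $\left(\frac{2}{ -1}\right)=1$ if ($m=1$, $pD\equiv7\pmod 8$, $D\equiv1\pmod4$)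 or ($m=1$, $pD\equiv1\pmod8$, $D\equiv3\pmod4$) or ($m\ge4$, $pD\equiv1\pmod 8$); and $\left(\frac{2}{ -1}\right)=-1$ if ($m=1$, $pD\equiv5\pmod8$, $D\equiv1\pmod4$) or ($m=1$, $pD\equiv7\pmod8$, $D\equiv3\pmod4$) or ($m\ge4$, $pD\equiv5\pmod8$). The directed graph $G(+D)$: Case 1: if $m=1$, or $m=2$ and $(p+2)D\not\equiv5\pmod8$, or $m\ge3$ and $pD\equiv1\pmod4$, the vertex set is $\{ -1,p,q,D_1,\dots,D_n\}$. Case 2: if $m=2$ and $(p+2)D\equiv5\pmod 8$, or $m\ge3$ and $pD\equiv3\pmod4$, the vertex set is $\{p,q,D_1,\dots,D_n\}$. Edges (among existing vertices): $D_i\to D_j$ whenever $1\le i\le s$, $1\le j\le n$, $\left(\frac{D_j}{D_i}\right)=-1$; $D_j\to D_i$ whenever $1\le i\le s<j\le n$, $\left(\frac{D_i}{D_j}\right)=-1$; $\ell\to D_i$ for $\ell\in\{p,q\}$, $1\le i\le s$, $\left(\frac{D_i}{\ell}\right)=-1$; $D_i\to p$ for $1\le i\le s$, $\left(\frac{p}{D_i}\right)=-1$; and, in Case 1 only, $-1\to D_i$ for $1\le i\le s$ with $\left(\frac{ -1}{D_i}\right)=-1$. -}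

module Defs where

open import Data.Bool using (Bool; true; false; _∧_; _∨_; not; _xor_; if_then_else_)
open import Data.Nat as ℕ using (ℕ; zero; suc; _≡ᵇ_; _<ᵇ_; _%_)
open import Data.Integer as ℤ using (ℤ; +_; -[1+_]; _%ℕ_)
import Data.Integer.Divisibility as ℤD
open import Data.Rational.Unnormalised as Q using (ℚᵘ; mkℚᵘ)
open import Data.Fin using (Fin; toℕ)
open import Data.Vec using (Vec; lookup)
open import Data.List using (List; []; _∷_; map; allFin; concatMap; filterᵇ; length; upTo; foldr)
open import Data.Bool.ListAction using (any)
open import Data.List.Membership.Propositional using (_∈_)
open import Data.List.Relation.Unary.Unique.Propositional using (Unique)
open import Data.Product using (Σ; _×_; _,_; proj₁; proj₂)
open import Relation.Binary.PropositionalEquality using (_≡_)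
open import Relation.Nullary using (does)

Card : {A : Set} → (A → Set) → ℕ → Set
Card {A} P N =
  Σ (List A) λ L → Unique L × ((x : A) → x ∈ L → P x) × ((x : A) → P x → x ∈ L)
                 × length L ≡ N

countᵇ : {A : Set} → (A → Bool) → List A → ℕ
countᵇ f xs = length (filterᵇ f xs)

isSqMod : ℕ → (P : ℕ) → .{{_ : ℕ.NonZero P}} → Bool
isSqMod r P = any (λ x → ((x ℕ.* x) % P) ≡ᵇ r) (upTo P)

legendre : ℤ → ℕ → ℤ
legendre a zero = + 0
legendre a P@(suc _) =
  if (a %ℕ P) ≡ᵇ 0 then + 0
  else if isSqMod (a %ℕ P) P then + 1 else -[1+ 0 ]

isNR : ℤ → ℕ → Bool
isNR a P = does (legendre a P ℤ.≟ -[1+ 0 ])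

record RawField : Set₁ where
  field
    Raw   : Set
    valid : Raw → Set           -- which raw data are genuine elements
    _⊕_   : Raw → Raw → Raw
    _⊗_   : Raw → Raw → Raw
    ι     : ℤ → Raw
    _≈_   : Raw → Raw → Set

HasPoint : RawField → (d : ℤ) (p q m D : ℕ) → Set
HasPoint K d p q m D =
  Σ Raw λ z → Σ Raw λ w → valid z × valid w ×
    ((ι d ⊗ (w ⊗ w)) ≈
     ((ι (d ℤ.* d) ⊕ (ι (ℤ.- (+ 2 ℤ.* + (p ℕ.+ q) ℤ.* + D ℤ.* d)) ⊗ (z ⊗ z)))
       ⊕ (ι (+ (4 ℕ.^ m ℕ.* (D ℕ.* D))) ⊗ ((z ⊗ z) ⊗ (z ⊗ z)))))
  where open RawField K

CongMod : ℤ → ℤ → ℕ → Set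
CongMod x y M = (+ M) ℤD.∣ (x ℤ.- y)

-- ℚ_ℓ: an element is x / ℓ^a with x ∈ ℤ_ℓ, where ℤ_ℓ = lim ℤ/ℓ^k is
-- given by a compatible sequence (x k mod ℓ^k)_k.
Qℓ : ℕ → RawField
Qℓ ℓ = record
  { Raw   = (ℕ → ℤ) × ℕ
  ; valid = λ { (x , a) → (k : ℕ) → CongMod (x (suc k)) (x k) (ℓ ℕ.^ k) }
  ; _⊕_   = λ { (x , a) (y , b) →
               (λ k → x k ℤ.* + (ℓ ℕ.^ b) ℤ.+ y k ℤ.* + (ℓ ℕ.^ a)) , a ℕ.+ b }
  ; _⊗_   = λ { (x , a) (y , b) → (λ k → x k ℤ.* y k) , a ℕ.+ b }
  ; ι     = λ c → (λ _ → c) , 0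
  ; _≈_   = λ { (x , a) (y , b) →
               (k : ℕ) → CongMod (x k ℤ.* + (ℓ ℕ.^ b)) (y k ℤ.* + (ℓ ℕ.^ a)) (ℓ ℕ.^ k) }
  }

-- ℝ as Cauchy sequences of rationals; ε ranges over 1/(j+1).
ε : ℕ → ℚᵘ
ε j = mkℚᵘ (+ 1) j

ℝ : RawField
ℝ = record
  { Raw   = ℕ → ℚᵘ
  ; valid = λ x → (j : ℕ) → Σ ℕ λ N → (k l : ℕ) → N ℕ.≤ k → N ℕ.≤ l →
                   Q.∣ x k Q.- x l ∣ Q.≤ ε j
  ; _⊕_   = λ x y k → x k Q.+ y k
  ; _⊗_   = λ x y k → x k Q.* y k
  ; ι     = λ c _ → mkℚᵘ c 0
  ; _≈_   = λ x y → (j : ℕ) → Σ ℕ λ N → (k : ℕ) → N ℕ.≤ k →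
                   Q.∣ x k Q.- y k ∣ Q.≤ ε j
  }

-- The setup: p, q, m, D_1..D_n (as D : Fin n → ℕ, 0-indexed), s.
-- Index i (0-based) is among "1..s" iff toℕ i < s.

module Setup (p q m n : ℕ) (Dv : Fin n → ℕ) (s : ℕ) where

  D : ℕ
  D = foldr ℕ._*_ 1 (map Dv (allFin n))

  inS : Fin n → Bool
  inS i = toℕ i <ᵇ s

  pD : ℕ
  pD = p ℕ.* D

  -- Selmer group.  Elements of Q(S,2) ↔ exponent vectors
  -- (e₋₁, e₂, e_p, e_q, (e_{D_i})_i) ∈ {0,1}^(4+n); d is the square-free
  -- representative (-1)^e₋₁ 2^e₂ p^e_p q^e_q ∏ D_i^e_i.

  Exps : Set
  Exps = Bool × Bool × Bool × Bool × Vec Bool n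

  pw : Bool → ℕ → ℕ
  pw true  x = x
  pw false x = 1

  dOf : Exps → ℤ
  dOf (e₋₁ , e₂ , ep , eq , c) =
    (if e₋₁ then -[1+ 0 ] else + 1) ℤ.*
    + (pw e₂ 2 ℕ.* pw ep p ℕ.* pw eq q ℕ.*
       foldr ℕ._*_ 1 (map (λ i → pw (lookup c i) (Dv i)) (allFin n)))

  InSelmer : Exps → Set
  InSelmer e = HasPoint ℝ (dOf e) p q m D ×
               ((ℓ : ℕ) → Prime ℓ → HasPoint (Qℓ ℓ) (dOf e) p q m D)
    where open import Data.Nat.Primality using (Prime)

  data Vtx : Set where
    v-1 vp vq : Vtx
    vD        : Fin n → Vtx

  case2 : Bool
  case2 = ((m ≡ᵇ 2) ∧ ((((p ℕ.+ 2) ℕ.* D) % 8) ≡ᵇ 5))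
        ∨ ((2 <ᵇ m) ∧ ((pD % 4) ≡ᵇ 3))

  vertices : List Vtx
  vertices = if case2 then vp ∷ vq ∷ map vD (allFin n)
                      else v-1 ∷ vp ∷ vq ∷ map vD (allFin n)

  edge : Vtx → Vtx → Bool
  edge (vD i) (vD j) = (inS i ∨ inS j) ∧ isNR (+ Dv j) (Dv i)
  edge vp     (vD i) = inS i ∧ isNR (+ Dv i) p
  edge vq     (vD i) = inS i ∧ isNR (+ Dv i) q
  edge (vD i) vp     = inS i ∧ isNR (+ p) (Dv i)
  edge v-1    (vD i) = inS i ∧ isNR -[1+ 0 ] (Dv i)
  edge _      _      = false

  -- (2 / P); for P = -1 the convention of the paper (false = -1;
  -- only the listed cases are ever used)
  twoSym : Vtx → Bool
  twoSym vp     = not (isNR (+ 2) p)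
  twoSym vq     = not (isNR (+ 2) q)
  twoSym (vD i) = not (isNR (+ 2) (Dv i))
  twoSym v-1    =
       ((m ≡ᵇ 1) ∧ ((pD % 8) ≡ᵇ 7) ∧ ((D % 4) ≡ᵇ 1))
    ∨ ((m ≡ᵇ 1) ∧ ((pD % 8) ≡ᵇ 1) ∧ ((D % 4) ≡ᵇ 3))
    ∨ ((3 <ᵇ m) ∧ ((pD % 8) ≡ᵇ 1))

  -- ordered partitions (V₁,V₂) of a vertex list: each vertex labelled
  -- true (∈ V₁) or false (∈ V₂)
  Partition : Set
  Partition = List (Vtx × Bool)

  labelings : List Vtx → List Partition
  labelings []       = [] ∷ []
  labelings (v ∷ vs) =
    concatMap (λ L → ((v , true) ∷ L) ∷ ((v , false) ∷ L) ∷ []) (labelings vs)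

  crossOut : Partition → Vtx → Bool → ℕ
  crossOut L P b = countᵇ (λ { (Q , b') → (b xor b') ∧ edge P Q }) L

  isEven : ℕ → Bool
  isEven k = (k % 2) ≡ᵇ 0

  allᵇ : {A : Set} → (A → Bool) → List A → Bool
  allᵇ f xs = foldr (λ x r → f x ∧ r) true xs

  even : Partition → Bool
  even L = allᵇ (λ { (P , b) → isEven (crossOut L P b) }) L

  quasiEven : Partition → Bool
  quasiEven L = allᵇ (λ { (P , b) →
     if twoSym P then isEven (crossOut L P b) else not (isEven (crossOut L P b)) }) L

  forcedV2 : Vtx → Bool
  forcedV2 v-1    = true
  forcedV2 vp     = true
  forcedV2 vq     = true
  forcedV2 (vD k) = not (inS k)

  restricted : Partition → Bool
  restricted L = allᵇ (λ { (P , b) → not (forcedV2 P ∧ b) }) L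

  #even : ℕ
  #even = countᵇ (λ L → even L ∧ restricted L) (labelings vertices)

  #quasiEven : ℕ
  #quasiEven = countᵇ (λ L → quasiEven L ∧ restricted L) (labelings vertices)

  Cond : Set
  Cond = (m ≡ 1 × pD % 8 ≡ 5 × D % 4 ≡ 3)
       ⊎ (m ≡ 1 × pD % 8 ≡ 1 × D % 4 ≡ 1)
       ⊎ (m ≡ 2)
       ⊎ (pD % 8 ≡ 3)
       ⊎ (m ≡ 3 × pD % 4 ≡ 1)
       ⊎ (m ≡ 4 × pD % 8 ≡ 7)
    where open import Data.Sum using (_⊎_)

{-# OPTIONS --safe #-}
module Submission where

-- Write F(X,Z) for the homogenised quartic. It has the two conic forms
-- (d Z² ∓ 2^m D X²)² - 4 r D d X² Z², with r = p for the minus and r = q for the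
-- plus sign. A point over ℚ_ℓ forces the leading ℓ-adic term of F, at a point
-- (X : ℓ^a) in lowest terms, to be d times a square; conversely Newton iteration
-- turns a suitable integer X into a point. This determines the local conditions:
-- d > 0; p and q do not divide d; d is a square modulo p, q and every D_j not
-- dividing d; if d = D_i d′ and D = D_i D′ then F/D_i² has a root modulo D_i,
-- that is, p D′ d′ and q D′ d′ are squares modulo D_i, so pq is one too. At
-- the other odd primes a counting argument gives a point. At 2 there is a
-- congruence condition on d modulo 8. Written additively in the Legendre
-- symbols, the odd conditions say that V₁ = {D_i : D_i ∣ d} is even (d odd) or
-- quasi-even (d even) at each odd vertex, and since (-1/D_i) is the class of D_i
-- modulo 4, the condition at 2 is the one at the vertex -1. Quadratic
-- reciprocity is not needed.

open import Defs
open import Algebra.Bundles using (CommutativeRing)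
import Algebra.Properties.CommutativeMonoid.Sum as MonoidSum
open import Data.Bool using (Bool; true; false; _∧_; _∨_; not; _xor_; if_then_else_; T; T?)
open import Data.Bool.ListAction using (any)
import Data.Bool.Properties as 𝔹ₚ
open import Data.Empty using (⊥; ⊥-elim)
open import Data.Fin as Fin using (Fin; toℕ)
import Data.Fin.Permutation as Perm
import Data.Fin.Properties as Finₚ
open import Data.Integer hiding (suc; NonZero; _≤?_)
open import Data.Integer.DivMod using (a≡a%ℕn+[a/ℕn]*n; n%ℕd<d)
import Data.Integer.Divisibility.Signed as ℤ∣
import Data.Integer.Properties as ℤₚ
open import Data.Integer.Tactic.RingSolver using (solve-∀)
open import Data.List using (List; []; _∷_; map; _++_; allFin; upTo; foldr; filterᵇ; concatMap)
open import Data.List.Membership.Propositional using (_∈_)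
import Data.List.Membership.Propositional.Properties as ∈ₚ
import Data.List.Properties as Listₚ
import Data.List.Relation.Unary.All as All
open import Data.List.Relation.Unary.All using (All; []; _∷_)
open import Data.List.Relation.Unary.AllPairs using ([]; _∷_)
open import Data.List.Relation.Unary.Any using (Any; here; there)
open import Data.List.Relation.Unary.Unique.Propositional using (Unique)
import Data.List.Relation.Unary.Unique.Propositional.Properties as Uniqueₚ
open import Data.Nat as ℕ using (ℕ; zero; suc; z≤n; s≤s; NonZero)
import Data.Nat.Coprimality as Coprime
import Data.Nat.DivMod as ℕ%
import Data.Nat.Divisibility as ℕ∣
import Data.Nat.GCD as GCD
open import Data.Nat.Primality using (Prime; euclidsLemma; prime⇒nonZero; prime⇒nonTrivial; prime⇒irreducible; prime[2])
import Data.Nat.Properties as ℕₚ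
import Data.Nat.Tactic.RingSolver as ℕSolver
open import Data.Product using (∃; _×_; _,_; proj₁; proj₂)
open import Data.Rational.Unnormalised as Q using (ℚᵘ; mkℚᵘ; *≤*; 0ℚᵘ; 1ℚᵘ)
import Data.Rational.Unnormalised.Properties as Qₚ
open import Data.Rational.Unnormalised.Solver using (module +-*-Solver)
open import Data.Sum using (_⊎_; inj₁; inj₂; [_,_]′)
open import Data.Unit using (tt)
open import Data.Vec using (Vec; []; _∷_; lookup; tabulate)
import Data.Vec.Properties as Vecₚ
open import Function using (_∘_; case_of_)
open import Relation.Binary using (tri<; tri≈; tri>)
open import Relation.Binary.PropositionalEquality using (_≡_; _≢_; refl; sym; trans; cong; cong₂; subst; subst₂; module ≡-Reasoning)
open import Relation.Nullary using (¬_; Dec; yes; no; does; contradiction)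

-- A point over `Qℓ ℓ` is only a sequence of approximations with explicit denominators, so every
-- statement about it is a congruence modulo a large power of `ℓ`. `Matches` is what survives of
-- solubility: in lowest terms the valuation of F has the parity of that of d, and the unit parts
-- agree up to a square modulo `ℓ³`. Three digits are kept because unit squares are recognised
-- modulo `ℓ` for odd `ℓ`, but only modulo 8 for `ℓ = 2`. At primes of good reduction the existence
-- of a point takes the place of the Hasse bound. It comes from the map (X, y) to (X², y) onto a
-- conic, whose rational parametrisation would otherwise yield an injection of the residues into
-- themselves that misses a value. An edge leaving an odd vertex P carries a symbol modulo P, as
-- does the local condition at P, so that each condition concerns a single vertex. For the vertex -1
-- the first supplementary law is proved by counting fixed points of involutions on the units modulo
-- sign. `Cond` collects cases in which no even d is soluble at 2; quasi-even partitions, which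
-- describe the even d, then contribute nothing.

infix 4 _≡[_]_

-- Congruences between integers

record _≡[_]_ (x M y : ℤ) : Set where
  constructor _by_
  field
    quot : ℤ
    equality : x ≡ y + quot * M

infix 5 _by_

module _ {M : ℤ} where

  -- A linear combination of congruences, checked by a ring identity.
  lin₁ : ∀ {A B X Y} → A ≡[ M ] B → (c : ℤ) → X - Y ≡ c * (A - B) → X ≡[ M ] Y
  lin₁ {A} {B} {X} {Y} (k by refl) c e = c * k by
    trans (trans (add-back X Y) (cong (λ t → Y + t) e)) (rearrange Y B c k M)
    where
    add-back : ∀ X Y → X ≡ Y + (X - Y)
    add-back = solve-∀
    rearrange : ∀ Y B c k M → Y + c * (B + k * M - B) ≡ Y + c * k * M
    rearrange = solve-∀

  lin₀ : ∀ {X Y} → (c : ℤ) → X - Y ≡ c * M → X ≡[ M ] Y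
  lin₀ c e = lin₁ {A = M} {B = 0ℤ} (1ℤ by identity M) c (trans e (cong (c *_) (minus-zero M)))
    where
    identity : ∀ M → M ≡ 0ℤ + 1ℤ * M
    identity = solve-∀
    minus-zero : ∀ M → M ≡ M - 0ℤ
    minus-zero = solve-∀

  lin₂ : ∀ {A B A′ B′ X Y} → A ≡[ M ] B → A′ ≡[ M ] B′ → (c c′ : ℤ) →
         X - Y ≡ c * (A - B) + c′ * (A′ - B′) → X ≡[ M ] Y
  lin₂ {A} {B} {A′} {B′} (k by e₁) (k′ by e₂) c c′ e =
    lin₁ {A = c * (A - B) + c′ * (A′ - B′)} {B = 0ℤ} (c * k + c′ * k′ by combined) 1ℤ
      (trans e (unfold (c * (A - B) + c′ * (A′ - B′))))
    where
    unfold : ∀ x → x ≡ 1ℤ * (x - 0ℤ)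
    unfold = solve-∀
    rearrange : ∀ B B′ c c′ k k′ M →
      c * (B + k * M - B) + c′ * (B′ + k′ * M - B′) ≡ 0ℤ + (c * k + c′ * k′) * M
    rearrange = solve-∀
    combined : c * (A - B) + c′ * (A′ - B′) ≡ 0ℤ + (c * k + c′ * k′) * M
    combined = trans (cong₂ (λ x y → c * (x - B) + c′ * (y - B′)) e₁ e₂)
                     (rearrange B B′ c c′ k k′ M)

  ≡ₘ-reflexive : ∀ {x y} → x ≡ y → x ≡[ M ] y
  ≡ₘ-reflexive {x} refl = lin₀ 0ℤ (cancel x M)
    where
    cancel : ∀ x M → x - x ≡ 0ℤ * M
    cancel = solve-∀

  ≡ₘ-refl : ∀ {x} → x ≡[ M ] x
  ≡ₘ-refl = ≡ₘ-reflexive refl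

  ≡ₘ-sym : ∀ {x y} → x ≡[ M ] y → y ≡[ M ] x
  ≡ₘ-sym {x} {y} h = lin₁ h -1ℤ (identity x y)
    where
    identity : ∀ x y → y - x ≡ -1ℤ * (x - y)
    identity = solve-∀

  ≡ₘ-trans : ∀ {x y z} → x ≡[ M ] y → y ≡[ M ] z → x ≡[ M ] z
  ≡ₘ-trans {x} {y} {z} h h′ = lin₂ h h′ 1ℤ 1ℤ (identity x y z)
    where
    identity : ∀ x y z → x - z ≡ 1ℤ * (x - y) + 1ℤ * (y - z)
    identity = solve-∀

  +-congₘ : ∀ {x y u v} → x ≡[ M ] y → u ≡[ M ] v → x + u ≡[ M ] y + v
  +-congₘ {x} {y} {u} {v} h h′ = lin₂ h h′ 1ℤ 1ℤ (identity x y u v)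
    where
    identity : ∀ x y u v → x + u - (y + v) ≡ 1ℤ * (x - y) + 1ℤ * (u - v)
    identity = solve-∀

  *-congₘ : ∀ {x y u v} → x ≡[ M ] y → u ≡[ M ] v → x * u ≡[ M ] y * v
  *-congₘ {x} {y} {u} {v} h h′ = lin₂ h h′ u y (identity x y u v)
    where
    identity : ∀ x y u v → x * u - y * v ≡ u * (x - y) + y * (u - v)
    identity = solve-∀

  neg-congₘ : ∀ {x y} → x ≡[ M ] y → - x ≡[ M ] - y
  neg-congₘ {x} {y} h = lin₁ h -1ℤ (identity x y)
    where
    identity : ∀ x y → - x - (- y) ≡ -1ℤ * (x - y)
    identity = solve-∀

  scaleₘ : ∀ {x y} c → x ≡[ M ] y → c * x ≡[ c * M ] c * y
  scaleₘ {x} {y} c (k by refl) = k by identity c y k M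
    where
    identity : ∀ c y k M → c * (y + k * M) ≡ c * y + k * (c * M)
    identity = solve-∀

  unscaleₘ : ∀ {x y} c → c ≢ 0ℤ → c * x ≡[ c * M ] c * y → x ≡[ M ] y
  unscaleₘ {x} {y} c c≢0 (k by e) = k by
    ℤₚ.*-cancelˡ-≡ c x (y + k * M) {{≢-nonZero c≢0}} (trans e (identity c y k M))
    where
    identity : ∀ c y k M → c * y + k * (c * M) ≡ c * (y + k * M)
    identity = solve-∀

remodulus : ∀ {M N x y} → M ≡ N → x ≡[ M ] y → x ≡[ N ] y
remodulus refl h = h

coarsenₘ : ∀ {M x y} N → x ≡[ M * N ] y → x ≡[ N ] y
coarsenₘ {M} {y = y} N (k by refl) = k * M by cong (λ t → y + t) (sym (ℤₚ.*-assoc k M N))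

fromCong : ∀ {x y M} → CongMod x y M → x ≡[ + M ] y
fromCong {x} {y} {M} h with ℤ∣.∣ᵤ⇒∣ {+ M} {x - y} h
... | ℤ∣.divides q e = lin₀ q e

toCong : ∀ {x y M} → x ≡[ + M ] y → CongMod x y M
toCong {x} {y} {M} (k by refl) = ℤ∣.∣⇒∣ᵤ (ℤ∣.divides k (identity y k (+ M)))
  where
  identity : ∀ y k M → y + k * M - y ≡ k * M
  identity = solve-∀

_≡ₘ?_ : ∀ {M} x y → Dec (x ≡[ M ] y)
_≡ₘ?_ {M} x y with M ℤ∣.∣? (x - y)
... | yes (ℤ∣.divides q e) = yes (lin₀ q e)
... | no ¬h = no λ { (k by refl) → ¬h (ℤ∣.divides k (identity y k M)) }
  where
  identity : ∀ y k M → y + k * M - y ≡ k * M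
  identity = solve-∀

zero⇒∣ : ∀ {x P} → x ≡[ + P ] 0ℤ → P ℕ∣.∣ ∣ x ∣
zero⇒∣ {x} {P} (k by e) =
  ℤ∣.∣⇒∣ᵤ (ℤ∣.divides k (trans e (ℤₚ.+-identityˡ (k * + P))))

∣⇒zero : ∀ {x P} → P ℕ∣.∣ ∣ x ∣ → x ≡[ + P ] 0ℤ
∣⇒zero {x} {P} h with ℤ∣.∣ᵤ⇒∣ {+ P} {x} h
... | ℤ∣.divides q e = q by trans e (sym (ℤₚ.+-identityˡ (q * + P)))

Unit : ℕ → ℤ → Set
Unit P x = ¬ (x ≡[ + P ] 0ℤ)

-- Residues modulo a prime

residue : ∀ P .{{_ : NonZero P}} x → x ≡[ + P ] + (x %ℕ P)
residue P x = (x /ℕ P) by a≡a%ℕn+[a/ℕn]*n x P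

private
  residues-≤ : ∀ {P r s} → s ℕ.≤ r → r ℕ.< P → + r ≡[ + P ] + s → r ℕ.≤ s
  residues-≤ {P} {r} {s} s≤r r<P h with r ℕ.∸ s in eq
  ... | zero = ℕₚ.m∸n≡0⇒m≤n eq
  ... | suc k = contradiction
    (ℕₚ.≤-trans (ℕ∣.∣⇒≤ P∣) (ℕₚ.≤-trans (ℕₚ.≤-reflexive (sym eq)) (ℕₚ.m∸n≤m r s))) (ℕₚ.<⇒≱ r<P)
    where
    diff : + r - + s ≡ + suc k
    diff = trans (ℤₚ.m-n≡m⊖n r s) (trans (ℤₚ.⊖-≥ s≤r) (cong +_ eq))
    move : ∀ x y → x - y - 0ℤ ≡ 1ℤ * (x - y)
    move = solve-∀
    P∣ : P ℕ∣.∣ suc k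
    P∣ = subst (λ z → P ℕ∣.∣ ∣ z ∣) diff (zero⇒∣ {+ r - + s} (lin₁ h 1ℤ (move (+ r) (+ s))))

small-residues : ∀ {P r s} → r ℕ.< P → s ℕ.< P → + r ≡[ + P ] + s → r ≡ s
small-residues {P} {r} {s} r<P s<P h with ℕₚ.≤-total s r
... | inj₁ s≤r = ℕₚ.≤-antisym (residues-≤ s≤r r<P h) s≤r
... | inj₂ r≤s = ℕₚ.≤-antisym r≤s (residues-≤ r≤s s<P (≡ₘ-sym h))

-- A missed class could be punched out of `Fin P`, leaving an injection of `P` indices into `P - 1`
-- classes.
injective⇒surjectiveₘ : ∀ P .{{_ : NonZero P}} (f : Fin P → ℤ) →
  (∀ i j → f i ≡[ + P ] f j → i ≡ j) → ∀ y → ∃ λ i → f i ≡[ + P ] y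
injective⇒surjectiveₘ P@(suc P-1) f inj y
  with Finₚ.any? (λ i → f i ≡ₘ? y)
... | yes hit = hit
... | no miss = contradiction (Finₚ.injective⇒≤ {f = avoid} avoid-injective) ℕₚ.1+n≰n
  where
  reduce : ℤ → Fin P
  reduce x = Fin.fromℕ< (n%ℕd<d x P)
  reduce-sound : ∀ x x′ → reduce x ≡ reduce x′ → x ≡[ + P ] x′
  reduce-sound x x′ e = ≡ₘ-trans (residue P x) (≡ₘ-trans
    (≡ₘ-reflexive (cong +_ (Finₚ.fromℕ<-injective _ _ (n%ℕd<d x P) (n%ℕd<d x′ P) e))) (≡ₘ-sym (residue P x′)))
  y≢ : ∀ i → reduce y ≢ reduce (f i)
  y≢ i e = miss (i , reduce-sound (f i) y (sym e))
  avoid : Fin P → Fin P-1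
  avoid i = Fin.punchOut (y≢ i)
  avoid-injective : ∀ {i j} → avoid i ≡ avoid j → i ≡ j
  avoid-injective {i} {j} e =
    inj i j (reduce-sound (f i) (f j) (Finₚ.punchOut-injective (y≢ i) (y≢ j) e))

module _ {P : ℕ} (prime : Prime P) where

  private instance
    P≢0 : NonZero P
    P≢0 = prime⇒nonZero prime

  euclid : ∀ a b → a * b ≡[ + P ] 0ℤ → a ≡[ + P ] 0ℤ ⊎ b ≡[ + P ] 0ℤ
  euclid a b h with euclidsLemma ∣ a ∣ ∣ b ∣ prime (subst (P ℕ∣.∣_) (ℤₚ.abs-* a b) (zero⇒∣ h))
  ... | inj₁ P∣a = inj₁ (∣⇒zero P∣a)
  ... | inj₂ P∣b = inj₂ (∣⇒zero P∣b)

  Unit-* : ∀ {a b} → Unit P a → Unit P b → Unit P (a * b)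
  Unit-* {a} {b} ua ub h = [ ua , ub ]′ (euclid a b h)

  Unit-1 : Unit P 1ℤ
  Unit-1 h = contradiction (ℕ∣.∣1⇒≡1 (zero⇒∣ h)) (ℕ.nonTrivial⇒≢1 {{prime⇒nonTrivial prime}})

  cancelₘ : ∀ {a x y} → Unit P a → a * x ≡[ + P ] a * y → x ≡[ + P ] y
  cancelₘ {a} {x} {y} ua h = [ (λ a≡0 → contradiction a≡0 ua) , (λ e → lin₁ e 1ℤ (drop x y)) ]′
    (euclid a (x - y) (lin₁ h 1ℤ (factor a x y)))
    where
    factor : ∀ a x y → a * (x - y) - 0ℤ ≡ 1ℤ * (a * x - a * y)
    factor = solve-∀
    drop : ∀ x y → x - y ≡ 1ℤ * (x - y - 0ℤ)
    drop = solve-∀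

  inverse : ∀ a → Unit P a → ∃ λ v → a * v ≡[ + P ] 1ℤ
  inverse a ua with a %ℕ P in eq
  ... | zero = contradiction (≡ₘ-trans (residue P a) (≡ₘ-reflexive (cong +_ eq))) ua
  ... | r@(suc _) with Coprime.coprime-Bézout (Coprime.prime⇒coprime {n = r} prime (subst (ℕ._< P) eq (n%ℕd<d a P)))
  ... | GCD.Bézout.+- x y e = - + y ,
    ≡ₘ-trans (*-congₘ a≡r ≡ₘ-refl) (lin₀ (- + x)
      (trans (rearrange (+ r) (+ y)) (trans (cong (-_) cast) (ℤₚ.neg-distribˡ-* (+ x) (+ P)))))
    where
    a≡r : a ≡[ + P ] + r
    a≡r = ≡ₘ-trans (residue P a) (≡ₘ-reflexive (cong +_ eq))
    cast : 1ℤ + + y * + r ≡ + x * + P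
    cast = trans (cong (λ t → 1ℤ + t) (sym (ℤₚ.pos-* y r)))
             (trans (sym (ℤₚ.pos-+ 1 (y ℕ.* r))) (trans (cong +_ e) (ℤₚ.pos-* x P)))
    rearrange : ∀ r y → r * (- y) - 1ℤ ≡ - (1ℤ + y * r)
    rearrange = solve-∀
  ... | GCD.Bézout.-+ x y e = + y ,
    ≡ₘ-trans (*-congₘ a≡r ≡ₘ-refl) (lin₀ (+ x)
      (trans (cong (_- 1ℤ) (trans (ℤₚ.*-comm (+ r) (+ y)) (sym cast))) (rearrange (+ x) (+ P))))
    where
    a≡r : a ≡[ + P ] + r
    a≡r = ≡ₘ-trans (residue P a) (≡ₘ-reflexive (cong +_ eq))
    cast : 1ℤ + + x * + P ≡ + y * + r
    cast = trans (cong (λ t → 1ℤ + t) (sym (ℤₚ.pos-* x P)))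
             (trans (sym (ℤₚ.pos-+ 1 (x ℕ.* P))) (trans (cong +_ e) (ℤₚ.pos-* y r)))
    rearrange : ∀ x P → 1ℤ + x * P - 1ℤ ≡ x * P
    rearrange = solve-∀

-- Squares modulo a prime and the Legendre symbol

Sq : ℕ → ℤ → Set
Sq P a = ∃ λ x → x * x ≡[ + P ] a

any-true : ∀ {A : Set} (f : A → Bool) xs → any f xs ≡ true → ∃ λ x → f x ≡ true
any-true f (x ∷ xs) h with f x in eq
... | true = x , eq
... | false = any-true f xs h

any-∈ : ∀ {A : Set} (f : A → Bool) {xs x} → x ∈ xs → f x ≡ true → any f xs ≡ true
any-∈ f (here refl) e rewrite e = refl
any-∈ f {y ∷ _} (there h) e with f y
... | true = refl
... | false = any-∈ f h e

≡ᵇ-true : ∀ m n → (m ℕ.≡ᵇ n) ≡ true → m ≡ n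
≡ᵇ-true m n e = ℕₚ.≡ᵇ⇒≡ m n (subst T (sym e) tt)

≡ᵇ-refl : ∀ m → (m ℕ.≡ᵇ m) ≡ true
≡ᵇ-refl zero = refl
≡ᵇ-refl (suc m) = ≡ᵇ-refl m

-- The indices hold the values of `legendre` and of `isNR`, so that one match on the view settles
-- both together with their meaning.
data Legendre (a : ℤ) (P : ℕ) : ℤ → Bool → Set where
  isZero : a ≡[ + P ] 0ℤ → Legendre a P (+ 0) false
  isResidue : Unit P a → Sq P a → Legendre a P (+ 1) false
  isNonresidue : Unit P a → ¬ Sq P a → Legendre a P (-[1+ 0 ]) true

module _ (a : ℤ) (P : ℕ) .{{_ : NonZero P}} where

  private
    nonzero-unit : ((a %ℕ P) ℕ.≡ᵇ 0) ≡ false → Unit P a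
    nonzero-unit e a≡0 = case trans (sym e) (cong (ℕ._≡ᵇ 0) r≡0) of λ ()
      where
      r≡0 : a %ℕ P ≡ 0
      r≡0 = small-residues (n%ℕd<d a P) (ℕ.>-nonZero⁻¹ P) (≡ₘ-trans (≡ₘ-sym (residue P a)) a≡0)

    isSqMod-true : isSqMod (a %ℕ P) P ≡ true → Sq P a
    isSqMod-true e = let x , f = any-true _ (upTo P) e in
      + x , ≡ₘ-trans (≡ₘ-reflexive (sym (ℤₚ.pos-* x x)))
        (≡ₘ-trans (residue P (+ (x ℕ.* x)))
          (≡ₘ-trans (≡ₘ-reflexive (cong +_ (≡ᵇ-true _ _ f))) (≡ₘ-sym (residue P a))))

    isSqMod-false : isSqMod (a %ℕ P) P ≡ false → ¬ Sq P a
    isSqMod-false e (x , h) = case trans (sym e) (any-∈ _ (∈ₚ.∈-upTo⁺ (n%ℕd<d x P)) found) of λ ()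
      where
      r : ℕ
      r = x %ℕ P
      same : (r ℕ.* r) ℕ.% P ≡ a %ℕ P
      same = small-residues (n%ℕd<d (+ (r ℕ.* r)) P) (n%ℕd<d a P)
        (≡ₘ-trans (≡ₘ-sym (residue P (+ (r ℕ.* r)))) (≡ₘ-trans (≡ₘ-reflexive (ℤₚ.pos-* r r))
          (≡ₘ-trans (≡ₘ-sym (*-congₘ (residue P x) (residue P x))) (≡ₘ-trans h (residue P a)))))
      found : ((r ℕ.* r) ℕ.% P ℕ.≡ᵇ a %ℕ P) ≡ true
      found = trans (cong (ℕ._≡ᵇ (a %ℕ P)) same) (≡ᵇ-refl (a %ℕ P))

  legendre-view : Legendre a P (legendre a P) (isNR a P)
  legendre-view = unfold P refl
    where
    classify : ∀ b b′ → ((a %ℕ P) ℕ.≡ᵇ 0) ≡ b → isSqMod (a %ℕ P) P ≡ b′ →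
      let l = if b then + 0 else if b′ then + 1 else -[1+ 0 ] in
      Legendre a P l (does (l ≟ -[1+ 0 ]))
    classify true _ e _ = isZero (≡ₘ-trans (residue P a) (≡ₘ-reflexive (cong +_ (≡ᵇ-true _ 0 e))))
    classify false true e e′ = isResidue (nonzero-unit e) (isSqMod-true e′)
    classify false false e e′ = isNonresidue (nonzero-unit e) (isSqMod-false e′)
    -- `legendre` splits on its modulus first and reduces only when that is a successor; the modulus
    -- of the view stays fixed meanwhile.
    unfold : ∀ P′ → P ≡ P′ → Legendre a P (legendre a P′) (isNR a P′)
    unfold zero e = contradiction e (ℕ.≢-nonZero⁻¹ P)
    unfold (suc _) refl = classify _ _ refl refl

-- Sums modulo 2 and involutions

module ⊕ = MonoidSum (CommutativeRing.+-commutativeMonoid 𝔹ₚ.xor-∧-commutativeRing)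

oddᵇ : ℕ → Bool
oddᵇ zero = false
oddᵇ (suc n) = not (oddᵇ n)

count-parity : ∀ n → ⊕.sum {n} (λ _ → true) ≡ oddᵇ n
count-parity zero = refl
count-parity (suc n) = cong not (count-parity n)

sum-false : ∀ {n} (f : Fin n → Bool) → (∀ i → f i ≡ false) → ⊕.sum f ≡ false
sum-false {zero} f e = refl
sum-false {suc n} f e rewrite e Fin.zero = sum-false (f ∘ Fin.suc) (e ∘ Fin.suc)

-- The pairs {i, σ i} with i ≠ σ i cancel modulo 2.
involution-parity : ∀ {n} (σ : Fin n → Fin n) → (∀ i → σ (σ i) ≡ i) →
  oddᵇ n ≡ ⊕.sum (λ i → does (i Finₚ.≟ σ i))
involution-parity {n} σ σσ = begin
  oddᵇ n                                             ≡⟨ count-parity n ⟨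
  ⊕.sum {n} (λ _ → true)                             ≡⟨ ⊕.sum-cong-≗ trichotomy ⟩
  ⊕.sum (λ i → (below i xor above i) xor fixed i)    ≡⟨ ⊕.∑-distrib-+ (λ i → below i xor above i) fixed ⟩
  ⊕.sum (λ i → below i xor above i) xor ⊕.sum fixed  ≡⟨ cong (_xor ⊕.sum fixed) (⊕.∑-distrib-+ below above) ⟩
  (⊕.sum below xor ⊕.sum above) xor ⊕.sum fixed      ≡⟨ cong (λ b → (⊕.sum below xor b) xor ⊕.sum fixed) swap ⟩
  (⊕.sum below xor ⊕.sum below) xor ⊕.sum fixed      ≡⟨ cong (_xor ⊕.sum fixed) (𝔹ₚ.xor-same (⊕.sum below)) ⟩
  ⊕.sum fixed                                        ∎
  where
  open ≡-Reasoning
  below above fixed : Fin n → Bool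
  below i = does (i Finₚ.<? σ i)
  above i = does (σ i Finₚ.<? i)
  fixed i = does (i Finₚ.≟ σ i)
  trichotomy : ∀ i → true ≡ (below i xor above i) xor fixed i
  trichotomy i = go (i Finₚ.<? σ i) (σ i Finₚ.<? i) (i Finₚ.≟ σ i)
    where
    go : (a : Dec (i Fin.< σ i)) (b : Dec (σ i Fin.< i)) (c : Dec (i ≡ σ i)) →
         true ≡ (does a xor does b) xor does c
    go (yes a) (yes b) _       = contradiction b (ℕₚ.<-asym a)
    go (yes a) (no  _) (yes e) = contradiction a (Finₚ.<-irrefl e)
    go (yes _) (no  _) (no  _) = refl
    go (no  _) (yes b) (yes e) = contradiction b (Finₚ.<-irrefl (sym e))
    go (no  _) (yes _) (no  _) = refl
    go (no  _) (no  _) (yes _) = refl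
    go (no  a) (no  b) (no  c) = contradiction (Finₚ.≤-antisym (ℕₚ.≮⇒≥ b) (ℕₚ.≮⇒≥ a)) c
  swap : ⊕.sum above ≡ ⊕.sum below
  swap = trans (⊕.sum-permute above (Perm.permutation σ σ σσ σσ))
    (⊕.sum-cong-≗ (λ i → cong (λ j → does (j Finₚ.<? σ i)) (σσ i)))

odd-half : ∀ h → (suc (h ℕ.* 2) ℕ.% 4 ℕ.≡ᵇ 3) ≡ oddᵇ h
odd-half 0 = refl
odd-half 1 = refl
odd-half (suc (suc h)) = trans (odd-half h) (sym (𝔹ₚ.not-involutive (oddᵇ h)))

-- Quadratic residues

module OddPrime {P : ℕ} (prime : Prime P) (odd : P ℕ.% 2 ≡ 1) where

  private instance
    P≢0 : NonZero P
    P≢0 = prime⇒nonZero prime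

  half : ℕ
  half = P ℕ./ 2

  P≡1+2half : P ≡ suc (half ℕ.* 2)
  P≡1+2half = trans (ℕ%.m≡m%n+[m/n]*n P 2) (cong (ℕ._+ half ℕ.* 2) odd)

  P≡1+half+half : P ≡ suc (half ℕ.+ half)
  P≡1+half+half = trans P≡1+2half (cong suc (trans (ℕₚ.*-comm half 2) (cong (half ℕ.+_) (ℕₚ.+-identityʳ half))))

  half<P : half ℕ.< P
  half<P = subst (half ℕ.<_) (sym P≡1+half+half) (s≤s (ℕₚ.m≤m+n half half))

  Unit-2 : Unit P (+ 2)
  Unit-2 h with ℕ∣.∣⇒≤ (zero⇒∣ {+ 2} h) | ℕ.nonTrivial⇒n>1 P {{prime⇒nonTrivial prime}}
  ... | P≤2 | 1<P = case trans (sym odd) (cong (ℕ._% 2) (ℕₚ.≤-antisym P≤2 1<P)) of λ ()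

  -- As `P = 1 + half + half`, neither half of the residues contains both `x` and `P - x`. Hence
  -- squaring is injective on each half separately.
  lower-sum : ∀ {x y} → x ℕ.≤ half → y ℕ.≤ half → x ℕ.+ y ≢ P
  lower-sum x≤ y≤ e =
    ℕₚ.1+n≰n (subst (ℕ._≤ half ℕ.+ half) (trans e P≡1+half+half) (ℕₚ.+-mono-≤ x≤ y≤))

  upper-sum : ∀ {x y} → ¬ x ℕ.≤ half → ¬ y ℕ.≤ half → x ℕ.+ y ≢ P
  upper-sum {x} {y} x≰ y≰ e = ℕₚ.<-irrefl (sym (trans e P≡1+half+half))
    (ℕₚ.≤-trans (ℕₚ.≤-reflexive (cong suc (sym (ℕₚ.+-suc half half)))) (ℕₚ.+-mono-≤ (ℕₚ.≰⇒> x≰) (ℕₚ.≰⇒> y≰)))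

  zero⊎P : ∀ {s} → s ℕ.< P ℕ.+ P → + s ≡[ + P ] 0ℤ → s ≡ 0 ⊎ s ≡ P
  zero⊎P {s} s<2P h with zero⇒∣ {+ s} h
  ... | ℕ∣.divides 0 e = inj₁ e
  ... | ℕ∣.divides 1 e = inj₂ (trans e (ℕₚ.+-identityʳ P))
  ... | ℕ∣.divides (suc (suc k)) e = contradiction s<2P (ℕₚ.≤⇒≯ (subst (P ℕ.+ P ℕ.≤_) (sym e)
    (subst (ℕ._≤ P ℕ.+ (P ℕ.+ k ℕ.* P)) refl (ℕₚ.+-monoʳ-≤ P (ℕₚ.m≤m+n P (k ℕ.* P))))))

  equal-squares : ∀ {x y} → x ℕ.< P → y ℕ.< P → + x * + x ≡[ + P ] + y * + y → x ≡ y ⊎ x ℕ.+ y ≡ P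
  equal-squares {x} {y} x<P y<P h =
    [ (λ e → inj₁ (small-residues x<P y<P (lin₁ e 1ℤ (drop (+ x) (+ y)))))
    , (λ e → [ (λ z → inj₁ (trans (ℕₚ.m+n≡0⇒m≡0 x z) (sym (ℕₚ.m+n≡0⇒n≡0 x z)))) , inj₂ ]′
               (zero⊎P (ℕₚ.+-mono-< x<P y<P) e)) ]′
    (euclid prime (+ x - + y) (+ x + + y) (lin₁ h 1ℤ (factor (+ x) (+ y))))
    where
    drop : ∀ x y → x - y ≡ 1ℤ * (x - y - 0ℤ)
    drop = solve-∀
    factor : ∀ x y → (x - y) * (x + y) - 0ℤ ≡ 1ℤ * (x * x - y * y)
    factor = solve-∀

  -- Every class is x² or a x²: otherwise x ↦ x² on the lower half and
  -- x ↦ a x² on the upper half is injective but not surjective.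
  square⊎twisted : ∀ {a} → Unit P a → ¬ Sq P a → ∀ b → ∃ λ x → x * x ≡[ + P ] b ⊎ a * (x * x) ≡[ + P ] b
  square⊎twisted {a} ua nsq b = found (injective⇒surjectiveₘ P f f-injective b)
    where
    val : ∀ {A : Set} → Dec A → ℤ → ℤ
    val (yes _) x = x * x
    val (no _) x = a * (x * x)
    f : Fin P → ℤ
    f i = val (toℕ i ℕ.≤? half) (+ toℕ i)
    found : (∃ λ i → f i ≡[ + P ] b) → ∃ λ x → x * x ≡[ + P ] b ⊎ a * (x * x) ≡[ + P ] b
    found (i , e) = go (toℕ i ℕ.≤? half) e
      where
      go : ∀ {A : Set} (c : Dec A) → val c (+ toℕ i) ≡[ + P ] b → ∃ λ x → x * x ≡[ + P ] b ⊎ a * (x * x) ≡[ + P ] b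
      go (yes _) e = + toℕ i , inj₁ e
      go (no _) e = + toℕ i , inj₂ e
    mixed : ∀ {x y} → Unit P y → x * x ≡[ + P ] a * (y * y) → ⊥
    mixed {x} {y} uy e = let v , yv≡1 = inverse prime y uy in
      nsq (x * v , ≡ₘ-trans (lin₁ e (v * v) (expand x y v a)) (lin₁ yv≡1 (a * (y * v + 1ℤ)) (square a y v)))
      where
      expand : ∀ x y v a → x * v * (x * v) - a * (y * v * (y * v)) ≡ v * v * (x * x - a * (y * y))
      expand = solve-∀
      square : ∀ a y v → a * (y * v * (y * v)) - a ≡ a * (y * v + 1ℤ) * (y * v - 1ℤ)
      square = solve-∀
    large-unit : ∀ {i : Fin P} → ¬ toℕ i ℕ.≤ half → Unit P (+ toℕ i)
    large-unit {i} i≰ h = i≰ (subst (ℕ._≤ half)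
      (sym (small-residues (Finₚ.toℕ<n i) (ℕ.>-nonZero⁻¹ P) h)) z≤n)
    f-injective : ∀ i j → f i ≡[ + P ] f j → i ≡ j
    f-injective i j = go (toℕ i ℕ.≤? half) (toℕ j ℕ.≤? half)
      where
      go : (c : Dec (toℕ i ℕ.≤ half)) (c′ : Dec (toℕ j ℕ.≤ half)) →
           val c (+ toℕ i) ≡[ + P ] val c′ (+ toℕ j) → i ≡ j
      go (yes i≤) (yes j≤) h = [ Finₚ.toℕ-injective , (λ e → contradiction e (lower-sum i≤ j≤)) ]′
        (equal-squares (Finₚ.toℕ<n i) (Finₚ.toℕ<n j) h)
      go (yes _) (no j≰) h = ⊥-elim (mixed {+ toℕ i} {+ toℕ j} (large-unit {j} j≰) h)
      go (no i≰) (yes _) h = ⊥-elim (mixed {+ toℕ j} {+ toℕ i} (large-unit {i} i≰) (≡ₘ-sym h))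
      go (no i≰) (no j≰) h = [ Finₚ.toℕ-injective , (λ e → contradiction e (upper-sum i≰ j≰)) ]′
        (equal-squares (Finₚ.toℕ<n i) (Finₚ.toℕ<n j) (cancelₘ prime ua h))

  Sq-cong : ∀ {a b} → a ≡[ + P ] b → Sq P a → Sq P b
  Sq-cong e (x , h) = x , ≡ₘ-trans h e

  Sq-* : ∀ {a b} → Sq P a → Sq P b → Sq P (a * b)
  Sq-* (x , h) (y , h′) = x * y , ≡ₘ-trans (≡ₘ-reflexive (interchange x y)) (*-congₘ h h′)
    where
    interchange : ∀ x y → x * y * (x * y) ≡ x * x * (y * y)
    interchange = solve-∀

  Sq-cancel : ∀ {a b} → Unit P a → Sq P a → Sq P (a * b) → Sq P b
  Sq-cancel {a} {b} ua (x , h) (y , h′) = let v , av≡1 = inverse prime a ua in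
    x * y * v , ≡ₘ-trans (lin₂ h h′ (y * y * (v * v)) (a * (v * v)) (step₁ a b x y v))
      (lin₁ av≡1 (b * (a * v + 1ℤ)) (step₂ a b v))
    where
    step₁ : ∀ a b x y v → x * y * v * (x * y * v) - a * v * (a * v) * b ≡
      y * y * (v * v) * (x * x - a) + a * (v * v) * (y * y - a * b)
    step₁ = solve-∀
    step₂ : ∀ a b v → a * v * (a * v) * b - b ≡ b * (a * v + 1ℤ) * (a * v - 1ℤ)
    step₂ = solve-∀

  -- By `square⊎twisted` the nonsquare `b` is `a * x²`, and then `a * b` is `(a * x)²`.
  NR-* : ∀ {a b} → Unit P a → ¬ Sq P a → ¬ Sq P b → Sq P (a * b)
  NR-* {a} {b} ua na nb with square⊎twisted ua na b
  ... | x , inj₁ h = contradiction (x , h) nb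
  ... | x , inj₂ h = a * x , lin₁ h a (expand a b x)
    where
    expand : ∀ a b x → a * x * (a * x) - a * b ≡ a * (a * (x * x) - b)
    expand = solve-∀

  isNR-cases : ∀ a → Unit P a → (isNR a P ≡ false × Sq P a) ⊎ (isNR a P ≡ true × ¬ Sq P a)
  isNR-cases a ua with legendre a P | isNR a P | legendre-view a P
  ... | _ | _ | isZero z = contradiction z ua
  ... | _ | _ | isResidue _ s = inj₁ (refl , s)
  ... | _ | _ | isNonresidue _ n = inj₂ (refl , n)

  isNR-Sq : ∀ {a} → Unit P a → Sq P a → isNR a P ≡ false
  isNR-Sq {a} ua sq = [ proj₁ , (λ h → contradiction sq (proj₂ h)) ]′ (isNR-cases a ua)

  isNR-¬Sq : ∀ {a} → Unit P a → ¬ Sq P a → isNR a P ≡ true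
  isNR-¬Sq {a} ua nsq = [ (λ h → contradiction (proj₂ h) nsq) , proj₁ ]′ (isNR-cases a ua)

  Sq-isNR : ∀ {a} → Unit P a → isNR a P ≡ false → Sq P a
  Sq-isNR {a} ua e = [ proj₂ , (λ h → case trans (sym e) (proj₁ h) of λ ()) ]′ (isNR-cases a ua)

  isNR-* : ∀ a b → Unit P a → Unit P b → isNR (a * b) P ≡ isNR a P xor isNR b P
  isNR-* a b ua ub with isNR-cases a ua | isNR-cases b ub
  ... | inj₁ (e , sa) | inj₁ (e′ , sb) rewrite e | e′ = isNR-Sq (Unit-* prime ua ub) (Sq-* sa sb)
  ... | inj₁ (e , sa) | inj₂ (e′ , nb) rewrite e | e′ =
    isNR-¬Sq (Unit-* prime ua ub) (λ s → nb (Sq-cancel ua sa s))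
  ... | inj₂ (e , na) | inj₁ (e′ , sb) rewrite e | e′ =
    isNR-¬Sq (Unit-* prime ua ub) (λ s → na (Sq-cancel ub sb (Sq-cong (≡ₘ-reflexive (ℤₚ.*-comm a b)) s)))
  ... | inj₂ (e , na) | inj₂ (e′ , nb) rewrite e | e′ = isNR-Sq (Unit-* prime ua ub) (NR-* ua na nb)

  private
    -- Representatives `1, ..., half` of the units modulo sign. Such a class is determined by its
    -- square, and is handled through it below.
    rep : Fin half → ℤ
    rep i = + suc (toℕ i)

    rep<P : ∀ i → suc (toℕ i) ℕ.< P
    rep<P i = ℕₚ.≤-<-trans (Finₚ.toℕ<n i) half<P

    rep-unit : ∀ i → Unit P (rep i)
    rep-unit i h = case small-residues (rep<P i) (ℕ.>-nonZero⁻¹ P) h of λ ()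

    rep-unique : ∀ i j → rep i * rep i ≡[ + P ] rep j * rep j → i ≡ j
    rep-unique i j h = [ (λ e → Finₚ.toℕ-injective (ℕₚ.suc-injective e))
                       , (λ e → contradiction e (lower-sum (Finₚ.toℕ<n i) (Finₚ.toℕ<n j))) ]′
      (equal-squares (rep<P i) (rep<P j) h)

    rep-exists : ∀ z → Unit P z → ∃ λ i → rep i * rep i ≡[ + P ] z * z
    rep-exists z uz = choose (z %ℕ P) (n%ℕd<d z P) (residue P z)
      where
      fromPos : ∀ r → r ≢ 0 → r ℕ.≤ half → + r * + r ≡[ + P ] z * z → ∃ λ i → rep i * rep i ≡[ + P ] z * z
      fromPos zero r≢0 _ _ = contradiction refl r≢0
      fromPos (suc r) _ r< h = Fin.fromℕ< r< ,
        subst (λ k → + suc k * + suc k ≡[ + P ] z * z) (sym (Finₚ.toℕ-fromℕ< r<)) h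
      flip : ∀ P r z → (P - r) * (P - r) - z * z ≡ (P - r - r) * P + - (z + r) * (z - r)
      flip = solve-∀
      negate : ∀ r → r ℕ.≤ P → z ≡[ + P ] + r → + (P ℕ.∸ r) * + (P ℕ.∸ r) ≡[ + P ] z * z
      negate r r≤P h = subst (λ w → w * w ≡[ + P ] z * z)
        (trans (ℤₚ.m-n≡m⊖n P r) (ℤₚ.⊖-≥ r≤P))
        (lin₂ {A = + P} {B = 0ℤ} (1ℤ by sym (trans (ℤₚ.+-identityˡ _) (ℤₚ.*-identityˡ (+ P)))) h
          (+ P - + r - + r) (- (z + + r))
          (trans (flip (+ P) (+ r) z) (cong (λ t → (+ P - + r - + r) * t + - (z + + r) * (z - + r))
            (sym (ℤₚ.+-identityʳ (+ P))))))
      choose : ∀ r → r ℕ.< P → z ≡[ + P ] + r → ∃ λ i → rep i * rep i ≡[ + P ] z * z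
      choose r r<P h with r ℕ.≤? half
      ... | yes r≤ = fromPos r (λ { refl → uz h }) r≤ (≡ₘ-sym (*-congₘ h h))
      ... | no r≰ = fromPos (P ℕ.∸ r) (ℕₚ.m>n⇒m∸n≢0 r<P)
        (ℕₚ.+-cancelʳ-≤ r _ _ (ℕₚ.≤-trans (ℕₚ.≤-reflexive (trans (ℕₚ.m∸n+n≡m (ℕₚ.<⇒≤ r<P))
          (trans P≡1+half+half (sym (ℕₚ.+-suc half half)))))
          (ℕₚ.+-monoʳ-≤ half (ℕₚ.≰⇒> r≰))))
        (negate r (ℕₚ.<⇒≤ r<P) h)

    -- If `u² = -1`, multiplication by `u` is an involution on the units modulo sign. It negates
    -- squares, so a fixed class would satisfy `2 x² = 0`.
    half-even : Sq P -1ℤ → oddᵇ half ≡ false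
    half-even (u , uu≡-1) = trans (involution-parity σ σσ) (sum-false _ no-fixed)
      where
      u-unit : Unit P u
      u-unit u≡0 = Unit-1 prime (lin₂ u≡0 uu≡-1 (- u) 1ℤ (identity u))
        where
        identity : ∀ u → 1ℤ - 0ℤ ≡ - u * (u - 0ℤ) + 1ℤ * (u * u - -1ℤ)
        identity = solve-∀
      twist : ∀ i → ∃ λ j → rep j * rep j ≡[ + P ] u * rep i * (u * rep i)
      twist i = rep-exists (u * rep i) (Unit-* prime u-unit (rep-unit i))
      σ : Fin half → Fin half
      σ i = proj₁ (twist i)
      σ-neg : ∀ i → rep (σ i) * rep (σ i) ≡[ + P ] - (rep i * rep i)
      σ-neg i = ≡ₘ-trans (proj₂ (twist i)) (lin₁ uu≡-1 (rep i * rep i) (identity u (rep i)))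
        where
        identity : ∀ u x → u * x * (u * x) - - (x * x) ≡ x * x * (u * u - -1ℤ)
        identity = solve-∀
      σσ : ∀ i → σ (σ i) ≡ i
      σσ i = rep-unique _ _ (≡ₘ-trans (σ-neg (σ i))
        (≡ₘ-trans (neg-congₘ (σ-neg i)) (≡ₘ-reflexive (ℤₚ.neg-involutive _))))
      no-fixed : ∀ i → does (i Finₚ.≟ σ i) ≡ false
      no-fixed i = go (i Finₚ.≟ σ i)
        where
        identity : ∀ y → + 2 * y - 0ℤ ≡ 1ℤ * (y - - y)
        identity = solve-∀
        go : (c : Dec (i ≡ σ i)) → does c ≡ false
        go (no _) = refl
        go (yes e) = contradiction
          (lin₁ (subst (λ j → rep j * rep j ≡[ + P ] - (rep i * rep i)) (sym e) (σ-neg i)) 1ℤ (identity (rep i * rep i)))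
          (Unit-* prime Unit-2 (Unit-* prime (rep-unit i) (rep-unit i)))

    -- Inversion is an involution on the units modulo sign. A fixed class has `x⁴ = 1`, and since
    -- `x² = -1` is excluded, only the class of 1 is fixed.
    half-odd : ¬ Sq P -1ℤ → oddᵇ half ≡ true
    half-odd nsq = trans (involution-parity σ σσ) (only-first half refl)
      where
      inv : ∀ i → ∃ λ v → rep i * v ≡[ + P ] 1ℤ
      inv i = inverse prime (rep i) (rep-unit i)
      inv-unit : ∀ i → Unit P (proj₁ (inv i))
      inv-unit i v≡0 = Unit-1 prime (lin₂ v≡0 (proj₂ (inv i)) (rep i) -1ℤ (identity (rep i) (proj₁ (inv i))))
        where
        identity : ∀ x v → 1ℤ - 0ℤ ≡ x * (v - 0ℤ) + -1ℤ * (x * v - 1ℤ)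
        identity = solve-∀
      invert : ∀ i → ∃ λ j → rep j * rep j ≡[ + P ] proj₁ (inv i) * proj₁ (inv i)
      invert i = rep-exists (proj₁ (inv i)) (inv-unit i)
      σ : Fin half → Fin half
      σ i = proj₁ (invert i)
      σ-inv : ∀ i → rep (σ i) * rep (σ i) * (rep i * rep i) ≡[ + P ] 1ℤ
      σ-inv i = lin₂ (proj₂ (invert i)) (proj₂ (inv i)) (x * x) (x * v + 1ℤ) (identity y x v)
        where
        x = rep i
        v = proj₁ (inv i)
        y = rep (σ i)
        identity : ∀ y x v → y * y * (x * x) - 1ℤ ≡ x * x * (y * y - v * v) + (x * v + 1ℤ) * (x * v - 1ℤ)
        identity = solve-∀
      σσ : ∀ i → σ (σ i) ≡ i
      σσ i = rep-unique _ _ (cancelₘ prime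
        {x = rep (σ (σ i)) * rep (σ (σ i))} {y = rep i * rep i} (Unit-* prime (rep-unit (σ i)) (rep-unit (σ i)))
        (≡ₘ-trans (≡ₘ-reflexive (ℤₚ.*-comm (rep (σ i) * rep (σ i)) (rep (σ (σ i)) * rep (σ (σ i)))))
          (≡ₘ-trans (σ-inv (σ i)) (≡ₘ-sym (σ-inv i)))))
      fixed⇒1 : ∀ i → σ i ≡ i → rep i * rep i ≡[ + P ] 1ℤ * 1ℤ
      fixed⇒1 i e = [ (λ z → lin₁ z 1ℤ (minus y)) , (λ z → contradiction (rep i , lin₁ z 1ℤ (plus y)) nsq) ]′
        (euclid prime (y - 1ℤ) (y + 1ℤ) (lin₁ (subst (λ j → rep j * rep j * y ≡[ + P ] 1ℤ) e (σ-inv i)) 1ℤ (factor y)))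
        where
        y = rep i * rep i
        minus : ∀ y → y - 1ℤ * 1ℤ ≡ 1ℤ * (y - 1ℤ - 0ℤ)
        minus = solve-∀
        plus : ∀ y → y - -1ℤ ≡ 1ℤ * (y + 1ℤ - 0ℤ)
        plus = solve-∀
        factor : ∀ y → (y - 1ℤ) * (y + 1ℤ) - 0ℤ ≡ 1ℤ * (y * y - 1ℤ)
        factor = solve-∀
      1⇒fixed : ∀ i → rep i ≡ 1ℤ → i ≡ σ i
      1⇒fixed i e = rep-unique _ _ (≡ₘ-trans (≡ₘ-reflexive (cong (λ x → x * x) e))
        (≡ₘ-sym (≡ₘ-trans (≡ₘ-reflexive (sym (ℤₚ.*-identityʳ (rep (σ i) * rep (σ i)))))
          (subst (λ x → rep (σ i) * rep (σ i) * (x * x) ≡[ + P ] 1ℤ) e (σ-inv i)))))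
      half≢0 : half ≢ 0
      half≢0 e = contradiction (trans P≡1+2half (cong (λ h → suc (h ℕ.* 2)) e)) (ℕ.nonTrivial⇒≢1 {{prime⇒nonTrivial prime}})
      only-first : ∀ h → half ≡ h → ⊕.sum (λ i → does (i Finₚ.≟ σ i)) ≡ true
      only-first zero e = contradiction e half≢0
      only-first (suc h) e = go h e σ
        (λ i toℕ≡0 → 1⇒fixed i (cong (λ k → + suc k) toℕ≡0))
        (λ i e → 1+i≡1 i (equal-squares (rep<P i) (ℕ.nonTrivial⇒n>1 P {{prime⇒nonTrivial prime}}) (fixed⇒1 i (sym e))))
        where
        1+i≡1 : ∀ (i : Fin half) → suc (toℕ i) ≡ 1 ⊎ suc (toℕ i) ℕ.+ 1 ≡ P → toℕ i ≡ 0
        1+i≡1 i (inj₁ e) = ℕₚ.suc-injective e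
        1+i≡1 i (inj₂ e) = contradiction e (lower-sum (Finₚ.toℕ<n i) (ℕₚ.≤-trans (s≤s z≤n) (Finₚ.toℕ<n i)))
        -- `half` is a quotient and cannot be unified with `suc h`, so the count is stated for an
        -- arbitrary size `k`.
        go : ∀ {k} h → k ≡ suc h → (τ : Fin k → Fin k) → (∀ i → toℕ i ≡ 0 → i ≡ τ i) →
             (∀ i → i ≡ τ i → toℕ i ≡ 0) → ⊕.sum (λ i → does (i Finₚ.≟ τ i)) ≡ true
        go h refl τ fix fix⇒ with Fin.zero Finₚ.≟ τ Fin.zero
        ... | no n = contradiction (fix Fin.zero refl) n
        ... | yes _ = cong not (sum-false (λ i → does (Fin.suc i Finₚ.≟ τ (Fin.suc i))) rest)
          where
          rest : ∀ i → does (Fin.suc i Finₚ.≟ τ (Fin.suc i)) ≡ false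
          rest i with Fin.suc i Finₚ.≟ τ (Fin.suc i)
          ... | no _ = refl
          ... | yes f = case fix⇒ (Fin.suc i) f of λ ()

  -- `half` counts the units modulo sign, and the two involutions give its parity in terms of
  -- whether -1 is a square. On the other side `P = 1 + 2 half`.
  isNR-[-1] : isNR -1ℤ P ≡ (P ℕ.% 4 ℕ.≡ᵇ 3)
  isNR-[-1] = trans (by-cases (isNR-cases -1ℤ -1-unit))
    (trans (sym (odd-half half)) (cong (λ x → x ℕ.% 4 ℕ.≡ᵇ 3) (sym P≡1+2half)))
    where
    -1-unit : Unit P -1ℤ
    -1-unit h = Unit-1 prime (neg-congₘ h)
    by-cases : (isNR -1ℤ P ≡ false × Sq P -1ℤ) ⊎ (isNR -1ℤ P ≡ true × ¬ Sq P -1ℤ) → isNR -1ℤ P ≡ oddᵇ half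
    by-cases (inj₁ (e , s)) = trans e (sym (half-even s))
    by-cases (inj₂ (e , n)) = trans e (sym (half-odd n))

-- ℓ-adic points

quartic : (d c e X Z : ℤ) → ℤ
quartic d c e X Z = d * d * (Z * Z * (Z * Z)) + c * (X * X) * (Z * Z) + e * (X * X * (X * X))

module Powers (ℓ : ℕ) where

  -- Opaque powers of `ℓ`, which enter the ring identities as atoms; only the equations in this
  -- block are known of them.
  abstract
    L : ℕ → ℤ
    L k = + (ℓ ℕ.^ k)

    L-def : ∀ k → L k ≡ + (ℓ ℕ.^ k)
    L-def k = refl

    L-zero : L 0 ≡ 1ℤ
    L-zero = refl

    L-suc : ∀ k → L (suc k) ≡ + ℓ * L k
    L-suc k = ℤₚ.pos-* ℓ (ℓ ℕ.^ k)

    L-+ : ∀ a b → L (a ℕ.+ b) ≡ L a * L b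
    L-+ a b = trans (cong +_ (ℕₚ.^-distribˡ-+-* ℓ a b)) (ℤₚ.pos-* (ℓ ℕ.^ a) (ℓ ℕ.^ b))

  fromCongL : ∀ {x y} k → CongMod x y (ℓ ℕ.^ k) → x ≡[ L k ] y
  fromCongL {x} {y} k h = subst (λ M → x ≡[ M ] y) (sym (L-def k)) (fromCong h)

  toCongL : ∀ {x y} k → x ≡[ L k ] y → CongMod x y (ℓ ℕ.^ k)
  toCongL {x} {y} k h = toCong (subst (λ M → x ≡[ M ] y) (L-def k) h)

  L-coarsen : ∀ {x y} a b → x ≡[ L (a ℕ.+ b) ] y → x ≡[ L b ] y
  L-coarsen {x} {y} a b h = coarsenₘ {L a} (L b) (subst (λ M → x ≡[ M ] y) (L-+ a b) h)

  L-≤ : ∀ {x y a b} → b ℕ.≤ a → x ≡[ L a ] y → x ≡[ L b ] y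
  L-≤ {x} {y} {a} {b} b≤a h = L-coarsen (a ℕ.∸ b) b (subst (λ k → x ≡[ L k ] y) (sym (ℕₚ.m∸n+n≡m b≤a)) h)

  L-one : ∀ {x y} → x ≡[ L 1 ] y → x ≡[ + ℓ ] y
  L-one {x} {y} = subst (λ M → x ≡[ M ] y) (trans (L-def 1) (cong +_ (ℕₚ.*-identityʳ ℓ)))

  one-L : ∀ {x y} → x ≡[ + ℓ ] y → x ≡[ L 1 ] y
  one-L {x} {y} = subst (λ M → x ≡[ M ] y) (sym (trans (L-def 1) (cong +_ (ℕₚ.*-identityʳ ℓ))))

module LocalField (ℓ : ℕ) (d : ℤ) (p q m D : ℕ) where

  open Powers ℓ

  c e : ℤ
  c = - (+ 2 * + (p ℕ.+ q) * + D * d)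
  e = + (4 ℕ.^ m ℕ.* (D ℕ.* D))

  Φ : ℤ → ℤ → ℤ
  Φ = quartic d c e

  Compatible : (ℕ → ℤ) → Set
  Compatible y = ∀ k → CongMod (y (suc k)) (y k) (ℓ ℕ.^ k)

  private
    N : ℕ → ℤ
    N k = + (ℓ ℕ.^ k)

    double : ∀ a → L (a ℕ.+ a) ≡ L a * L a
    double a = L-+ a a

    square : ∀ a → N (a ℕ.+ a) ≡ L a * L a
    square a = trans (sym (L-def (a ℕ.+ a))) (double a)

    fourth : ∀ a → N ((a ℕ.+ a) ℕ.+ (a ℕ.+ a)) ≡ L a * L a * (L a * L a)
    fourth a = trans (sym (L-def _)) (trans (L-+ (a ℕ.+ a) (a ℕ.+ a)) (cong₂ _*_ (double a) (double a)))

    -- The right side of the curve equation acquires the denominator `ℓ^(6a)`: `_⊕_` multiplies the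
    -- denominators `ℓ^(2a)` and `ℓ^(4a)` of its summands instead of taking the larger.
    sixth : ∀ a → N ((a ℕ.+ a) ℕ.+ ((a ℕ.+ a) ℕ.+ (a ℕ.+ a))) ≡ L a * L a * (L a * L a * (L a * L a))
    sixth a = trans (sym (L-def _)) (trans (L-+ (a ℕ.+ a) _) (cong₂ _*_ (double a) (trans (L-def _) (fourth a))))

  -- The point is `z = X / ℓ^a`, `w = y * ℓ^γ / ℓ^(2a)`. The factor `ℓ^γ` takes care of an even
  -- power of `ℓ` that divides the quartic at `(X : ℓ^a)`.
  mkPoint : ∀ X a γ (y : ℕ → ℤ) → Compatible y →
    (∀ k → d * (y k * y k) * (L γ * L γ) ≡[ L k ] Φ X (L a)) → HasPoint (Qℓ ℓ) d p q m D
  mkPoint X a γ y compat h =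
    ((λ _ → X) , a) , ((λ k → y k * L γ) , a ℕ.+ a) , constant , scaled , equation
    where
    constant : ∀ k → CongMod X X (ℓ ℕ.^ k)
    constant k = toCongL {X} {X} k ≡ₘ-refl
    scaled : ∀ k → CongMod (y (suc k) * L γ) (y k * L γ) (ℓ ℕ.^ k)
    scaled k = toCongL {y (suc k) * L γ} {y k * L γ} k (*-congₘ (fromCongL {y (suc k)} {y k} k (compat k)) ≡ₘ-refl)
    identity : ∀ d c e X A y Γ →
      d * (y * Γ * (y * Γ)) * (A * A * (A * A * (A * A))) -
      ((d * d * (A * A) + c * (X * X) * 1ℤ) * (A * A * (A * A)) + e * (X * X * (X * X)) * (A * A)) * (A * A * (A * A))
      ≡ A * A * (A * A * (A * A)) *
        (d * (y * y) * (Γ * Γ) - (d * d * (A * A * (A * A)) + c * (X * X) * (A * A) + e * (X * X * (X * X))))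
    identity = solve-∀
    equation : ∀ k → CongMod
      (d * (y k * L γ * (y k * L γ)) * N ((a ℕ.+ a) ℕ.+ ((a ℕ.+ a) ℕ.+ (a ℕ.+ a))))
      (((d * d * N (a ℕ.+ a) + c * (X * X) * 1ℤ) * N ((a ℕ.+ a) ℕ.+ (a ℕ.+ a)) +
        e * (X * X * (X * X)) * N (a ℕ.+ a)) * N ((a ℕ.+ a) ℕ.+ (a ℕ.+ a)))
      (ℓ ℕ.^ k)
    equation k = subst₂ (λ u v → CongMod u v (ℓ ℕ.^ k))
      (cong (d * (y k * L γ * (y k * L γ)) *_) (sym (sixth a)))
      (cong₂ (λ u v → ((d * d * u + c * (X * X) * 1ℤ) * v + e * (X * X * (X * X)) * u) * v) (sym (square a)) (sym (fourth a)))
      (toCongL {d * (y k * L γ * (y k * L γ)) * (L a * L a * (L a * L a * (L a * L a)))}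
        {((d * d * (L a * L a) + c * (X * X) * 1ℤ) * (L a * L a * (L a * L a)) +
          e * (X * X * (X * X)) * (L a * L a)) * (L a * L a * (L a * L a))}
        k (lin₁ (h k) (L a * L a * (L a * L a * (L a * L a))) (identity d c e X (L a) (y k) (L γ))))

  pointEquation : HasPoint (Qℓ ℓ) d p q m D → .{{NonZero ℓ}} → ∃ λ a → ∃ λ b → ∀ K → ∃ λ X → ∃ λ Y →
    d * (Y * Y) * (L a * L a * (L a * L a)) ≡[ L K ] Φ X (L a) * (L b * L b)
  pointEquation ((x , a) , (y , b) , _ , _ , h) = a , b , λ K → x (a ℕ.+ a ℕ.+ K) , y (a ℕ.+ a ℕ.+ K) ,
    unscaleₘ (L a * L a) A²≢0 (remodulus (modulus K) (at (a ℕ.+ a ℕ.+ K)))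
    where
    A²≢0 : L a * L a ≢ 0ℤ
    A²≢0 z = ℕ.≢-nonZero⁻¹ (ℓ ℕ.^ (a ℕ.+ a)) {{ℕₚ.m^n≢0 ℓ (a ℕ.+ a)}} (ℤₚ.+-injective (trans (square a) z))
    modulus : ∀ K → L (a ℕ.+ a ℕ.+ K) ≡ L a * L a * L K
    modulus K = trans (L-+ (a ℕ.+ a) K) (cong (_* L K) (double a))
    identity : ∀ d c e X Y A B →
      A * A * (d * (Y * Y) * (A * A * (A * A))) -
      A * A * ((d * d * (A * A * (A * A)) + c * (X * X) * (A * A) + e * (X * X * (X * X))) * (B * B))
      ≡ 1ℤ * (d * (Y * Y) * (A * A * (A * A * (A * A))) -
      ((d * d * (A * A) + c * (X * X) * 1ℤ) * (A * A * (A * A)) + e * (X * X * (X * X)) * (A * A)) * (B * B))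
    identity = solve-∀
    raw : ∀ k → CongMod
      (d * (y k * y k) * N ((a ℕ.+ a) ℕ.+ ((a ℕ.+ a) ℕ.+ (a ℕ.+ a))))
      (((d * d * N (a ℕ.+ a) + c * (x k * x k) * 1ℤ) * N ((a ℕ.+ a) ℕ.+ (a ℕ.+ a)) +
        e * (x k * x k * (x k * x k)) * N (a ℕ.+ a)) * N (b ℕ.+ b))
      (ℓ ℕ.^ k)
    raw = h
    at : ∀ k → L a * L a * (d * (y k * y k) * (L a * L a * (L a * L a)))
      ≡[ L k ] L a * L a * (Φ (x k) (L a) * (L b * L b))
    at k = lin₁ cooked 1ℤ (identity d c e (x k) (y k) (L a) (L b))
      where
      cooked : d * (y k * y k) * (L a * L a * (L a * L a * (L a * L a))) ≡[ L k ]
        ((d * d * (L a * L a) + c * (x k * x k) * 1ℤ) * (L a * L a * (L a * L a)) +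
          e * (x k * x k * (x k * x k)) * (L a * L a)) * (L b * L b)
      cooked = subst₂ (λ u v → d * (y k * y k) * u ≡[ L k ] v) (sixth a)
        (cong₂ _*_ (cong₂ (λ u v → (d * d * u + c * (x k * x k) * 1ℤ) * v + e * (x k * x k * (x k * x k)) * u)
                     (square a) (fourth a)) (square b))
        (fromCongL {d * (y k * y k) * N ((a ℕ.+ a) ℕ.+ ((a ℕ.+ a) ℕ.+ (a ℕ.+ a)))}
          {((d * d * N (a ℕ.+ a) + c * (x k * x k) * 1ℤ) * N ((a ℕ.+ a) ℕ.+ (a ℕ.+ a)) +
            e * (x k * x k * (x k * x k)) * N (a ℕ.+ a)) * N (b ℕ.+ b)} k (raw k))

  module _ (prime : Prime ℓ) where

    private instance
      ℓ≢0 : NonZero ℓ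
      ℓ≢0 = prime⇒nonZero prime

    L≢0 : ∀ k → L k ≢ 0ℤ
    L≢0 k z = ℕ.≢-nonZero⁻¹ (ℓ ℕ.^ k) {{ℕₚ.m^n≢0 ℓ k}} (ℤₚ.+-injective (trans (sym (L-def k)) z))

    one-* : ∀ x → x ≡ L 0 * x
    one-* x = sym (trans (cong (_* x) L-zero) (ℤₚ.*-identityˡ x))

    leading-unit : ∀ {i u K} → suc i ℕ.≤ K → L i * u ≡[ L K ] 0ℤ → u ≡[ + ℓ ] 0ℤ
    leading-unit {i} {u} i<K h = unscaleₘ (L i) (L≢0 i) (subst₂ (λ M z → L i * u ≡[ M ] z)
      (trans (L-suc i) (ℤₚ.*-comm (+ ℓ) (L i))) (sym (ℤₚ.*-zeroʳ (L i))) (L-≤ i<K h))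

    L-vanish : ∀ {i j} u → i ℕ.≤ j → L j * u ≡[ L i ] 0ℤ
    L-vanish {i} {j} u i≤j = L-≤ i≤j (lin₀ u (trans (ℤₚ.+-identityʳ _) (ℤₚ.*-comm (L j) u)))

    -- Different valuations would make one of the units vanish modulo `ℓ`. Once the common power of
    -- `ℓ` is divided out, the three digits beyond it compare the unit parts.
    compare-valuations : ∀ {i j u w K} → Unit ℓ u → Unit ℓ w → 3 ℕ.+ j ℕ.≤ K →
      L i * u ≡[ L K ] L j * w → i ≡ j × u ≡[ L 3 ] w
    compare-valuations {i} {j} {u} {w} {K} uu uw j+3≤K h with ℕₚ.<-cmp i j
    ... | tri< i<j _ _ = contradiction
      (leading-unit {i} ℕₚ.≤-refl (≡ₘ-trans (L-≤ (ℕₚ.≤-trans i<j (ℕₚ.≤-trans (ℕₚ.m≤n+m j 3) j+3≤K)) h) (L-vanish w i<j))) uu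
    ... | tri> _ _ j<i = contradiction
      (leading-unit {j} ℕₚ.≤-refl (≡ₘ-trans (≡ₘ-sym (L-≤ (ℕₚ.≤-trans (ℕₚ.+-monoˡ-≤ j {1} {3} (s≤s z≤n)) j+3≤K) h))
        (L-vanish u j<i))) uw
    ... | tri≈ _ refl _ = refl , unscaleₘ (L i) (L≢0 i)
      (subst (λ M → L i * u ≡[ M ] L i * w) (trans (L-+ 3 i) (ℤₚ.*-comm (L 3) (L i))) (L-≤ j+3≤K h))

    -- At most `N` factors `ℓ` are extracted, which keeps the recursion structural and puts `Y = 0`
    -- under the first alternative.
    valuation : ∀ N Y → Y ≡[ L N ] 0ℤ ⊎ ∃ λ j → ∃ λ Y₀ → Unit ℓ Y₀ × Y ≡ L j * Y₀
    valuation zero Y = inj₁ (lin₀ Y (trans (ℤₚ.+-identityʳ Y) (sym (trans (cong (Y *_) L-zero) (ℤₚ.*-identityʳ Y)))))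
    valuation (suc N) Y with Y ≡ₘ? 0ℤ
    ... | no uY = inj₂ (0 , Y , uY , one-* Y)
    ... | yes (Y′ by e₁) with valuation N Y′
    ...   | inj₁ h = inj₁ (subst₂ (λ M y → y ≡[ M ] 0ℤ) (sym (L-suc N))
      (sym (trans e₁ (trans (ℤₚ.+-identityˡ _) (ℤₚ.*-comm Y′ (+ ℓ)))))
      (≡ₘ-trans (scaleₘ (+ ℓ) h) (≡ₘ-reflexive (ℤₚ.*-zeroʳ (+ ℓ)))))
    ...   | inj₂ (j , Y₀ , uY , e₂) = inj₂ (suc j , Y₀ , uY , trans e₁ (trans (ℤₚ.+-identityˡ _)
      (trans (cong (_* + ℓ) e₂) (trans (rearrange (L j) Y₀ (+ ℓ)) (cong (_* Y₀) (sym (L-suc j)))))))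
      where
      rearrange : ∀ x y z → x * y * z ≡ z * x * y
      rearrange = solve-∀

    normalize : ∀ a X → ∃ λ i → ∃ λ a′ → ∃ λ X′ → a ≡ i ℕ.+ a′ × X ≡ L i * X′ × (a′ ≡ 0 ⊎ Unit ℓ X′)
    normalize zero X = 0 , 0 , X , refl , one-* X , inj₁ refl
    normalize (suc a) X with X ≡ₘ? 0ℤ
    ... | no uX = 0 , suc a , X , refl , one-* X , inj₂ uX
    ... | yes (X₁ by e₁) with normalize a X₁
    ...   | i , a′ , X′ , e₂ , e₃ , norm = suc i , a′ , X′ , cong suc e₂ ,
      trans e₁ (trans (ℤₚ.+-identityˡ _) (trans (cong (_* + ℓ) e₃) (trans (rearrange (L i) X′ (+ ℓ))
        (cong (_* X′) (sym (L-suc i)))))) , norm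
      where
      rearrange : ∀ x y z → x * y * z ≡ z * x * y
      rearrange = solve-∀

    -- What solubility at ℓ says about the leading ℓ-adic term of the quartic.
    Matches : ℤ → ℕ → Set
    Matches X a = ∀ v U δ d′ → Φ X (L a) ≡ L v * U → Unit ℓ U → v ℕ.≤ 4 ℕ.* a ℕ.+ 4 →
      d ≡ L δ * d′ → Unit ℓ d′ → oddᵇ v ≡ oddᵇ δ × ∃ λ y → d′ * (y * y) ≡[ L 3 ] U

    oddᵇ-+2 : ∀ n k → oddᵇ (n ℕ.+ (k ℕ.+ k)) ≡ oddᵇ n
    oddᵇ-+2 n zero = cong oddᵇ (ℕₚ.+-identityʳ n)
    oddᵇ-+2 n (suc k) = trans (cong oddᵇ (trans (cong (n ℕ.+_) (cong suc (ℕₚ.+-suc k k)))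
      (trans (ℕₚ.+-suc n (suc (k ℕ.+ k))) (cong suc (ℕₚ.+-suc n (k ℕ.+ k))))))
      (trans (𝔹ₚ.not-involutive _) (oddᵇ-+2 n k))

    -- The factors `Y²`, `ℓ^(2t)` and `ℓ^(2g)` change valuations by even amounts only, so the
    -- parities of `v` and `δ` agree. The unit part of `Y` is the required `y`.
    match-leading : ∀ {K Y U d′} v δ t g → Unit ℓ U → Unit ℓ d′ → d ≡ L δ * d′ → 3 ℕ.+ (v ℕ.+ (g ℕ.+ g)) ℕ.≤ K →
      d * (Y * Y) * (L t * L t) ≡[ L K ] L v * U * (L g * L g) →
      oddᵇ v ≡ oddᵇ δ × ∃ λ y → d′ * (y * y) ≡[ L 3 ] U
    match-leading {K} {Y} {U} {d′} v δ t g uU ud′ d≡ bound h = go (valuation K Y)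
      where
      G : ℕ
      G = v ℕ.+ (g ℕ.+ g)
      right : L v * U * (L g * L g) ≡ L G * U
      right = trans (rearrange (L v) U (L g)) (cong (_* U) (sym (trans (L-+ v (g ℕ.+ g)) (cong (L v *_) (double g)))))
        where
        rearrange : ∀ v U g → v * U * (g * g) ≡ v * (g * g) * U
        rearrange = solve-∀
      go : Y ≡[ L K ] 0ℤ ⊎ (∃ λ j → ∃ λ Y₀ → Unit ℓ Y₀ × Y ≡ L j * Y₀) →
        oddᵇ v ≡ oddᵇ δ × ∃ λ y → d′ * (y * y) ≡[ L 3 ] U
      go (inj₁ z) = contradiction
        (leading-unit {G} (ℕₚ.≤-trans (ℕₚ.+-monoˡ-≤ G {1} {3} (s≤s z≤n)) bound)
          (≡ₘ-trans (≡ₘ-reflexive (sym right)) (≡ₘ-trans (≡ₘ-sym h) (lin₁ z (d * Y * (L t * L t)) (identity d Y (L t)))))) uU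
        where
        identity : ∀ d Y t → d * (Y * Y) * (t * t) - 0ℤ ≡ d * Y * (t * t) * (Y - 0ℤ)
        identity = solve-∀
      go (inj₂ (j , Y₀ , uY₀ , refl)) = let i≡G , cong₃ = compare-valuations {δ ℕ.+ (j ℕ.+ t ℕ.+ (j ℕ.+ t))} {G}
                                              (Unit-* prime ud′ (Unit-* prime uY₀ uY₀)) uU bound
                                              (≡ₘ-trans (≡ₘ-reflexive (sym left)) (≡ₘ-trans h (≡ₘ-reflexive right)))
                                        in trans (sym (oddᵇ-+2 v g)) (trans (cong oddᵇ (sym i≡G)) (oddᵇ-+2 δ (j ℕ.+ t))) ,
                                          Y₀ , cong₃
        where
        rearrange : ∀ δ d j Y t → δ * d * (j * Y * (j * Y)) * (t * t) ≡ δ * (j * t * (j * t)) * (d * (Y * Y))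
        rearrange = solve-∀
        left : d * (L j * Y₀ * (L j * Y₀)) * (L t * L t) ≡ L (δ ℕ.+ (j ℕ.+ t ℕ.+ (j ℕ.+ t))) * (d′ * (Y₀ * Y₀))
        left = trans (cong (λ x → x * (L j * Y₀ * (L j * Y₀)) * (L t * L t)) d≡)
          (trans (rearrange (L δ) d′ (L j) Y₀ (L t)) (cong (_* (d′ * (Y₀ * Y₀)))
            (sym (trans (L-+ δ _) (cong (L δ *_) (trans (double (j ℕ.+ t)) (cong₂ _*_ (L-+ j t) (L-+ j t))))))))

    point-matches : HasPoint (Qℓ ℓ) d p q m D → ∃ λ X → ∃ λ a → (a ≡ 0 ⊎ Unit ℓ X) × Matches X a
    point-matches pt = let a , b , sol = pointEquation pt
                           K = 4 ℕ.* a ℕ.+ 4 ℕ.+ (b ℕ.+ b) ℕ.+ 3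
                           X , Y , h = sol K
                           i , a′ , X′ , a≡ , X≡ , norm = normalize a X
                       in X′ , a′ , norm , λ v U δ d′ Φ≡ uU v≤ d≡ ud′ →
                         match-leading {Y = Y} v δ (a ℕ.+ a) (i ℕ.+ i ℕ.+ b) uU ud′ d≡
                           (bound a a′ i b v a≡ v≤)
                           (≡ₘ-trans (≡ₘ-reflexive (cong (λ s → d * (Y * Y) * s) (cong₂ _*_ (double a) (double a))))
                             (≡ₘ-trans h (≡ₘ-reflexive (transfer X X′ a a′ i b v U X≡ a≡ Φ≡))))
      where
      bound : ∀ a a′ i b v → a ≡ i ℕ.+ a′ → v ℕ.≤ 4 ℕ.* a′ ℕ.+ 4 →
        3 ℕ.+ (v ℕ.+ (i ℕ.+ i ℕ.+ b ℕ.+ (i ℕ.+ i ℕ.+ b))) ℕ.≤ 4 ℕ.* a ℕ.+ 4 ℕ.+ (b ℕ.+ b) ℕ.+ 3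
      bound a a′ i b v refl v≤ = ℕₚ.≤-trans
        (ℕₚ.+-monoʳ-≤ 3 (ℕₚ.+-monoˡ-≤ (i ℕ.+ i ℕ.+ b ℕ.+ (i ℕ.+ i ℕ.+ b)) v≤))
        (ℕₚ.≤-reflexive (rearrange a′ i b))
        where
        rearrange : ∀ a i b → 3 ℕ.+ (4 ℕ.* a ℕ.+ 4 ℕ.+ (i ℕ.+ i ℕ.+ b ℕ.+ (i ℕ.+ i ℕ.+ b))) ≡
          4 ℕ.* (i ℕ.+ a) ℕ.+ 4 ℕ.+ (b ℕ.+ b) ℕ.+ 3
        rearrange = ℕSolver.solve-∀
      transfer : ∀ X X′ a a′ i b v U → X ≡ L i * X′ → a ≡ i ℕ.+ a′ → Φ X′ (L a′) ≡ L v * U →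
        Φ X (L a) * (L b * L b) ≡ L v * U * (L (i ℕ.+ i ℕ.+ b) * L (i ℕ.+ i ℕ.+ b))
      transfer X X′ a a′ i b v U refl refl Φ≡ = begin
        Φ (L i * X′) (L (i ℕ.+ a′)) * (L b * L b)   ≡⟨ cong (λ z → Φ (L i * X′) z * (L b * L b)) (L-+ i a′) ⟩
        Φ (L i * X′) (L i * L a′) * (L b * L b)     ≡⟨ homogeneous d c e X′ (L a′) (L i) (L b) ⟩
        Φ X′ (L a′) * (L i * L i * L b * (L i * L i * L b))  ≡⟨ cong₂ _*_ Φ≡ (cong (λ z → z * z) (sym power)) ⟩
        L v * U * (L (i ℕ.+ i ℕ.+ b) * L (i ℕ.+ i ℕ.+ b))    ∎
        where
        open ≡-Reasoning
        power : L (i ℕ.+ i ℕ.+ b) ≡ L i * L i * L b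
        power = trans (L-+ (i ℕ.+ i) b) (cong (_* L b) (double i))
        homogeneous : ∀ d c e X A I B →
          (d * d * (I * A * (I * A) * (I * A * (I * A))) + c * (I * X * (I * X)) * (I * A * (I * A)) +
            e * (I * X * (I * X) * (I * X * (I * X)))) * (B * B) ≡
          (d * d * (A * A * (A * A)) + c * (X * X) * (A * A) + e * (X * X * (X * X))) * (I * I * B * (I * I * B))
        homogeneous = solve-∀

-- Lifting solutions of `d y² = A`

module Hensel (ℓ : ℕ) where

  open Powers ℓ

  -- Newton's iteration with the fixed inverse v of the derivative 2 d w₀.
  module _ (prime : Prime ℓ) (odd : ℓ ℕ.% 2 ≡ 1) {d A w₀ : ℤ} (ud : Unit ℓ d) (uA : Unit ℓ A)
           (start : d * (w₀ * w₀) ≡[ + ℓ ] A) where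

    private
      w₀-unit : Unit ℓ w₀
      w₀-unit z = uA (lin₂ start z -1ℤ (d * w₀) (identity d w₀ A))
        where
        identity : ∀ d w A → A - 0ℤ ≡ -1ℤ * (d * (w * w) - A) + d * w * (w - 0ℤ)
        identity = solve-∀

      slope : ∃ λ v → + 2 * d * w₀ * v ≡[ + ℓ ] 1ℤ
      slope = inverse prime (+ 2 * d * w₀) (Unit-* prime (Unit-* prime (OddPrime.Unit-2 prime odd) ud) w₀-unit)

      v : ℤ
      v = proj₁ slope

      root : ℕ → ℤ
      root zero = w₀
      root (suc k) = root k + v * (A - d * (root k * root k))

      -- The second component keeps `v` an inverse of the derivative at `root k` modulo `ℓ`.
      Invariant : ℕ → Set
      Invariant k = A - d * (root k * root k) ≡[ L (suc k) ] 0ℤ × root k ≡[ + ℓ ] w₀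

      step : ∀ k → Invariant k → Invariant (suc k)
      step k (h@(s by e) , r≡w₀) = error , close
        where
        y : ℤ
        y = root k
        h₁ : A - d * (y * y) ≡[ + ℓ ] 0ℤ
        h₁ = L-one (L-≤ (s≤s z≤n) h)
        close : y + v * (A - d * (y * y)) ≡[ + ℓ ] w₀
        close = lin₂ r≡w₀ h₁ 1ℤ v (identity y v w₀ (A - d * (y * y)))
          where
          identity : ∀ y v w E → y + v * E - w ≡ 1ℤ * (y - w) + v * (E - 0ℤ)
          identity = solve-∀
        slope-y : 1ℤ - + 2 * d * y * v ≡[ + ℓ ] 0ℤ
        slope-y = lin₂ (proj₂ slope) r≡w₀ -1ℤ (- (+ 2 * d * v)) (identity d w₀ v y)
          where
          identity : ∀ d w v y → 1ℤ - + 2 * d * y * v - 0ℤ ≡ -1ℤ * (+ 2 * d * w * v - 1ℤ) + - (+ 2 * d * v) * (y - w)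
          identity = solve-∀
        error : A - d * ((y + v * (A - d * (y * y))) * (y + v * (A - d * (y * y)))) ≡[ L (suc (suc k)) ] 0ℤ
        error = remodulus (sym (L-suc (suc k))) (finish slope-y)
          where
          -- With the old error `E` the new one is `E (1 - 2 d y v) - d v² E²`. The first term gains
          -- a factor `ℓ` from `slope-y`, the second from `E²`.
          expand : ∀ A d y v → A - d * ((y + v * (A - d * (y * y))) * (y + v * (A - d * (y * y)))) ≡
            (A - d * (y * y)) * (1ℤ - + 2 * d * y * v) - d * v * v * ((A - d * (y * y)) * (A - d * (y * y)))
          expand = solve-∀
          collect : ∀ d v s t l M → (0ℤ + s * (l * M)) * (0ℤ + t * l) - d * v * v * ((0ℤ + s * (l * M)) * (0ℤ + s * (l * M))) ≡
            0ℤ + (s * t - d * v * v * s * s * M) * (l * (l * M))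
          collect = solve-∀
          finish : 1ℤ - + 2 * d * y * v ≡[ + ℓ ] 0ℤ → A - d * ((y + v * (A - d * (y * y))) * (y + v * (A - d * (y * y))))
            ≡[ + ℓ * L (suc k) ] 0ℤ
          finish (t by e′) = s * t - d * v * v * s * s * L k by
            trans (expand A d y v)
              (trans (cong₂ (λ E S → E * S - d * v * v * (E * E)) (trans e (cong (λ M → 0ℤ + s * M) (L-suc k))) e′)
                (trans (collect d v s t (+ ℓ) (L k)) (cong (λ M → 0ℤ + (s * t - d * v * v * s * s * L k) * (+ ℓ * M))
                  (sym (L-suc k)))))

      invariant : ∀ k → Invariant k
      invariant zero = one-L (lin₁ start -1ℤ (identity A (d * (w₀ * w₀)))) , ≡ₘ-refl
        where
        identity : ∀ A x → A - x - 0ℤ ≡ -1ℤ * (x - A)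
        identity = solve-∀
      invariant (suc k) = step k (invariant k)

    abstract
      hensel-odd : ∃ λ (y : ℕ → ℤ) → (∀ k → CongMod (y (suc k)) (y k) (ℓ ℕ.^ k)) × (∀ k → d * (y k * y k) ≡[ L k ] A)
      hensel-odd = root , (λ k → toCongL {root (suc k)} {root k} k (compatible k)) , solves
        where
        compatible : ∀ k → root (suc k) ≡[ L k ] root k
        compatible k = lin₁ (L-coarsen 1 k (proj₁ (invariant k))) v (identity (root k) v (A - d * (root k * root k)))
          where
          identity : ∀ y v E → y + v * E - y ≡ v * (E - 0ℤ)
          identity = solve-∀
        solves : ∀ k → d * (root k * root k) ≡[ L k ] A
        solves k = lin₁ (L-coarsen 1 k (proj₁ (invariant k))) -1ℤ (identity A (d * (root k * root k)))
          where
          identity : ∀ A x → x - A ≡ -1ℤ * (A - x - 0ℤ)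
          identity = solve-∀

module Hensel₂ {d A : ℤ} (d-odd : d ≡[ + 2 ] 1ℤ) (A≡d : A ≡[ + 8 ] d) where

  open Powers 2

  private
    L₃ : L 3 ≡ + 8
    L₃ = L-def 3

    -- The derivative `2 d w` has valuation exactly 1, so a root known modulo `2^(2+k)` goes with an
    -- error known modulo `2^(3+k)`.
    State : ℕ → Set
    State k = ∃ λ w → w ≡[ + 2 ] 1ℤ × A - d * (w * w) ≡[ L (3 ℕ.+ k) ] 0ℤ

    four : ∀ k → L (2 ℕ.+ k) ≡ + 4 * L k
    four k = trans (L-+ 2 k) (cong (_* L k) (L-def 2))

    eight : ∀ k → L (3 ℕ.+ k) ≡ + 8 * L k
    eight k = trans (L-+ 3 k) (cong (_* L k) (L-def 3))

    -- For the error `s * 2^(3+k)` the root is corrected by `s * 2^(2+k)`. This leaves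
    -- `s (1 - d w) * 2^(3+k)` and a square divisible by `2^(4+k)`; as `d w` is odd, a further
    -- factor 2 appears.
    next : ∀ k → State k → State (suc k)
    next k (w , w-odd , (s by e)) = w + s * L (2 ℕ.+ k) , odd w-odd , error d-odd w-odd
      where
      odd : w ≡[ + 2 ] 1ℤ → w + s * L (2 ℕ.+ k) ≡[ + 2 ] 1ℤ
      odd h = lin₂ h (L-even) 1ℤ s (identity w s (L (2 ℕ.+ k)))
        where
        identity : ∀ w s M → w + s * M - 1ℤ ≡ 1ℤ * (w - 1ℤ) + s * (M - 0ℤ)
        identity = solve-∀
        half : ∀ M → + 4 * M - 0ℤ ≡ + 2 * M * + 2
        half = solve-∀
        L-even : L (2 ℕ.+ k) ≡[ + 2 ] 0ℤ
        L-even = lin₀ (+ 2 * L k) (trans (cong (_- 0ℤ) (four k)) (half (L k)))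
      error : d ≡[ + 2 ] 1ℤ → w ≡[ + 2 ] 1ℤ →
        A - d * ((w + s * L (2 ℕ.+ k)) * (w + s * L (2 ℕ.+ k))) ≡[ L (4 ℕ.+ k) ] 0ℤ
      error (t by e₁) (u by e₂) = - (s * (u + t + + 2 * t * u)) - d * s * s * L k by
        trans (split A d w (s * L (2 ℕ.+ k)))
          (trans (cong₂ (λ E h → E - + 2 * d * w * h - d * (h * h)) (trans e (cong (λ M → 0ℤ + s * M) (eight k)))
            (cong (s *_) (four k)))
            (trans (cong₂ (λ d′ w′ → 0ℤ + s * (+ 8 * L k) - + 2 * d′ * w′ * (s * (+ 4 * L k)) - d *
              (s * (+ 4 * L k) * (s * (+ 4 * L k)))) e₁ e₂)
              (trans (collect d s t u (L k)) (cong (λ M → 0ℤ + (- (s * (u + t + + 2 * t * u)) - d * s * s * L k) * M)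
                (sym sixteen)))))
        where
        sixteen : L (4 ℕ.+ k) ≡ + 16 * L k
        sixteen = trans (L-+ 4 k) (cong (_* L k) (L-def 4))
        split : ∀ A d w h → A - d * ((w + h) * (w + h)) ≡ A - d * (w * w) - + 2 * d * w * h - d * (h * h)
        split = solve-∀
        collect : ∀ d s t u K → 0ℤ + s * (+ 8 * K) - + 2 * (1ℤ + t * + 2) * (1ℤ + u * + 2) * (s * (+ 4 * K)) - d *
          (s * (+ 4 * K) * (s * (+ 4 * K))) ≡
          0ℤ + (- (s * (u + t + + 2 * t * u)) - d * s * s * K) * (+ 16 * K)
        collect = solve-∀

    state : ∀ k → State k
    state zero = 1ℤ , ≡ₘ-refl , remodulus (sym L₃) (lin₁ A≡d 1ℤ (identity A d))
      where
      identity : ∀ A d → A - d * (1ℤ * 1ℤ) - 0ℤ ≡ 1ℤ * (A - d)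
      identity = solve-∀
    state (suc k) = next k (state k)

  abstract
    hensel₂ : ∃ λ (y : ℕ → ℤ) → (∀ k → CongMod (y (suc k)) (y k) (2 ℕ.^ k)) × (∀ k → d * (y k * y k) ≡[ L k ] A)
    hensel₂ = y , (λ k → toCongL {y (suc k)} {y k} k (compatible k)) , solves
      where
      y : ℕ → ℤ
      y k = proj₁ (state k)
      compatible : ∀ k → y (suc k) ≡[ L k ] y k
      compatible k with state k
      ... | w , _ , (s by _) = lin₀ (s * + 4) (trans (cong (λ M → w + s * M - w) (four k)) (identity w s (L k)))
        where
        identity : ∀ w s M → w + s * (+ 4 * M) - w ≡ s * + 4 * M
        identity = solve-∀
      solves : ∀ k → d * (y k * y k) ≡[ L k ] A
      solves k = lin₁ (L-coarsen 3 k (proj₂ (proj₂ (state k)))) -1ℤ (identity A (d * (y k * y k)))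
        where
        identity : ∀ A x → x - A ≡ -1ℤ * (A - x - 0ℤ)
        identity = solve-∀

module LocalPoints (ℓ : ℕ) (d : ℤ) (p q m D : ℕ) where

  open Powers ℓ
  open LocalField ℓ d p q m D

  -- `D₀` is a common factor of `d` and of the quartic, below one of `1`, `ℓ` and `2`. Dividing by
  -- it leaves an equation with unit coefficients, to which the lifting applies.
  from-root : ∀ X a γ D₀ {d′ A} → d ≡ D₀ * d′ → Φ X (L a) ≡ D₀ * (L γ * L γ) * A →
    (∃ λ (y : ℕ → ℤ) → Compatible y × (∀ k → d′ * (y k * y k) ≡[ L k ] A)) → HasPoint (Qℓ ℓ) d p q m D
  from-root X a γ D₀ {d′} {A} d≡ Φ≡ (y , compat , h) = mkPoint X a γ y compat λ k →
    ≡ₘ-trans (≡ₘ-reflexive (cong (λ x → x * (y k * y k) * (L γ * L γ)) d≡))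
      (≡ₘ-trans (lin₁ (h k) (D₀ * (L γ * L γ)) (identity D₀ d′ (y k) (L γ) A)) (≡ₘ-reflexive (sym Φ≡)))
    where
    identity : ∀ D₀ d y Γ A → D₀ * d * (y * y) * (Γ * Γ) - D₀ * (Γ * Γ) * A ≡ D₀ * (Γ * Γ) * (d * (y * y) - A)
    identity = solve-∀

  point-odd : Prime ℓ → ℓ ℕ.% 2 ≡ 1 → ∀ X a γ D₀ d′ A w₀ → d ≡ D₀ * d′ → Φ X (L a) ≡ D₀ * (L γ * L γ) * A →
    Unit ℓ d′ → Unit ℓ A → d′ * (w₀ * w₀) ≡[ + ℓ ] A → HasPoint (Qℓ ℓ) d p q m D
  point-odd pr odd X a γ D₀ d′ A w₀ d≡ Φ≡ ud uA h =
    from-root X a γ D₀ d≡ Φ≡ (Hensel.hensel-odd ℓ pr odd {d′} {A} {w₀} ud uA h)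

module DyadicPoints (d : ℤ) (p q m D : ℕ) where

  open Powers 2
  open LocalField 2 d p q m D

  point-2 : ∀ X a γ D₀ d′ A → d ≡ D₀ * d′ → Φ X (L a) ≡ D₀ * (L γ * L γ) * A →
    d′ ≡[ + 2 ] 1ℤ → A ≡[ + 8 ] d′ → HasPoint (Qℓ 2) d p q m D
  point-2 X a γ D₀ d′ A d≡ Φ≡ d-odd h =
    LocalPoints.from-root 2 d p q m D X a γ D₀ d≡ Φ≡ (Hensel₂.hensel₂ d-odd h)

-- Local conditions at odd primes

-- The quartic in terms of `P = p` and `T = 2^m`: here `P + T` is `q` and `T²` is `4^m`.
poly : (d P T D X Z : ℤ) → ℤ
poly d P T D X Z = quartic d (- (+ 2 * (P + (P + T)) * D * d)) (T * T * (D * D)) X Z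

-- The derivative of `poly` in `X` at `Z = 1`.
poly′ : (d P T D X : ℤ) → ℤ
poly′ d P T D X = + 2 * - (+ 2 * (P + (P + T)) * D * d) * X + + 4 * (T * T * (D * D)) * (X * X * X)

module OddModulus {ℓ : ℕ} (prime : Prime ℓ) (odd : ℓ ℕ.% 2 ≡ 1) where

  open OddPrime prime odd public

  private instance
    ℓ≢0 : NonZero ℓ
    ℓ≢0 = prime⇒nonZero prime

  infixr 7 _·_
  _·_ : ∀ {a b} → Unit ℓ a → Unit ℓ b → Unit ℓ (a * b)
  _·_ = Unit-* prime

  Unit-4 : Unit ℓ (+ 4)
  Unit-4 = Unit-2 · Unit-2

  Unit-cong : ∀ {a b} → a ≡[ + ℓ ] b → Unit ℓ b → Unit ℓ a
  Unit-cong h ub a≡0 = ub (≡ₘ-trans (≡ₘ-sym h) a≡0)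

  Sq-twist : ∀ {d y s} → Unit ℓ s → d * (y * y) ≡[ + ℓ ] s * s → Sq ℓ d
  Sq-twist {d} {y} {s} us h = let v , sv≡1 = inverse prime s us in
    d * y * v , lin₂ h sv≡1 (d * v * v) (d * (s * v + 1ℤ)) (identity d y s v)
    where
    identity : ∀ d y s v → d * y * v * (d * y * v) - d ≡ d * v * v * (d * (y * y) - s * s) + d * (s * v + 1ℤ) * (s * v - 1ℤ)
    identity = solve-∀

  Sq-scale : ∀ {a b s} → Unit ℓ s → a * (s * s) ≡[ + ℓ ] b * b → Sq ℓ a
  Sq-scale {a} {b} {s} us h = let v , sv≡1 = inverse prime s us in
    b * v , lin₂ h sv≡1 (- (v * v)) (a * (s * v + 1ℤ)) (identity a b s v)
    where
    identity : ∀ a b s v → b * v * (b * v) - a ≡ - (v * v) * (a * (s * s) - b * b) + a * (s * v + 1ℤ) * (s * v - 1ℤ)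
    identity = solve-∀

  module _ {d P T D : ℤ} (uP : Unit ℓ P) (uQ : Unit ℓ (P + T)) (uD : Unit ℓ D) (ud : Unit ℓ d) where

    root-unit : ∀ {X} → poly d P T D X 1ℤ ≡[ + ℓ ] 0ℤ → Unit ℓ X
    root-unit {X} h X≡0 = (ud · ud) (lin₂ h X≡0 1ℤ (- (- (+ 2 * (P + (P + T)) * D * d) * X + T * T * (D * D) * (X * X * X)))
      (identity d P T D X))
      where
      identity : ∀ d P T D X → d * d - 0ℤ ≡ 1ℤ * ((d * d * (1ℤ * 1ℤ * (1ℤ * 1ℤ)) + - (+ 2 * (P + (P + T)) * D * d) *
        (X * X) * (1ℤ * 1ℤ) + T * T * (D * D) * (X * X * (X * X))) - 0ℤ) +
        - (- (+ 2 * (P + (P + T)) * D * d) * X + T * T * (D * D) * (X * X * X)) * (X - 0ℤ)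
      identity = solve-∀

    -- With `w = d - T D X²` and `w′ = d + T D X²` one has `2 w w′ = 2 F - X F′`, so `w` or `w′`
    -- vanishes at a multiple root. The conic form built on it then forces `4 P D d X²` or
    -- `4 (P + T) D d X²` to vanish.
    derivative-unit : ∀ {X} → poly d P T D X 1ℤ ≡[ + ℓ ] 0ℤ → Unit ℓ (poly′ d P T D X)
    derivative-unit {X} h h′ =
      [ (λ w≡0 → (Unit-4 · uP · uD · ud · uX · uX) (lin₂ w≡0 h w -1ℤ (minus d P T D X)))
      , (λ w≡0 → (Unit-4 · uQ · uD · ud · uX · uX) (lin₂ w≡0 h w′ -1ℤ (plus d P T D X))) ]′
      (euclid prime w w′ (cancelₘ prime Unit-2 (lin₂ h′ h (- X) (+ 2) (combine d P T D X))))
      where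
      uX : Unit ℓ X
      uX = root-unit {X} h
      w w′ : ℤ
      w = d - T * D * (X * X)
      w′ = d + T * D * (X * X)
      combine : ∀ d P T D X → + 2 * ((d - T * D * (X * X)) * (d + T * D * (X * X))) - + 2 * 0ℤ ≡
        - X * ((+ 2 * - (+ 2 * (P + (P + T)) * D * d) * X + + 4 * (T * T * (D * D)) * (X * X * X)) - 0ℤ) + + 2 *
          ((d * d * (1ℤ * 1ℤ * (1ℤ * 1ℤ)) + - (+ 2 * (P + (P + T)) * D * d) * (X * X) * (1ℤ * 1ℤ) + T * T *
          (D * D) * (X * X * (X * X))) - 0ℤ)
      combine = solve-∀
      minus : ∀ d P T D X → + 4 * (P * (D * (d * (X * X)))) - 0ℤ ≡
        (d - T * D * (X * X)) * (d - T * D * (X * X) - 0ℤ) + -1ℤ *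
          ((d * d * (1ℤ * 1ℤ * (1ℤ * 1ℤ)) + - (+ 2 * (P + (P + T)) * D * d) * (X * X) * (1ℤ * 1ℤ) + T * T *
          (D * D) * (X * X * (X * X))) - 0ℤ)
      minus = solve-∀
      plus : ∀ d P T D X → + 4 * ((P + T) * (D * (d * (X * X)))) - 0ℤ ≡
        (d + T * D * (X * X)) * (d + T * D * (X * X) - 0ℤ) + -1ℤ *
          ((d * d * (1ℤ * 1ℤ * (1ℤ * 1ℤ)) + - (+ 2 * (P + (P + T)) * D * d) * (X * X) * (1ℤ * 1ℤ) + T * T *
          (D * D) * (X * X * (X * X))) - 0ℤ)
      plus = solve-∀

  -- Taylor expansion gives `F (X + N k) = N (g + k F′(X)) + N² R`, so `k = (t - g) / F′(X)`
  -- prescribes the class `t` of the cofactor of `N`.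
  lift-root : ∀ d P T D {X} N g t → N ≡[ + ℓ ] 0ℤ → Unit ℓ (poly′ d P T D X) → poly d P T D X 1ℤ ≡ N * g →
    ∃ λ X₁ → ∃ λ A → poly d P T D X₁ 1ℤ ≡ N * A × A ≡[ + ℓ ] t × X₁ ≡[ + ℓ ] X
  lift-root d P T D {X} N g t N≡0 u e = let v , fv≡1 = inverse prime (poly′ d P T D X) u
                                            k = (t - g) * v
                                            R = - (+ 2 * (P + (P + T)) * D * d) * k * k + T * T * (D * D) *
                                              (+ 6 * X * X * k * k + + 4 * X * k * k * k * N + k * k * k * k * N * N)
                                        in X + N * k , g + k * poly′ d P T D X + N * R ,
    trans (taylor d P T D X N k) (trans (cong (λ z → z + N * (k * poly′ d P T D X + N * R)) e)
      (factor N g (k * poly′ d P T D X) (N * R))) ,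
    lin₂ fv≡1 N≡0 (t - g) R (target t g v (poly′ d P T D X) N R) ,
    lin₁ N≡0 k (shift X N k)
    where
    taylor : ∀ d P T D X N k → (d * d * (1ℤ * 1ℤ * (1ℤ * 1ℤ)) + - (+ 2 * (P + (P + T)) * D * d) *
      ((X + N * k) * (X + N * k)) * (1ℤ * 1ℤ) + T * T * (D * D) * ((X + N * k) * (X + N * k) * ((X + N * k) * (X + N * k)))) ≡
      (d * d * (1ℤ * 1ℤ * (1ℤ * 1ℤ)) + - (+ 2 * (P + (P + T)) * D * d) * (X * X) * (1ℤ * 1ℤ) + T * T * (D * D) *
      (X * X * (X * X))) + N * (k * (+ 2 * - (+ 2 * (P + (P + T)) * D * d) * X + + 4 * (T * T * (D * D)) * (X * X * X)) + N *
      (- (+ 2 * (P + (P + T)) * D * d) * k * k + T * T * (D * D) * (+ 6 * X * X * k * k + + 4 * X * k * k *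
        k * N + k * k * k * k * N * N)))
    taylor = solve-∀
    factor : ∀ N g a b → N * g + N * (a + b) ≡ N * (g + a + b)
    factor = solve-∀
    target : ∀ t g v f N R → g + (t - g) * v * f + N * R - t ≡ (t - g) * (f * v - 1ℤ) + R * (N - 0ℤ)
    target = solve-∀
    shift : ∀ X N k → X + N * k - X ≡ k * (N - 0ℤ)
    shift = solve-∀

  poly-cong : ∀ d P T D {X Y} → X ≡[ + ℓ ] Y → poly d P T D X 1ℤ ≡[ + ℓ ] poly d P T D Y 1ℤ
  poly-cong d P T D {X} {Y} h = lin₁ h (- (+ 2 * (P + (P + T)) * D * d) * (X + Y) + T * T * (D * D) * (X + Y) * (X * X + Y * Y))
    (identity d P T D X Y)
    where
    identity : ∀ d P T D X Y → (d * d * (1ℤ * 1ℤ * (1ℤ * 1ℤ)) + - (+ 2 * (P + (P + T)) * D * d) * (X * X) *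
      (1ℤ * 1ℤ) + T * T * (D * D) * (X * X * (X * X))) - (d * d * (1ℤ * 1ℤ * (1ℤ * 1ℤ)) + - (+ 2 * (P + (P + T)) * D * d) *
      (Y * Y) * (1ℤ * 1ℤ) + T * T * (D * D) * (Y * Y * (Y * Y))) ≡
      (- (+ 2 * (P + (P + T)) * D * d) * (X + Y) + T * T * (D * D) * (X + Y) * (X * X + Y * Y)) * (X - Y)
    identity = solve-∀

  -- If every value of the quartic were a nonzero square y², with y chosen to be
  -- an odd function of X, then X ↦ y - T D X² would be injective, as the conic
  -- is parametrised by this slope; but it misses the value -(2P + T) d / T.
  not-all-squares : ∀ {d P T D} → Unit ℓ P → Unit ℓ (P + T) → Unit ℓ T → Unit ℓ D → Unit ℓ d →
    ¬ ((x : ℕ) → ∃ λ y → Unit ℓ y × y * y ≡[ + ℓ ] poly d P T D (+ x) 1ℤ)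
  not-all-squares {d} {P} {T} {D} uP uQ uT uD ud sq =
    let v , Tv≡1 = inverse prime T uT
        i , hit = injective⇒surjectiveₘ ℓ slope slope-injective (- ((P + (P + T)) * d) * v)
    in missed i (lin₂ hit Tv≡1 T (- ((P + (P + T)) * d)) (clear (slope i) P T d v))
    where
    clear : ∀ s P T d v → T * s - - ((P + (P + T)) * d) ≡ T * (s - - ((P + (P + T)) * d) * v) + - ((P + (P + T)) * d) *
      (T * v - 1ℤ)
    clear = solve-∀
    y : ∀ {x} → Dec (x ℕ.≤ half) → ℤ
    y {x} (yes _) = proj₁ (sq x)
    y {x} (no _) = - proj₁ (sq (ℓ ℕ.∸ x))
    y-square : ∀ {x} → x ℕ.< ℓ → (c : Dec (x ℕ.≤ half)) → y c * y c ≡[ + ℓ ] poly d P T D (+ x) 1ℤ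
    y-square {x} _ (yes _) = proj₂ (proj₂ (sq x))
    y-square {x} x<ℓ (no _) = ≡ₘ-trans (≡ₘ-reflexive (square-neg (proj₁ (sq (ℓ ℕ.∸ x)))))
      (≡ₘ-trans (proj₂ (proj₂ (sq (ℓ ℕ.∸ x)))) (≡ₘ-trans (poly-cong d P T D {+ (ℓ ℕ.∸ x)} { - + x} (lin₀ 1ℤ shift))
        (≡ₘ-reflexive (even d P T D (+ x)))))
      where
      square-neg : ∀ y → - y * - y ≡ y * y
      square-neg = solve-∀
      even : ∀ d P T D X → (d * d * (1ℤ * 1ℤ * (1ℤ * 1ℤ)) + - (+ 2 * (P + (P + T)) * D * d) * ((- X) * (- X)) *
        (1ℤ * 1ℤ) + T * T * (D * D) * ((- X) * (- X) * ((- X) * (- X)))) ≡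
        (d * d * (1ℤ * 1ℤ * (1ℤ * 1ℤ)) + - (+ 2 * (P + (P + T)) * D * d) * (X * X) * (1ℤ * 1ℤ) + T * T *
        (D * D) * (X * X * (X * X)))
      even = solve-∀
      cancel : ∀ l x → l - x - - x ≡ 1ℤ * l
      cancel = solve-∀
      shift : + (ℓ ℕ.∸ x) - - + x ≡ 1ℤ * + ℓ
      shift = trans (cong (λ z → z - - + x) (sym (trans (ℤₚ.m-n≡m⊖n ℓ x) (ℤₚ.⊖-≥ (ℕₚ.<⇒≤ x<ℓ))))) (cancel (+ ℓ) (+ x))
    y-unit : ∀ {x} (c : Dec (x ℕ.≤ half)) → Unit ℓ (y c)
    y-unit {x} (yes _) = proj₁ (proj₂ (sq x))
    y-unit {x} (no _) h = proj₁ (proj₂ (sq (ℓ ℕ.∸ x))) (lin₁ h -1ℤ (negate (proj₁ (sq (ℓ ℕ.∸ x)))))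
      where
      negate : ∀ y → y - 0ℤ ≡ -1ℤ * (- y - 0ℤ)
      negate = solve-∀
    y-odd : ∀ {x x′} → x ℕ.+ x′ ≡ ℓ → (c : Dec (x ℕ.≤ half)) (c′ : Dec (x′ ℕ.≤ half)) → y c ≡ - y c′
    y-odd {x} {x′} e (yes a) (yes b) = contradiction e (lower-sum a b)
    y-odd {x} {x′} e (yes _) (no _) = trans (cong (λ k → proj₁ (sq k)) (sym (trans (cong (ℕ._∸ x′) (sym e)) (ℕₚ.m+n∸n≡m x x′))))
      (sym (ℤₚ.neg-involutive _))
    y-odd {x} {x′} e (no _) (yes _) = cong (λ k → - proj₁ (sq k)) (trans (cong (ℕ._∸ x) (sym e)) (ℕₚ.m+n∸m≡n x x′))
    y-odd {x} {x′} e (no a) (no b) = contradiction e (upper-sum a b)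
    low? : ∀ (i : Fin ℓ) → Dec (toℕ i ℕ.≤ half)
    low? i = toℕ i ℕ.≤? half
    slopeAt : ℤ → ℤ → ℤ
    slopeAt X Y = Y - T * D * (X * X)
    slope : Fin ℓ → ℤ
    slope i = slopeAt (+ toℕ i) (y (low? i))
    -- λ² + 2 X² D (T λ + (2P + T) d) = d² for λ = y - T D X².
    conic : ∀ X Y → Y * Y ≡[ + ℓ ] poly d P T D X 1ℤ →
      slopeAt X Y * slopeAt X Y + + 2 * D * (T * slopeAt X Y + (P + (P + T)) * d) * (X * X) ≡[ + ℓ ] d * d
    conic X Y h = lin₁ h 1ℤ (identity d P T D X Y)
      where
      identity : ∀ d P T D X Y → (Y - T * D * (X * X)) * (Y - T * D * (X * X)) + + 2 * D *
        (T * (Y - T * D * (X * X)) + (P + (P + T)) * d) * (X * X) - d * d ≡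
        1ℤ * (Y * Y - (d * d * (1ℤ * 1ℤ * (1ℤ * 1ℤ)) + - (+ 2 * (P + (P + T)) * D * d) * (X * X) * (1ℤ * 1ℤ)
          + T * T * (D * D) * (X * X * (X * X))))
      identity = solve-∀
    -- At this slope the coefficient of `X²` in `conic` vanishes and leaves `λ² = d²`. Hence
    -- `(2P + T)² = T²`, that is, `4 P (P + T) = 0`.
    missed-at : ∀ X Y → Y * Y ≡[ + ℓ ] poly d P T D X 1ℤ → ¬ (T * slopeAt X Y ≡[ + ℓ ] - ((P + (P + T)) * d))
    missed-at X Y h hit = (Unit-4 · uP · uQ · ud · ud) (lin₂ (conic X Y h) hit (T * T)
        (- ((T * s - b) + + 2 * D * (T * T) * (X * X))) (identity d P T D X s))
      where
      s b : ℤ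
      s = slopeAt X Y
      b = (P + (P + T)) * d
      identity : ∀ d P T D X s → + 4 * (P * ((P + T) * (d * d))) - 0ℤ ≡
        T * T * (s * s + + 2 * D * (T * s + (P + (P + T)) * d) * (X * X) - d * d) +
        - ((T * s - (P + (P + T)) * d) + + 2 * D * (T * T) * (X * X)) * (T * s - - ((P + (P + T)) * d))
      identity = solve-∀
    missed : ∀ i → ¬ (T * slope i ≡[ + ℓ ] - ((P + (P + T)) * d))
    missed i = missed-at (+ toℕ i) (y (low? i)) (y-square (Finₚ.toℕ<n i) (low? i))
    -- Away from the missed slope, `conic` is linear in `X²` with a unit coefficient, so the slope
    -- determines `X²`.
    same-square : ∀ X Y X′ Y′ → Y * Y ≡[ + ℓ ] poly d P T D X 1ℤ → Y′ * Y′ ≡[ + ℓ ] poly d P T D X′ 1ℤ →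
      slopeAt X Y ≡[ + ℓ ] slopeAt X′ Y′ → X * X ≡[ + ℓ ] X′ * X′
    same-square X Y X′ Y′ h h′ e = cancelₘ prime (Unit-2 · uD · u)
      (lin₂ (≡ₘ-trans (conic X Y h) (≡ₘ-sym (conic X′ Y′ h′))) e 1ℤ
        (- (s + s′ + + 2 * D * T * (X′ * X′))) (identity d P T D X X′ s s′))
      where
      s s′ : ℤ
      s = slopeAt X Y
      s′ = slopeAt X′ Y′
      u : Unit ℓ (T * s + (P + (P + T)) * d)
      u z = missed-at X Y h (lin₁ z 1ℤ (move (T * s) ((P + (P + T)) * d)))
        where
        move : ∀ a b → a - - b ≡ 1ℤ * (a + b - 0ℤ)
        move = solve-∀
      identity : ∀ d P T D X X′ s s′ →
        + 2 * (D * (T * s + (P + (P + T)) * d)) * (X * X) - + 2 * (D * (T * s + (P + (P + T)) * d)) * (X′ * X′) ≡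
        1ℤ * (s * s + + 2 * D * (T * s + (P + (P + T)) * d) * (X * X) - (s′ * s′ + + 2 * D * (T * s′ + (P + (P + T)) * d) *
          (X′ * X′))) +
        - (s + s′ + + 2 * D * T * (X′ * X′)) * (s - s′)
      identity = solve-∀
    -- If the two indices are opposite modulo `ℓ`, the oddness of `y` turns equality of the slopes
    -- into `2 y = 0`.
    slope-injective : ∀ i j → slope i ≡[ + ℓ ] slope j → i ≡ j
    slope-injective i j e = [ Finₚ.toℕ-injective , (λ sum≡ℓ → contradiction (doubled (y-odd sum≡ℓ (low? i) (low? j)))
      (Unit-2 · y-unit (low? j))) ]′
      (equal-squares (Finₚ.toℕ<n i) (Finₚ.toℕ<n j) squares)
      where
      squares : + toℕ i * + toℕ i ≡[ + ℓ ] + toℕ j * + toℕ j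
      squares = same-square (+ toℕ i) (y (low? i)) (+ toℕ j) (y (low? j))
        (y-square (Finₚ.toℕ<n i) (low? i)) (y-square (Finₚ.toℕ<n j) (low? j)) e
      doubled : y (low? i) ≡ - y (low? j) → + 2 * y (low? j) ≡[ + ℓ ] 0ℤ
      doubled eq = lin₂ (subst (λ z → slopeAt (+ toℕ i) z ≡[ + ℓ ] slope j) eq e) squares -1ℤ (- (T * D))
        (identity (+ toℕ i) (+ toℕ j) (y (low? j)) T D)
        where
        identity : ∀ x x′ y T D → + 2 * y - 0ℤ ≡ -1ℤ * (- y - T * D * (x * x) - (y - T * D * (x′ * x′))) + - (T * D) *
          (x * x - x′ * x′)
        identity = solve-∀

module OddConditions {ℓ : ℕ} (prime : Prime ℓ) (odd : ℓ ℕ.% 2 ≡ 1) (p q m Dₙ : ℕ) (d P T D : ℤ)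
  (Φ≡poly : ∀ X Z → LocalField.Φ ℓ d p q m Dₙ X Z ≡ poly d P T D X Z) where

  open OddModulus prime odd
  open Powers ℓ
  open LocalField ℓ d p q m Dₙ
  open LocalPoints ℓ d p q m Dₙ

  private
    instance
      ℓ≢0 : NonZero ℓ
      ℓ≢0 = prime⇒nonZero prime

    Point : Set
    Point = HasPoint (Qℓ ℓ) d p q m Dₙ

    L₀ : L 0 ≡ 1ℤ
    L₀ = L-zero

    L₁ : L 1 ≡ + ℓ
    L₁ = trans (L-suc 0) (trans (cong (+ ℓ *_) L₀) (ℤₚ.*-identityʳ (+ ℓ)))

    L₂ : L 2 ≡ + ℓ * + ℓ
    L₂ = trans (L-suc 1) (cong (+ ℓ *_) L₁)

    ℓ≡0 : + ℓ ≡[ + ℓ ] 0ℤ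
    ℓ≡0 = lin₀ 1ℤ (trans (ℤₚ.+-identityʳ (+ ℓ)) (sym (ℤₚ.*-identityˡ (+ ℓ))))

    one : ∀ x → x ≡ L 0 * x
    one = one-* prime

    Φ-at-1 : ∀ X → Φ X (L 0) ≡ poly d P T D X 1ℤ
    Φ-at-1 X = trans (Φ≡poly X (L 0)) (cong (poly d P T D X) L₀)

    match-even : Unit ℓ d → ∀ X a → Matches prime X a → ∀ v U → Φ X (L a) ≡ L v * U → Unit ℓ U → v ℕ.≤ 4 →
      oddᵇ v ≡ false × ∃ λ y → d * (y * y) ≡[ + ℓ ] U
    match-even ud X a M v U e uU v≤4 = let parity , y , h = M v U 0 d e uU (ℕₚ.≤-trans v≤4 (ℕₚ.m≤n+m 4 (4 ℕ.* a))) (one d) ud in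
      parity , y , L-one (L-≤ (s≤s z≤n) h)

    match-odd : ∀ {d′} → d ≡ + ℓ * d′ → Unit ℓ d′ → ∀ X a → Matches prime X a → ∀ v U → Φ X (L a) ≡ L v * U → Unit ℓ U → v ℕ.≤ 4 →
      oddᵇ v ≡ true
    match-odd {d′} d≡ ud′ X a M v U e uU v≤4 =
      proj₁ (M v U 1 d′ e uU (ℕₚ.≤-trans v≤4 (ℕₚ.m≤n+m 4 (4 ℕ.* a))) (trans d≡ (cong (_* d′) (sym L₁))) ud′)

    L-divisible : ∀ a → L (suc a) ≡[ + ℓ ] 0ℤ
    L-divisible a = lin₁ ℓ≡0 (L a) (trans (cong (_- 0ℤ) (L-suc a)) (identity (+ ℓ) (L a)))
      where
      identity : ∀ l M → l * M - 0ℤ ≡ M * (l - 0ℤ)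
      identity = solve-∀

  -- At `X = 0`, `Z = 1` the quartic is `d²`, and a square root of `d` serves as `w`.
  residue-point : Unit ℓ d → Sq ℓ d → Point
  residue-point ud (w , h) = point-odd prime odd 0ℤ 0 0 1ℤ d (d * d) w (sym (ℤₚ.*-identityˡ d))
    (trans (Φ-at-1 0ℤ) (trans (identity d P T D) (cong (λ z → 1ℤ * (z * z) * (d * d)) (sym L₀)))) ud (ud · ud)
    (*-congₘ {u = w * w} {d} (≡ₘ-refl {x = d}) h)
    where
    identity : ∀ d P T D → (d * d * (1ℤ * 1ℤ * (1ℤ * 1ℤ)) + - (+ 2 * (P + (P + T)) * D * d) * (0ℤ * 0ℤ) *
      (1ℤ * 1ℤ) + T * T * (D * D) * (0ℤ * 0ℤ * (0ℤ * 0ℤ))) ≡ 1ℤ * (1ℤ * 1ℤ) * (d * d)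
    identity = solve-∀

  -- For `X` a unit the term `T² D² X⁴` dominates; otherwise `Z = 1` and `d²` dominates, with
  -- valuation 2. Both valuations are even, whereas that of `d w²` is odd.
  ramified-no-point : ∀ {d′} → d ≡ + ℓ * d′ → Unit ℓ d′ → Unit ℓ T → Unit ℓ D → ¬ Point
  ramified-no-point {d′} d≡ ud′ uT uD pt = let X , a , norm , M = point-matches prime pt in go X a norm M (X ≡ₘ? 0ℤ)
    where
    go : ∀ X a → a ≡ 0 ⊎ Unit ℓ X → Matches prime X a → Dec (X ≡[ + ℓ ] 0ℤ) → ⊥
    go X a norm M (no uX) = case match-odd d≡ ud′ X a M 0 (Φ X (L a)) (one _) unit z≤n of λ ()
      where
      d≡0 : d ≡[ + ℓ ] 0ℤ
      d≡0 = lin₁ ℓ≡0 d′ (trans (cong (_- 0ℤ) d≡) (identity (+ ℓ) d′))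
        where
        identity : ∀ l d → l * d - 0ℤ ≡ d * (l - 0ℤ)
        identity = solve-∀
      identity : ∀ d P T D X Z → (d * d * (Z * Z * (Z * Z)) + - (+ 2 * (P + (P + T)) * D * d) * (X * X) *
        (Z * Z) + T * T * (D * D) * (X * X * (X * X))) - T * T * (D * D) * (X * X * (X * X)) ≡
        (d * (Z * Z * (Z * Z)) + - (+ 2 * (P + (P + T)) * D) * (X * X) * (Z * Z)) * (d - 0ℤ)
      identity = solve-∀
      unit : Unit ℓ (Φ X (L a))
      unit = Unit-cong (≡ₘ-trans (≡ₘ-reflexive (Φ≡poly X (L a)))
        (lin₁ d≡0 (d * (L a * L a * (L a * L a)) + - (+ 2 * (P + (P + T)) * D) * (X * X) * (L a * L a))
          (identity d P T D X (L a))))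
        (((uT · uT) · (uD · uD)) · ((uX · uX) · (uX · uX)))
    go X a (inj₂ uX) M (yes X≡0) = uX X≡0
    go X .0 (inj₁ refl) M (yes (X₁ by e)) = case match-odd d≡ ud′ X 0 M 2 U value unit (s≤s (s≤s z≤n)) of λ ()
      where
      U : ℤ
      U = d′ * d′ + + ℓ * (- (+ 2 * (P + (P + T)) * D * d′) * (X₁ * X₁) + T * T * (D * D) * (X₁ * X₁ * (X₁ * X₁)) * + ℓ)
      identity : ∀ l d P T D X → ((l * d) * (l * d) * (1ℤ * 1ℤ * (1ℤ * 1ℤ)) + - (+ 2 * (P + (P + T)) * D * (l * d)) *
        ((X * l) * (X * l)) * (1ℤ * 1ℤ) + T * T * (D * D) * ((X * l) * (X * l) * ((X * l) * (X * l)))) ≡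
        l * l * (d * d + l * (- (+ 2 * (P + (P + T)) * D * d) * (X * X) + T * T * (D * D) * (X * X * (X * X)) * l))
      identity = solve-∀
      value : Φ X (L 0) ≡ L 2 * U
      value = trans (Φ-at-1 X) (trans (cong₂ (λ d X → poly d P T D X 1ℤ) d≡ (trans e (ℤₚ.+-identityˡ (X₁ * + ℓ))))
        (trans (identity (+ ℓ) d′ P T D X₁) (cong (_* U) (sym L₂))))
      unit : Unit ℓ U
      unit = Unit-cong (lin₁ ℓ≡0 (- (+ 2 * (P + (P + T)) * D * d′) * (X₁ * X₁) + T * T * (D * D) * (X₁ * X₁ * (X₁ * X₁)) * + ℓ)
        (drop (d′ * d′) (+ ℓ) _)) (ud′ · ud′)
        where
        drop : ∀ x l y → x + l * y - x ≡ y * (l - 0ℤ)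
        drop = solve-∀

  -- At ℓ = p and ℓ = q the quartic is a square minus ℓ times a product.
  conic-residue : ∀ σ R → (∀ X Z → poly d P T D X Z ≡
      (d * (Z * Z) + σ * (X * X)) * (d * (Z * Z) + σ * (X * X)) - + ℓ * (R * (X * X) * (Z * Z))) →
    Unit ℓ σ → Unit ℓ R → Unit ℓ d → Point → Sq ℓ d
  conic-residue σ R shape uσ uR ud pt = let X , a , norm , M = point-matches prime pt in
    go X a norm M ((d * (L a * L a) + σ * (X * X)) ≡ₘ? 0ℤ)
    where
    go : ∀ X a → a ≡ 0 ⊎ Unit ℓ X → Matches prime X a → Dec (d * (L a * L a) + σ * (X * X) ≡[ + ℓ ] 0ℤ) → Sq ℓ d
    go X a norm M (no uw) = let _ , y , h = match-even ud X a M 0 (Φ X (L a)) (one _) (Unit-cong Φ≡w² (uw · uw)) z≤n in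
      Sq-twist {y = y} uw (≡ₘ-trans h Φ≡w²)
      where
      w : ℤ
      w = d * (L a * L a) + σ * (X * X)
      Φ≡w² : Φ X (L a) ≡[ + ℓ ] w * w
      Φ≡w² = ≡ₘ-trans (≡ₘ-reflexive (trans (Φ≡poly X (L a)) (shape X (L a))))
        (lin₁ ℓ≡0 (- (R * (X * X) * (L a * L a))) (identity w (+ ℓ) (R * (X * X) * (L a * L a))))
        where
        identity : ∀ w l r → w * w - l * r - w * w ≡ - r * (l - 0ℤ)
        identity = solve-∀
    go X (suc a) (inj₂ uX) M (yes w≡0) = contradiction
      (lin₂ w≡0 (L-divisible a) 1ℤ (- (d * L (suc a))) (identity d σ X (L (suc a)))) (uσ · (uX · uX))
      where
      identity : ∀ d σ X Z → σ * (X * X) - 0ℤ ≡ 1ℤ * (d * (Z * Z) + σ * (X * X) - 0ℤ) + - (d * Z) * (Z - 0ℤ)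
      identity = solve-∀
    go X zero norm M (yes w≡0) = finish w≡0
      where
      uX : Unit ℓ X
      uX X≡0 = ud (lin₂ (subst (λ z → d * (z * z) + σ * (X * X) ≡[ + ℓ ] 0ℤ) L₀ w≡0) X≡0 1ℤ (- (σ * X)) (identity d σ X))
        where
        identity : ∀ d σ X → d - 0ℤ ≡ 1ℤ * (d * (1ℤ * 1ℤ) + σ * (X * X) - 0ℤ) + - (σ * X) * (X - 0ℤ)
        identity = solve-∀
      finish : d * (L 0 * L 0) + σ * (X * X) ≡[ + ℓ ] 0ℤ → Sq ℓ d
      -- The square is divisible by `ℓ²`, so the quartic has the valuation 1 of `ℓ R X²`, although
      -- `d` is a unit.
      finish (k by e) = case proj₁ (match-even ud X 0 M 1 U value unit (s≤s z≤n)) of λ ()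
        where
        U : ℤ
        U = k * k * + ℓ - R * (X * X) * (1ℤ * 1ℤ)
        identity : ∀ k l r → (0ℤ + k * l) * (0ℤ + k * l) - l * r ≡ l * (k * k * l - r)
        identity = solve-∀
        value : Φ X (L 0) ≡ L 1 * U
        value = trans (Φ-at-1 X) (trans (shape X 1ℤ) (trans (cong (λ z → z * z - + ℓ * (R * (X * X) * (1ℤ * 1ℤ)))
          (trans (cong (λ z → d * (z * z) + σ * (X * X)) (sym L₀)) e))
            (trans (identity k (+ ℓ) (R * (X * X) * (1ℤ * 1ℤ))) (cong (_* U) (sym L₁)))))
        drop : ∀ k l r → r * (1ℤ * 1ℤ) - 0ℤ ≡ -1ℤ * (k * k * l - r * (1ℤ * 1ℤ) - 0ℤ) + k * k * (l - 0ℤ)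
        drop = solve-∀
        unit : Unit ℓ U
        unit z = ((uR · (uX · uX)) · (Unit-1 prime · Unit-1 prime)) (lin₂ z ℓ≡0 -1ℤ (k * k) (drop k (+ ℓ) (R * (X * X))))

  -- The leading term has a square unit part wherever the point lies: `d²` for `Z = 1`, and
  -- `(T D′ X²)²` after removal of `ℓ²` when `ℓ` divides `Z`.
  residue-at-D : ∀ {D′} → D ≡ + ℓ * D′ → Unit ℓ D′ → Unit ℓ T → Unit ℓ d → Point → Sq ℓ d
  residue-at-D {D′} D≡ uD′ uT ud pt = let X , a , norm , M = point-matches prime pt in go X a norm M
    where
    go : ∀ X a → a ≡ 0 ⊎ Unit ℓ X → Matches prime X a → Sq ℓ d
    go X zero _ M = let _ , y , h = match-even ud X 0 M 0 (Φ X (L 0)) (one _) (Unit-cong Φ≡d² (ud · ud)) z≤n in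
      Sq-twist {y = y} ud (≡ₘ-trans h Φ≡d²)
      where
      identity : ∀ l d P T D X → (d * d * (1ℤ * 1ℤ * (1ℤ * 1ℤ)) + - (+ 2 * (P + (P + T)) * (l * D) * d) *
        (X * X) * (1ℤ * 1ℤ) + T * T * ((l * D) * (l * D)) * (X * X * (X * X))) - d * d ≡
        (- (+ 2 * (P + (P + T)) * D * d) * (X * X) + T * T * (D * D) * l * (X * X * (X * X))) * (l - 0ℤ)
      identity = solve-∀
      Φ≡d² : Φ X (L 0) ≡[ + ℓ ] d * d
      Φ≡d² = ≡ₘ-trans (≡ₘ-reflexive (trans (Φ-at-1 X) (cong (λ D → poly d P T D X 1ℤ) D≡)))
        (lin₁ ℓ≡0 (- (+ 2 * (P + (P + T)) * D′ * d) * (X * X) + T * T * (D′ * D′) * + ℓ * (X * X * (X * X)))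
          (identity (+ ℓ) d P T D′ X))
    go X (suc a) (inj₂ uX) M = let _ , y , h = match-even ud X (suc a) M 2 U value (Unit-cong U≡s² (us · us)) (s≤s (s≤s z≤n)) in
      Sq-twist {y = y} us (≡ₘ-trans h U≡s²)
      where
      K : ℤ
      K = L a
      R : ℤ
      R = d * d * (K * K * (K * K)) * + ℓ + - (+ 2 * (P + (P + T)) * D′ * d) * (X * X) * (K * K)
      U : ℤ
      U = + ℓ * R + T * D′ * (X * X) * (T * D′ * (X * X))
      us : Unit ℓ (T * D′ * (X * X))
      us = (uT · uD′) · (uX · uX)
      identity : ∀ l d P T D X K → (d * d * ((l * K) * (l * K) * ((l * K) * (l * K))) + - (+ 2 * (P + (P + T)) * (l * D) * d) *
        (X * X) * ((l * K) * (l * K)) + T * T * ((l * D) * (l * D)) * (X * X * (X * X))) ≡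
        l * l * (l * (d * d * (K * K * (K * K)) * l + - (+ 2 * (P + (P + T)) * D * d) * (X * X) * (K * K)) + T * D *
          (X * X) * (T * D * (X * X)))
      identity = solve-∀
      value : Φ X (L (suc a)) ≡ L 2 * U
      value = trans (Φ≡poly X (L (suc a))) (trans (cong₂ (λ D Z → poly d P T D X Z) D≡ (L-suc a))
        (trans (identity (+ ℓ) d P T D′ X K) (cong (_* U) (sym L₂))))
      drop : ∀ l r s → l * r + s - s ≡ r * (l - 0ℤ)
      drop = solve-∀
      U≡s² : U ≡[ + ℓ ] T * D′ * (X * X) * (T * D′ * (X * X))
      U≡s² = lin₁ ℓ≡0 R (drop (+ ℓ) R _)

  module _ {d′ D′ : ℤ} (d≡ : d ≡ + ℓ * d′) (D≡ : D ≡ + ℓ * D′)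
           (ud′ : Unit ℓ d′) (uD′ : Unit ℓ D′) (uT : Unit ℓ T) (uP : Unit ℓ P) (uQ : Unit ℓ (P + T)) where

    private
      scaled : ∀ X a → Φ X (L a) ≡ L 2 * poly d′ P T D′ X (L a)
      scaled X a = trans (Φ≡poly X (L a)) (trans (cong₂ (λ d D → poly d P T D X (L a)) d≡ D≡)
        (trans (identity (+ ℓ) d′ P T D′ X (L a)) (cong (_* poly d′ P T D′ X (L a)) (sym L₂))))
        where
        identity : ∀ l d P T D X Z → ((l * d) * (l * d) * (Z * Z * (Z * Z)) + - (+ 2 * (P + (P + T)) * (l * D) * (l * d)) *
          (X * X) * (Z * Z) + T * T * ((l * D) * (l * D)) * (X * X * (X * X))) ≡ l * l *
          (d * d * (Z * Z * (Z * Z)) + - (+ 2 * (P + (P + T)) * D * d) * (X * X) * (Z * Z) + T * T * (D * D) * (X * X * (X * X)))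
        identity = solve-∀

    -- The factor `ℓ²` keeps valuations even, so the quartic of `d′` and `D′` cannot be a unit at
    -- the point. At a root the conic forms read `P D′ d′ (2X)² = (d′ - T D′ X²)²`, and likewise
    -- with `P + T` and the plus sign.
    root-at-D : Point → Sq ℓ (P * D′ * d′) × Sq ℓ ((P + T) * D′ * d′)
    root-at-D pt = let X , a , norm , M = point-matches prime pt in go X a norm M (poly d′ P T D′ X (L a) ≡ₘ? 0ℤ)
      where
      go : ∀ X a → a ≡ 0 ⊎ Unit ℓ X → Matches prime X a → Dec (poly d′ P T D′ X (L a) ≡[ + ℓ ] 0ℤ) →
        Sq ℓ (P * D′ * d′) × Sq ℓ ((P + T) * D′ * d′)
      go X a norm M (no u) = case match-odd d≡ ud′ X a M 2 _ (scaled X a) u (s≤s (s≤s z≤n)) of λ ()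
      go X (suc a) (inj₂ uX) M (yes z) = contradiction
        (lin₂ z (L-divisible a) 1ℤ (- (d′ * d′ * (Z * Z * Z) + - (+ 2 * (P + (P + T)) * D′ * d′) * (X * X) * Z))
          (identity d′ P T D′ X Z))
        (((uT · uT) · (uD′ · uD′)) · ((uX · uX) · (uX · uX)))
        where
        Z : ℤ
        Z = L (suc a)
        identity : ∀ d P T D X Z → T * T * (D * D) * (X * X * (X * X)) - 0ℤ ≡ 1ℤ *
          ((d * d * (Z * Z * (Z * Z)) + - (+ 2 * (P + (P + T)) * D * d) * (X * X) * (Z * Z) + T * T * (D * D) *
          (X * X * (X * X))) - 0ℤ) +
          - (d * d * (Z * Z * Z) + - (+ 2 * (P + (P + T)) * D * d) * (X * X) * Z) * (Z - 0ℤ)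
        identity = solve-∀
      go X zero norm M (yes z) = Sq-scale {b = d′ - T * D′ * (X * X)} u2X (lin₁ z₁ -1ℤ (minus d′ P T D′ X)) ,
                                 Sq-scale {b = d′ + T * D′ * (X * X)} u2X (lin₁ z₁ -1ℤ (plus d′ P T D′ X))
        where
        z₁ : poly d′ P T D′ X 1ℤ ≡[ + ℓ ] 0ℤ
        z₁ = subst (λ Z → poly d′ P T D′ X Z ≡[ + ℓ ] 0ℤ) L₀ z
        u2X : Unit ℓ (+ 2 * X)
        u2X = Unit-2 · root-unit {d′} {P} {T} {D′} uP uQ uD′ ud′ {X} z₁
        minus : ∀ d P T D X → P * D * d * (+ 2 * X * (+ 2 * X)) - (d - T * D * (X * X)) * (d - T * D * (X * X)) ≡
          -1ℤ * ((d * d * (1ℤ * 1ℤ * (1ℤ * 1ℤ)) + - (+ 2 * (P + (P + T)) * D * d) * (X * X) * (1ℤ * 1ℤ) + T * T *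
          (D * D) * (X * X * (X * X))) - 0ℤ)
        minus = solve-∀
        plus : ∀ d P T D X → (P + T) * D * d * (+ 2 * X * (+ 2 * X)) - (d + T * D * (X * X)) * (d + T * D * (X * X)) ≡
          -1ℤ * ((d * d * (1ℤ * 1ℤ * (1ℤ * 1ℤ)) + - (+ 2 * (P + (P + T)) * D * d) * (X * X) * (1ℤ * 1ℤ) + T * T *
          (D * D) * (X * X * (X * X))) - 0ℤ)
        plus = solve-∀

    -- Modulo `ℓ` the quartic is `(d′ - T D′ X²)² - (2 r X)²`. Its quadratic factor
    -- `T D′ X² + 2 r X - d′` has discriminant `4 (r² + T D′ d′) = (2 r′)²`, which explains the root
    -- `(r′ - r) / (T D′)`.
    point-at-D : Sq ℓ (P * D′ * d′) → Sq ℓ ((P + T) * D′ * d′) → Point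
    point-at-D (r , hr) (r′ , hr′) = let v , TDv≡1 = inverse prime (T * D′) (uT · uD′) in
        build ((r′ - r) * v) (lin₁ TDv≡1 (r′ - r) (solves (T * D′) r r′ v))
      where
      solves : ∀ a r r′ v → a * ((r′ - r) * v) - (r′ - r) ≡ (r′ - r) * (a * v - 1ℤ)
      solves = solve-∀
      build : ∀ X → T * D′ * X ≡[ + ℓ ] r′ - r → Point
      build X hX = finish zero-X
        where
        -- T D′ X² + 2 r X - d′ vanishes, since T D′ times it is r′² - r² - T D′ d′.
        quadratic : T * D′ * (X * X) + + 2 * r * X ≡[ + ℓ ] d′
        quadratic = cancelₘ prime (uT · uD′) (≡ₘ-trans
          (lin₁ hX (T * D′ * X + (r′ - r) + + 2 * r) (step₁ (T * D′) X r r′ d′))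
          (lin₂ hr′ hr 1ℤ -1ℤ (step₂ P T D′ d′ r r′)))
          where
          step₁ : ∀ a X r r′ d → a * (a * (X * X) + + 2 * r * X) - (r′ * r′ - r * r) ≡ (a * X + (r′ - r) + + 2 * r) *
            (a * X - (r′ - r))
          step₁ = solve-∀
          step₂ : ∀ P T D d r r′ → r′ * r′ - r * r - T * D * d ≡ 1ℤ * (r′ * r′ - (P + T) * D * d) + -1ℤ * (r * r - P * D * d)
          step₂ = solve-∀
        zero-X : poly d′ P T D′ X 1ℤ ≡[ + ℓ ] 0ℤ
        zero-X = lin₂ quadratic hr (- (d′ - T * D′ * (X * X) + + 2 * r * X)) (+ 4 * (X * X)) (identity d′ P T D′ X r)
          where
          identity : ∀ d P T D X r → (d * d * (1ℤ * 1ℤ * (1ℤ * 1ℤ)) + - (+ 2 * (P + (P + T)) * D * d) *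
            (X * X) * (1ℤ * 1ℤ) + T * T * (D * D) * (X * X * (X * X))) - 0ℤ ≡
            - (d - T * D * (X * X) + + 2 * r * X) * (T * D * (X * X) + + 2 * r * X - d) + + 4 * (X * X) * (r * r - P * D * d)
          identity = solve-∀
        finish : poly d′ P T D′ X 1ℤ ≡[ + ℓ ] 0ℤ → Point
        finish (g by e) =
          -- The root is moved until the cofactor of `ℓ` is `d′` modulo `ℓ`; the lifting of
          -- `d′ y² = A` then starts at `1`.
          let X₁ , A , value , A≡d′ , _ = lift-root d′ P T D′ {X} (+ ℓ) g d′ ℓ≡0 (derivative-unit {d′} {P} {T} {D′} uP uQ uD′ ud′ {X} zero-X)
                                          (trans e (trans (ℤₚ.+-identityˡ _) (ℤₚ.*-comm g (+ ℓ))))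
          in point-odd prime odd X₁ 0 1 (+ ℓ) d′ A 1ℤ d≡
            (trans (scaled X₁ 0) (trans (cong₂ _*_ L₂ (trans (cong (poly d′ P T D′ X₁) L₀) value))
              (trans (regroup (+ ℓ) A) (cong (λ z → + ℓ * (z * z) * A) (sym L₁)))))
            ud′ (Unit-cong A≡d′ ud′) (≡ₘ-trans (≡ₘ-reflexive (ℤₚ.*-identityʳ d′)) (≡ₘ-sym A≡d′))
          where
          regroup : ∀ l A → l * l * (l * A) ≡ l * (l * l) * A
          regroup = solve-∀

  -- For a nonresidue `d`, `not-all-squares` provides a value of the quartic that is zero or a
  -- nonresidue. A nonresidue is `d` times a square; a zero is simple and can be moved until the
  -- value is `ℓ² A` with `A` congruent to `d`.
  good-point : Unit ℓ P → Unit ℓ (P + T) → Unit ℓ T → Unit ℓ D → Unit ℓ d → Point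
  good-point uP uQ uT uD ud = [ (λ h → residue-point ud (proj₂ h)) , (λ h → nonresidue-point (proj₂ h)) ]′ (isNR-cases d ud)
    where
    F : ℤ → ℤ
    F X = poly d P T D X 1ℤ
    at-root : ∀ X → F X ≡[ + ℓ ] 0ℤ → Point
    at-root X z@(g by e) =
      -- Prescribing the cofactor `0` of `ℓ` gives a zero modulo `ℓ²`; the second lifting prescribes
      -- the cofactor of `ℓ²`. The even power is needed since `d` is a unit.
      let X₁ , A₁ , value₁ , A₁≡0 , X₁≡X = lift-root d P T D {X} (+ ℓ) g 0ℤ ℓ≡0 (der X z)
                                     (trans e (trans (ℤₚ.+-identityˡ _) (ℤₚ.*-comm g (+ ℓ))))
      in second X₁ A₁ value₁ A₁≡0 (≡ₘ-trans (poly-cong d P T D {X₁} {X} X₁≡X) z)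
      where
      der : ∀ X → F X ≡[ + ℓ ] 0ℤ → Unit ℓ (poly′ d P T D X)
      der X = derivative-unit {d} {P} {T} {D} uP uQ uD ud {X}
      second : ∀ X₁ A₁ → F X₁ ≡ + ℓ * A₁ → A₁ ≡[ + ℓ ] 0ℤ → F X₁ ≡[ + ℓ ] 0ℤ → Point
      second X₁ A₁ value₁ (g₁ by e₁) z₁ =
        let X₂ , A , value , A≡d , _ = lift-root d P T D {X₁} (+ ℓ * + ℓ) g₁ d ℓ²≡0 (der X₁ z₁)
                                         (trans value₁ (trans (cong (+ ℓ *_) e₁) (regroup (+ ℓ) g₁)))
        in point-odd prime odd X₂ 0 1 1ℤ d A 1ℤ (sym (ℤₚ.*-identityˡ d))
          (trans (Φ-at-1 X₂) (trans value (cong (_* A) (trans (cong₂ _*_ (sym L₁) (sym L₁)) (sym (ℤₚ.*-identityˡ _))))))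
          ud (Unit-cong A≡d ud) (≡ₘ-trans (≡ₘ-reflexive (ℤₚ.*-identityʳ d)) (≡ₘ-sym A≡d))
        where
        regroup : ∀ l g → l * (0ℤ + g * l) ≡ l * l * g
        regroup = solve-∀
        ℓ²≡0 : + ℓ * + ℓ ≡[ + ℓ ] 0ℤ
        ℓ²≡0 = lin₁ ℓ≡0 (+ ℓ) (identity (+ ℓ))
          where
          identity : ∀ l → l * l - 0ℤ ≡ l * (l - 0ℤ)
          identity = solve-∀
    nonresidue-point : ¬ Sq ℓ d → Point
    nonresidue-point nd = search (Finₚ.any? λ (i : Fin ℓ) → does? (+ toℕ i))
      where
      Bad : ℤ → Set
      Bad X = F X ≡[ + ℓ ] 0ℤ ⊎ isNR (F X) ℓ ≡ true
      does? : ∀ X → Dec (Bad X)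
      does? X with F X ≡ₘ? 0ℤ | isNR (F X) ℓ 𝔹ₚ.≟ true
      ... | yes a | _     = yes (inj₁ a)
      ... | no _  | yes b = yes (inj₂ b)
      ... | no a  | no b  = no [ a , b ]′
      bad-point : ∀ X → Bad X → Dec (F X ≡[ + ℓ ] 0ℤ) → Point
      bad-point X _ (yes z) = at-root X z
      bad-point X (inj₁ z) (no _) = at-root X z
      bad-point X (inj₂ e) (no u) = twisted (square⊎twisted ud nd (F X))
        where
        twisted : (∃ λ x → x * x ≡[ + ℓ ] F X ⊎ d * (x * x) ≡[ + ℓ ] F X) → Point
        twisted (x , inj₁ h) = case trans (sym e) (isNR-Sq u (x , h)) of λ ()
        twisted (x , inj₂ h) = point-odd prime odd X 0 0 1ℤ d (F X) x (sym (ℤₚ.*-identityˡ d))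
          (trans (Φ-at-1 X) (trans (sym (ℤₚ.*-identityˡ (F X))) (cong (λ z → 1ℤ * (z * z) * F X) (sym L₀)))) ud u h
      search : Dec (∃ λ (i : Fin ℓ) → Bad (+ toℕ i)) → Point
      search (yes (i , b)) = bad-point (+ toℕ i) b (F (+ toℕ i) ≡ₘ? 0ℤ)
      search (no none) = ⊥-elim (not-all-squares {d} {P} {T} {D} uP uQ uT uD ud squares)
        where
        squares : ∀ x → ∃ λ y → Unit ℓ y × y * y ≡[ + ℓ ] F (+ x)
        squares x = transport (Sq-isNR unit (𝔹ₚ.¬-not (λ b → none (i , inj₂ b))))
          where
          i : Fin ℓ
          i = Fin.fromℕ< (n%ℕd<d (+ x) ℓ)
          unit : Unit ℓ (F (+ toℕ i))
          unit z = none (i , inj₁ z)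
          i≡x : + toℕ i ≡[ + ℓ ] + x
          i≡x = ≡ₘ-trans (≡ₘ-reflexive (cong +_ (Finₚ.toℕ-fromℕ< (n%ℕd<d (+ x) ℓ)))) (≡ₘ-sym (residue ℓ (+ x)))
          transport : Sq ℓ (F (+ toℕ i)) → ∃ λ y → Unit ℓ y × y * y ≡[ + ℓ ] F (+ x)
          transport (y , h) = y , (λ y≡0 → unit (≡ₘ-trans (≡ₘ-sym h) (lin₁ y≡0 y (identity y)))) ,
            ≡ₘ-trans h (poly-cong d P T D {+ toℕ i} {+ x} i≡x)
            where
            identity : ∀ y → y * y - 0ℤ ≡ y * (y - 0ℤ)
            identity = solve-∀

-- Deciding implications between congruences modulo divisors of N

infixl 6 _:+_ _:-_
infixl 7 _:*_
infix 4 _≋_mod_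

data Expr (n : ℕ) : Set where
  var : Fin n → Expr n
  con : ℤ → Expr n
  _:+_ _:-_ _:*_ : Expr n → Expr n → Expr n

eval : ∀ {n} → Expr n → Vec ℤ n → ℤ
eval (var i) ρ = lookup ρ i
eval (con c) ρ = c
eval (a :+ b) ρ = eval a ρ + eval b ρ
eval (a :- b) ρ = eval a ρ - eval b ρ
eval (a :* b) ρ = eval a ρ * eval b ρ

record Claim (n : ℕ) : Set where
  constructor _≋_mod_
  field
    lhs rhs : Expr n
    modulus : ℕ

Holds : ∀ {n} → Vec ℤ n → Claim n → Set
Holds ρ (l ≋ r mod M) = eval l ρ ≡[ + M ] eval r ρ

-- The value at modulus `0` has to be nonzero, so that a claim modulo `0` passes neither `valid` nor
-- `holdsᵇ`.
rem : ℤ → ℕ → ℕ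
rem x zero = 1
rem x M@(suc _) = x %ℕ M

holdsᵇ : ∀ {n} → Vec ℤ n → Claim n → Bool
holdsᵇ ρ (l ≋ r mod M) = rem (eval l ρ - eval r ρ) M ℕ.≡ᵇ 0

forallBelow : ℕ → (ℕ → Bool) → Bool
forallBelow zero f = true
forallBelow (suc k) f = f k ∧ forallBelow k f

forallResidues : ∀ N n → (Vec ℤ n → Bool) → Bool
forallResidues N zero f = f []
forallResidues N (suc n) f = forallBelow N λ r → forallResidues N n λ ρ → f (+ r ∷ ρ)

-- The conclusions form a disjunction; the empty list states that the hypotheses contradict each
-- other.
implies : ∀ {n} → List (Claim n) → List (Claim n) → Vec ℤ n → Bool
implies [] cs ρ = any (holdsᵇ ρ) cs
implies (h ∷ hs) cs ρ = if holdsᵇ ρ h then implies hs cs ρ else true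

valid : ∀ {n} → ℕ → List (Claim n) → Bool
valid N [] = true
valid N ((_ ≋ _ mod M) ∷ cs) = (rem (+ N) M ℕ.≡ᵇ 0) ∧ valid N cs

check : ∀ n → ℕ → List (Claim n) → List (Claim n) → Bool
check n N hs cs = valid N hs ∧ valid N cs ∧ forallResidues N n (implies hs cs)

∧-true : ∀ a {b} → a ∧ b ≡ true → a ≡ true × b ≡ true
∧-true true e = refl , e

private
  rem-zero : ∀ x y M → rem (x - y) M ≡ 0 → x ≡[ + M ] y
  rem-zero x y M@(suc _) e = lin₁ (≡ₘ-trans (residue M (x - y)) (≡ₘ-reflexive (cong +_ e))) 1ℤ (identity x y)
    where
    identity : ∀ x y → x - y ≡ 1ℤ * (x - y - 0ℤ)
    identity = solve-∀

  zero-rem : ∀ x y M → M ≢ 0 → x ≡[ + M ] y → rem (x - y) M ≡ 0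
  zero-rem x y zero M≢0 _ = contradiction refl M≢0
  zero-rem x y M@(suc _) _ h = small-residues (n%ℕd<d (x - y) M) (s≤s z≤n)
    (≡ₘ-trans (≡ₘ-sym (residue M (x - y))) (lin₁ h 1ℤ (identity x y)))
    where
    identity : ∀ x y → x - y - 0ℤ ≡ 1ℤ * (x - y)
    identity = solve-∀

  modulus≢0 : ∀ N M → rem N M ≡ 0 → M ≢ 0
  modulus≢0 N zero () _
  modulus≢0 N (suc M) _ ()

  eval-cong : ∀ {M n} (e : Expr n) {ρ σ : Vec ℤ n} → (∀ i → lookup ρ i ≡[ M ] lookup σ i) → eval e ρ ≡[ M ] eval e σ
  eval-cong (var i) h = h i
  eval-cong (con c) h = ≡ₘ-refl
  eval-cong (a :+ b) h = +-congₘ (eval-cong a h) (eval-cong b h)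
  eval-cong (a :- b) h = +-congₘ (eval-cong a h) (neg-congₘ (eval-cong b h))
  eval-cong (a :* b) h = *-congₘ (eval-cong a h) (eval-cong b h)

  module _ {n} (N : ℕ) (ρ σ : Vec ℤ n) (ρ≡σ : ∀ i → lookup ρ i ≡[ + N ] lookup σ i) where

    coarse : ∀ M → rem (+ N) M ≡ 0 → ∀ i → lookup ρ i ≡[ + M ] lookup σ i
    coarse M@(suc _) e i with rem-zero (+ N) 0ℤ M (trans (cong (λ x → rem x M) (ℤₚ.+-identityʳ (+ N))) e)
    ... | k by N≡ = coarsenₘ {k} (+ M) (remodulus (trans N≡ (ℤₚ.+-identityˡ _)) (ρ≡σ i))

    transfer : ∀ (l r : Expr n) M → rem (+ N) M ≡ 0 → eval l ρ ≡[ + M ] eval r ρ → eval l σ ≡[ + M ] eval r σ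
    transfer l r M e h = ≡ₘ-trans (≡ₘ-sym (eval-cong l (coarse M e))) (≡ₘ-trans h (eval-cong r (coarse M e)))

    untransfer : ∀ (l r : Expr n) M → rem (+ N) M ≡ 0 → eval l σ ≡[ + M ] eval r σ → eval l ρ ≡[ + M ] eval r ρ
    untransfer l r M e h = ≡ₘ-trans (eval-cong l (coarse M e)) (≡ₘ-trans h (≡ₘ-sym (eval-cong r (coarse M e))))

    conclude : ∀ cs → valid N cs ≡ true → any (holdsᵇ σ) cs ≡ true → Any (Holds ρ) cs
    conclude ((l ≋ r mod M) ∷ cs) v e with holdsᵇ σ (l ≋ r mod M) in eq
    ... | true = here (untransfer l r M (≡ᵇ-true (rem (+ N) M) 0 (proj₁ (∧-true _ v)))
      (rem-zero (eval l σ) (eval r σ) M (≡ᵇ-true _ 0 eq)))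
    ... | false = there (conclude cs (proj₂ (∧-true _ v)) e)

    derive : ∀ hs cs → valid N hs ≡ true → valid N cs ≡ true → implies hs cs σ ≡ true → All (Holds ρ) hs → Any (Holds ρ) cs
    derive [] cs vh vc e _ = conclude cs vc e
    derive ((l ≋ r mod M) ∷ hs) cs vh vc e (h ∷ all) = derive hs cs (proj₂ (∧-true _ vh)) vc
      (trans (sym (cong (λ b → if b then implies hs cs σ else true) holds)) e) all
      where
      valid-M : rem (+ N) M ≡ 0
      valid-M = ≡ᵇ-true _ 0 (proj₁ (∧-true _ vh))
      holds : holdsᵇ σ (l ≋ r mod M) ≡ true
      holds = cong (ℕ._≡ᵇ 0) (zero-rem (eval l σ) (eval r σ) M (modulus≢0 (+ N) M valid-M) (transfer l r M valid-M h))

  below : ∀ N f → forallBelow N f ≡ true → ∀ r → r ℕ.< N → f r ≡ true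
  below (suc N) f e r r< with ℕₚ.m≤n⇒m<n∨m≡n (ℕₚ.≤-pred r<)
  ... | inj₁ r<N = below N f (proj₂ (∧-true (f N) e)) r r<N
  ... | inj₂ refl = proj₁ (∧-true (f r) e)

  residues : ∀ N .{{_ : NonZero N}} n f → forallResidues N n f ≡ true → (ρ : Vec ℤ n) →
    ∃ λ σ → f σ ≡ true × (∀ i → lookup ρ i ≡[ + N ] lookup σ i)
  residues N zero f e [] = [] , e , λ ()
  residues N (suc n) f e (x ∷ ρ) =
    let σ , fσ , h = residues N n _ (below N _ e (x %ℕ N) (n%ℕd<d x N)) ρ
    in + (x %ℕ N) ∷ σ , fσ , λ { Fin.zero → residue N x ; (Fin.suc i) → h i }

abstract
  -- Every modulus divides `N`, so no claim changes when the integers are replaced by their residues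
  -- modulo `N`; `check` runs through all of these.
  decide : ∀ {n} N .{{_ : NonZero N}} hs cs → check n N hs cs ≡ true → (ρ : Vec ℤ n) → All (Holds ρ) hs → Any (Holds ρ) cs
  decide {n} N hs cs e ρ all =
    let vh , e′ = ∧-true (valid N hs) e
        vc , e″ = ∧-true (valid N cs) e′
        σ , eσ , h = residues N n (implies hs cs) e″ ρ
    in derive N ρ σ h hs cs vh vc eσ all

  infer : ∀ {n} N .{{_ : NonZero N}} hs c → check n N hs (c ∷ []) ≡ true → (ρ : Vec ℤ n) → All (Holds ρ) hs → Holds ρ c
  infer N hs c e ρ all = only (decide N hs (c ∷ []) e ρ all)
    where
    only : Any (Holds ρ) (c ∷ []) → Holds ρ c
    only (here h) = h

x₀ : ∀ {n} → Expr (1 ℕ.+ n)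
x₀ = var Fin.zero
x₁ : ∀ {n} → Expr (2 ℕ.+ n)
x₁ = var (Fin.suc Fin.zero)
x₂ : ∀ {n} → Expr (3 ℕ.+ n)
x₂ = var (Fin.suc (Fin.suc Fin.zero))
x₃ : ∀ {n} → Expr (4 ℕ.+ n)
x₃ = var (Fin.suc (Fin.suc (Fin.suc Fin.zero)))
x₄ : ∀ {n} → Expr (5 ℕ.+ n)
x₄ = var (Fin.suc (Fin.suc (Fin.suc (Fin.suc Fin.zero))))
x₅ : ∀ {n} → Expr (6 ℕ.+ n)
x₅ = var (Fin.suc (Fin.suc (Fin.suc (Fin.suc (Fin.suc Fin.zero)))))

Odd : ℤ → Set
Odd x = x ≡[ + 2 ] 1ℤ

odd! : ∀ {n} → Expr n → Claim n
odd! x = x ≋ con 1ℤ mod 2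

parity : ∀ x → x ≡[ + 2 ] 0ℤ ⊎ Odd x
parity x = go (decide 2 [] ((x₀ ≋ con 0ℤ mod 2) ∷ odd! x₀ ∷ []) refl (x ∷ []) [])
  where
  go : Any (Holds (x ∷ [])) ((x₀ ≋ con 0ℤ mod 2) ∷ odd! x₀ ∷ []) → x ≡[ + 2 ] 0ℤ ⊎ Odd x
  go (here h) = inj₁ h
  go (there (here h)) = inj₂ h

odd⇒unit : ∀ {x} → Odd x → Unit 2 x
odd⇒unit {x} h z = case decide 2 (odd! x₀ ∷ (x₀ ≋ con 0ℤ mod 2) ∷ []) [] refl (x ∷ []) (h ∷ z ∷ []) of λ ()

mod-four : ∀ x → Odd x → x ≡[ + 4 ] 1ℤ ⊎ x ≡[ + 4 ] + 3
mod-four x h = go (decide 4 (odd! x₀ ∷ []) ((x₀ ≋ con 1ℤ mod 4) ∷ (x₀ ≋ con (+ 3) mod 4) ∷ []) refl (x ∷ []) (h ∷ []))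
  where
  go : Any (Holds (x ∷ [])) ((x₀ ≋ con 1ℤ mod 4) ∷ (x₀ ≋ con (+ 3) mod 4) ∷ []) → x ≡[ + 4 ] 1ℤ ⊎ x ≡[ + 4 ] + 3
  go (here e) = inj₁ e
  go (there (here e)) = inj₂ e

-- Local conditions at 2

-- The first alternative is what points with `Z = 1` or with `T` dividing `Z` require, where the
-- leading part of the quartic is a square modulo 4. The other two allow for the valuations of `Z`
-- in between.
OddSoluble : (m : ℕ) (P D d : ℤ) → Set
OddSoluble m P D d = d ≡[ + 4 ] 1ℤ ⊎ (m ≡ 2 × (P + + 2) * D ≡[ + 8 ] + 5) ⊎ (3 ℕ.≤ m × P * D ≡[ + 4 ] + 3)

-- The first alternative belongs to `Z = 1`, the others to `Z = 2^(a+1)` with `m = a + 3 + k`: both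
-- of `a` and `k` zero, exactly one zero, neither zero.
EvenSoluble : (m : ℕ) (P D d′ : ℤ) → Set
EvenSoluble m P D d′ =
  (m ≡ 1 × d′ * d′ + D * D - + 2 * (P + 1ℤ) * D * d′ ≡[ + 16 ] + 2 * d′)
  ⊎ (m ≡ 3 × P * D ≡[ + 8 ] + 7)
  ⊎ (4 ℕ.≤ m × + 2 * d′ - P * D ≡[ + 8 ] 1ℤ)
  ⊎ (5 ℕ.≤ m × P * D ≡[ + 8 ] + 7)

-- Here `a` is the valuation of `Z`. For odd `d` and `X` the three terms of the quartic have
-- valuations `4a`, at least `2 + 2a`, and `2m`; the border `m = a + 1` is where `2 + 2a` meets
-- `2m`.
data Regime (m a : ℕ) : Set where
  small  : ∀ k → m ≡ a ℕ.+ 2 ℕ.+ k → Regime m a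
  middle : m ≡ suc a → Regime m a
  large  : ∀ k → a ≡ m ℕ.+ k → Regime m a

regime : ∀ m a → Regime m a
regime m a with m ℕ.≤? a | m ℕ.≟ suc a
... | yes m≤a | _ = large (a ℕ.∸ m) (sym (ℕₚ.m+[n∸m]≡n m≤a))
... | no m≰a | yes e = middle e
... | no m≰a | no ne = small (m ℕ.∸ (a ℕ.+ 2)) (sym (ℕₚ.m+[n∸m]≡n
  (subst (ℕ._≤ m) (ℕₚ.+-comm 2 a) (ℕₚ.≤∧≢⇒< (ℕₚ.≰⇒> m≰a) (λ e → ne (sym e))))))

module Dyadic (p q m Dₙ : ℕ) (d P T D : ℤ) (T≡ : T ≡ Powers.L 2 m) (1≤m : 1 ℕ.≤ m)
  (P-odd : Odd P) (D-odd : Odd D)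
  (Φ≡poly : ∀ X Z → LocalField.Φ 2 d p q m Dₙ X Z ≡ poly d P T D X Z) where

  open Powers 2
  open LocalField 2 d p q m Dₙ
  open DyadicPoints d p q m Dₙ

  private
    Point : Set
    Point = HasPoint (Qℓ 2) d p q m Dₙ

    m′ : ℕ
    m′ = ℕ.pred m

    m≡ : m ≡ suc m′
    m≡ = sym (ℕₚ.suc-pred m {{ℕ.>-nonZero 1≤m}})

    S : ℤ
    S = L m′

    T≡2S : T ≡ + 2 * S
    T≡2S = trans T≡ (trans (cong L m≡) (L-suc m′))

    L-double : ∀ c a → L (c ℕ.+ (a ℕ.+ a)) ≡ L c * (L a * L a)
    L-double c a = trans (L-+ c (a ℕ.+ a)) (cong (L c *_) (L-+ a a))

    L-even : ∀ a → L (suc a) ≡[ + 2 ] 0ℤ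
    L-even a = lin₀ (L a) (trans (ℤₚ.+-identityʳ _) (trans (L-suc a) (ℤₚ.*-comm (+ 2) (L a))))

    -- Odd squares are 1 modulo 8, so the three digits in `Matches` compare `U` with `d′` itself.
    match : ∀ X a → Matches prime[2] X a → ∀ v U δ d′ → Φ X (L a) ≡ L v * U → Odd U → v ℕ.≤ 4 ℕ.* a ℕ.+ 4 →
      d ≡ L δ * d′ → Odd d′ → oddᵇ v ≡ oddᵇ δ × U ≡[ + 8 ] d′
    match X a M v U δ d′ e U-odd v≤ d≡ d′-odd =
      let parity , y , h = M v U δ d′ e (odd⇒unit U-odd) v≤ d≡ (odd⇒unit d′-odd)
      in parity , infer 8 (odd! x₀ ∷ odd! x₁ ∷ (x₀ :* (x₂ :* x₂) ≋ x₁ mod 8) ∷ []) (x₁ ≋ x₀ mod 8) refl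
           (d′ ∷ U ∷ y ∷ []) (d′-odd ∷ U-odd ∷ remodulus (L-def 3) h ∷ [])

    double-odd : ∀ {V} → V ≡[ + 4 ] + 2 → ∃ λ U → V ≡ + 2 * U × Odd U
    double-odd {V} (k by e) = 1ℤ + + 2 * k , trans e (identity k) , lin₀ k (shift k)
      where
      identity : ∀ k → + 2 + k * + 4 ≡ + 2 * (1ℤ + + 2 * k)
      identity = solve-∀
      shift : ∀ k → 1ℤ + + 2 * k - 1ℤ ≡ k * + 2
      shift = solve-∀

    bound : ∀ c a k → c ℕ.≤ 4 → c ℕ.+ (a ℕ.+ a) ℕ.≤ 4 ℕ.* (a ℕ.+ k) ℕ.+ 4
    bound c a k c≤4 = ℕₚ.≤-trans (ℕₚ.+-mono-≤ c≤4 (ℕₚ.m≤m+n (a ℕ.+ a) (a ℕ.+ a ℕ.+ 4 ℕ.* k))) (ℕₚ.≤-reflexive (rearrange a k))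
      where
      rearrange : ∀ a k → 4 ℕ.+ (a ℕ.+ a ℕ.+ (a ℕ.+ a ℕ.+ 4 ℕ.* k)) ≡ 4 ℕ.* (a ℕ.+ k) ℕ.+ 4
      rearrange = ℕSolver.solve-∀

    bound′ : ∀ c a → c ℕ.≤ 8 → c ℕ.+ (a ℕ.+ a) ℕ.≤ 4 ℕ.* suc a ℕ.+ 4
    bound′ c a c≤8 = ℕₚ.≤-trans (ℕₚ.+-mono-≤ c≤8 (ℕₚ.m≤m+n (a ℕ.+ a) (a ℕ.+ a))) (ℕₚ.≤-reflexive (rearrange a))
      where
      rearrange : ∀ a → 8 ℕ.+ (a ℕ.+ a ℕ.+ (a ℕ.+ a)) ≡ 4 ℕ.* suc a ℕ.+ 4
      rearrange = ℕSolver.solve-∀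

    oddᵇ-even : ∀ c a → oddᵇ (c ℕ.+ (a ℕ.+ a)) ≡ oddᵇ c
    oddᵇ-even = oddᵇ-+2 prime[2]

    Z-small : ∀ a′ k → m ≡ suc a′ ℕ.+ 2 ℕ.+ k → T ≡ + 8 * L a′ * L k
    Z-small a′ k e = trans T≡ (trans (cong L (trans e (rearrange a′ k))) (trans (L-+ 3 (a′ ℕ.+ k))
      (trans (cong₂ _*_ (L-def 3) (L-+ a′ k)) (sym (ℤₚ.*-assoc (+ 8) (L a′) (L k))))))
      where
      rearrange : ∀ a k → suc a ℕ.+ 2 ℕ.+ k ≡ 3 ℕ.+ (a ℕ.+ k)
      rearrange = ℕSolver.solve-∀

    module OddCase (d-odd : Odd d) where

      d≡L₀d : d ≡ L 0 * d
      d≡L₀d = one-* prime[2] d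

      -- At `Z = 1` the other two coefficients, `4 (P + S) D d` up to sign and `4 S² D²`, vanish
      -- modulo 4 and leave the odd square `d²`.
      at-zero : ∀ X → Matches prime[2] X 0 → d ≡[ + 4 ] 1ℤ
      at-zero X M = let _ , h = match X 0 M 0 (Φ X (L 0)) 0 d (one-* prime[2] _)
                                  (infer 4 (odd! x₀ ∷ (x₁ ≋ x₀ :* x₀ mod 4) ∷ []) (odd! x₁) refl (d ∷ Φ X (L 0) ∷ [])
                                    (d-odd ∷ U≡d² ∷ [])) z≤n d≡L₀d d-odd
        in infer 8 (odd! x₀ ∷ (x₁ ≋ x₀ :* x₀ mod 4) ∷ (x₁ ≋ x₀ mod 8) ∷ []) (x₀ ≋ con 1ℤ mod 4) refl
             (d ∷ Φ X (L 0) ∷ []) (d-odd ∷ U≡d² ∷ h ∷ [])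
        where
        identity : ∀ d P S D X → (d * d * (1ℤ * 1ℤ * (1ℤ * 1ℤ)) + - (+ 2 * (P + (P + (+ 2 * S))) * D * d) *
          (X * X) * (1ℤ * 1ℤ) + (+ 2 * S) * (+ 2 * S) * (D * D) * (X * X * (X * X))) - d * d ≡
          (- ((P + S) * D * d) * (X * X) + S * S * (D * D) * (X * X * (X * X))) * + 4
        identity = solve-∀
        U≡d² : Φ X (L 0) ≡[ + 4 ] d * d
        U≡d² = lin₀ (- ((P + S) * D * d) * (X * X) + S * S * (D * D) * (X * X * (X * X)))
          (trans (cong (_- d * d) (trans (Φ≡poly X (L 0)) (cong₂ (λ T Z → poly d P T D X Z) T≡2S L-zero))) (identity d P S D X))

      -- When `T` divides `Z`, removing `T²` leaves the odd square `D² X⁴` modulo 4.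
      at-large : ∀ X a k → a ≡ m ℕ.+ k → Odd X → Matches prime[2] X a → d ≡[ + 4 ] 1ℤ
      at-large X .(m ℕ.+ k) k refl X-odd M =
        let _ , h = match X (m ℕ.+ k) M (m ℕ.+ m) U 0 d value
                      (infer 4 (odd! x₀ ∷ odd! x₁ ∷ (x₂ ≋ x₀ :* x₀ :* (x₁ :* x₁ :* (x₁ :* x₁)) mod 4) ∷ [])
                        (odd! x₂) refl (D ∷ X ∷ U ∷ []) (D-odd ∷ X-odd ∷ U≡ ∷ []))
                      (bound 0 m k z≤n) d≡L₀d d-odd
        in infer 8 (odd! x₀ ∷ odd! x₁ ∷ (x₂ ≋ x₀ :* x₀ :* (x₁ :* x₁ :* (x₁ :* x₁)) mod 4) ∷ (x₂ ≋ x₃ mod 8) ∷ [])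
          (x₃ ≋ con 1ℤ mod 4) refl
             (D ∷ X ∷ U ∷ d ∷ []) (D-odd ∷ X-odd ∷ U≡ ∷ h ∷ [])
        where
        K : ℤ
        K = L k
        U : ℤ
        U = d * d * (T * T) * (K * K * (K * K)) + - (+ 2 * (P + (P + T)) * D * d) * (X * X) * (K * K) + D * D * (X * X * (X * X))
        identity : ∀ d P T D X K → (d * d * ((T * K) * (T * K) * ((T * K) * (T * K))) + - (+ 2 * (P + (P + T)) * D * d) *
          (X * X) * ((T * K) * (T * K)) + T * T * (D * D) * (X * X * (X * X))) ≡
          T * T * (d * d * (T * T) * (K * K * (K * K)) + - (+ 2 * (P + (P + T)) * D * d) * (X * X) *
            (K * K) + D * D * (X * X * (X * X)))
        identity = solve-∀
        value : Φ X (L (m ℕ.+ k)) ≡ L (m ℕ.+ m) * U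
        value = trans (Φ≡poly X (L (m ℕ.+ k))) (trans (cong (poly d P T D X) (trans (L-+ m k) (cong (_* K) (sym T≡))))
          (trans (identity d P T D X K) (cong (_* U) (sym (trans (L-+ m m) (cong₂ _*_ (sym T≡) (sym T≡)))))))
        strip : ∀ d P S D X K → d * d * (+ 2 * S * (+ 2 * S)) * (K * K * (K * K)) + - (+ 2 * (P + (P + + 2 * S)) * D * d) *
          (X * X) * (K * K) + D * D * (X * X * (X * X)) - D * D * (X * X * (X * X)) ≡
          (d * d * (S * S) * (K * K * (K * K)) + - ((P + S) * D * d) * (X * X) * (K * K)) * + 4
        strip = solve-∀
        U≡ : U ≡[ + 4 ] D * D * (X * X * (X * X))
        U≡ = lin₀ (d * d * (S * S) * (K * K * (K * K)) + - ((P + S) * D * d) * (X * X) * (K * K))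
          (trans (cong (λ T → d * d * (T * T) * (K * K * (K * K)) + - (+ 2 * (P + (P + T)) * D * d) * (X * X) *
            (K * K) + D * D * (X * X * (X * X)) - D * D * (X * X * (X * X))) T≡2S) (strip d P S D X K))

      module _ (d≡3 : d ≡[ + 4 ] + 3) where

        odd-valuation : ∀ X a′ V → V ≡[ + 4 ] + 2 → Φ X (L (suc a′)) ≡ L 4 * (L a′ * L a′) * V → Matches prime[2] X (suc a′) → ⊥
        odd-valuation X a′ V V≡2 value M = let U , V≡ , U-odd = double-odd V≡2 in
          case trans (sym (proj₁ (match X (suc a′) M (5 ℕ.+ (a′ ℕ.+ a′)) U 0 d
            (trans value (trans (cong (L 4 * (L a′ * L a′) *_) V≡) (trans (rearrange (L 4) (L a′) U)
              (cong (_* U) (sym (trans (L-double 5 a′) (cong (_* (L a′ * L a′)) (L-suc 4))))))))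
            U-odd (bound′ 5 a′ (s≤s (s≤s (s≤s (s≤s (s≤s z≤n)))))) d≡L₀d d-odd))) (oddᵇ-even 5 a′) of λ ()
          where
          rearrange : ∀ c a U → c * (a * a) * (+ 2 * U) ≡ + 2 * c * (a * a) * U
          rearrange = solve-∀

        -- Here `T = 2 Z`, and `16 R²` with `R = 2^a` can be removed. For even `R` and `P D`
        -- congruent to 1 the cofactor is 2 modulo 4, an odd valuation. For `R = 1` it is odd, and
        -- comparing it with `d` modulo 8 gives the condition.
        at-middle : ∀ X a → m ≡ suc (suc a) → Odd X → Matches prime[2] X (suc a) → P * D ≡[ + 4 ] 1ℤ ⊎ m ≡
          2 → m ≡ 2 × (P + + 2) * D ≡[ + 8 ] + 5
        at-middle X a e X-odd M = go a refl
          where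
          R V : ℤ
          R = L a
          V = d * d * (R * R) - (P + + 2 * R) * D * d * (X * X) + D * D * (X * X * (X * X))
          identity : ∀ d P R D X → (d * d * ((+ 2 * R) * (+ 2 * R) * ((+ 2 * R) * (+ 2 * R)))
            + - (+ 2 * (P + (P + (+ 4 * R))) * D * d) * (X * X) * ((+ 2 * R) * (+ 2 * R)) + (+ 4 * R) *
            (+ 4 * R) * (D * D) * (X * X * (X * X))) ≡
            + 16 * (R * R) * (d * d * (R * R) - (P + + 2 * R) * D * d * (X * X) + D * D * (X * X * (X * X)))
          identity = solve-∀
          value : Φ X (L (suc a)) ≡ L 4 * (L a * L a) * V
          value = trans (Φ≡poly X (L (suc a))) (trans (cong₂ (λ T Z → poly d P T D X Z)
              (trans T≡ (trans (cong L e) (trans (L-+ 2 a) (cong (_* R) (L-def 2))))) (L-suc a))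
            (trans (identity d P R D X) (cong (λ c → c * (R * R) * V) (sym (L-def 4)))))
          go : ∀ a₀ → a ≡ a₀ → P * D ≡[ + 4 ] 1ℤ ⊎ m ≡ 2 → m ≡ 2 × (P + + 2) * D ≡[ + 8 ] + 5
          go (suc a₁) a≡ (inj₂ m≡2) = case trans (sym a≡) (ℕₚ.suc-injective (ℕₚ.suc-injective (trans (sym e) m≡2))) of λ ()
          go (suc a₁) a≡ (inj₁ PD≡1) = ⊥-elim (odd-valuation X a V
            (infer 4 (odd! x₁ ∷ odd! x₃ ∷ (x₀ :* x₁ ≋ con 1ℤ mod 4) ∷ (x₂ ≋ con (+ 3) mod 4) ∷ (x₄ ≋ con 0ℤ mod 2) ∷ [])
              (x₂ :* x₂ :* (x₄ :* x₄) :- (x₀ :+ con (+ 2) :* x₄) :* x₁ :* x₂ :* (x₃ :* x₃) :+ x₁ :* x₁ :*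
                (x₃ :* x₃ :* (x₃ :* x₃)) ≋ con (+ 2) mod 4) refl
              (P ∷ D ∷ d ∷ X ∷ R ∷ []) (D-odd ∷ X-odd ∷ PD≡1 ∷ d≡3 ∷ subst (λ b → L b ≡[ + 2 ] 0ℤ) (sym a≡) (L-even a₁) ∷ []))
                value M)
          go zero a≡ _ = trans e (cong (λ b → suc (suc b)) a≡) ,
            infer 8 (odd! x₁ ∷ odd! x₃ ∷ odd! x₀ ∷ (x₂ ≋ con (+ 3) mod 4) ∷ (V₈ ≋ x₂ mod 8) ∷ [])
              ((x₀ :+ con (+ 2)) :* x₁ ≋ con (+ 5) mod 8) refl
              (P ∷ D ∷ d ∷ X ∷ []) (D-odd ∷ X-odd ∷ P-odd ∷ d≡3 ∷ subst (λ R → d * d * (R * R) - (P + + 2 * R)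
                * D * d * (X * X) + D * D * (X * X * (X * X)) ≡[ + 8 ] d) R≡1
                (proj₂ (match X (suc a) M (4 ℕ.+ (a ℕ.+ a)) V 0 d (trans value (cong (_* V) (sym (L-double 4 a))))
                (subst (λ R → Odd (d * d * (R * R) - (P + + 2 * R) * D * d * (X * X) + D * D * (X * X * (X * X)))) (sym R≡1)
                  (infer 2 (odd! x₀ ∷ odd! x₁ ∷ odd! x₂ ∷ odd! x₃ ∷ []) (odd! V₈) refl (P ∷ D ∷ d ∷ X ∷ [])
                    (P-odd ∷ D-odd ∷ d-odd ∷ X-odd ∷ [])))
                (bound′ 4 a (s≤s (s≤s (s≤s (s≤s z≤n))))) d≡L₀d d-odd)) ∷ [])
            where
            R≡1 : R ≡ 1ℤ
            R≡1 = trans (cong L a≡) L-zero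
            V₈ : Expr 4
            V₈ = x₂ :* x₂ :* (con 1ℤ :* con 1ℤ) :- (x₀ :+ con (+ 2) :* con 1ℤ) :* x₁ :* x₂ :* (x₃ :* x₃) :+
              x₁ :* x₁ :* (x₃ :* x₃ :* (x₃ :* x₃))

        -- For `a = 0` the cofactor `V` is 2 modulo 4, an odd valuation; for larger `a` it is 1
        -- modulo 4, whereas `d` is 3.
        at-small : ∀ X a k → m ≡ suc a ℕ.+ 2 ℕ.+ k → Odd X → Matches prime[2] X (suc a) → P * D ≡[ + 4 ] 1ℤ → ⊥
        at-small X a k e X-odd M PD≡1 = go (parity Z)
          where
          Z K V : ℤ
          Z = L a
          K = L k
          V = d * d * (Z * Z) - (P + + 4 * Z * K) * D * d * (X * X) + + 4 * (K * K) * (D * D) * (X * X * (X * X))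
          V₄ : Expr 6
          V₄ = x₂ :* x₂ :* (x₄ :* x₄) :- (x₀ :+ con (+ 4) :* x₄ :* x₅) :* x₁ :* x₂ :* (x₃ :* x₃) :+ con (+ 4) :*
            (x₅ :* x₅) :* (x₁ :* x₁) :* (x₃ :* x₃ :* (x₃ :* x₃))
          ρ : Vec ℤ 6
          ρ = P ∷ D ∷ d ∷ X ∷ Z ∷ K ∷ []
          identity : ∀ d P Z K D X → (d * d * ((+ 2 * Z) * (+ 2 * Z) * ((+ 2 * Z) * (+ 2 * Z)))
            + - (+ 2 * (P + (P + (+ 8 * Z * K))) * D * d) * (X * X) * ((+ 2 * Z) * (+ 2 * Z)) + (+ 8 * Z * K) *
            (+ 8 * Z * K) * (D * D) * (X * X * (X * X))) ≡
            + 16 * (Z * Z) * (d * d * (Z * Z) - (P + + 4 * Z * K) * D * d * (X * X) + + 4 * (K * K) * (D * D) * (X * X * (X * X)))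
          identity = solve-∀
          value : Φ X (L (suc a)) ≡ L 4 * (Z * Z) * V
          value = trans (Φ≡poly X (L (suc a))) (trans (cong₂ (λ T Z → poly d P T D X Z) (Z-small a k e) (L-suc a))
            (trans (identity d P Z K D X) (cong (λ c → c * (Z * Z) * V) (sym (L-def 4)))))
          go : Z ≡[ + 2 ] 0ℤ ⊎ Odd Z → ⊥
          go (inj₂ Z-odd) = odd-valuation X a V
            (infer 4 (odd! x₄ ∷ odd! x₃ ∷ (x₀ :* x₁ ≋ con 1ℤ mod 4) ∷ (x₂ ≋ con (+ 3) mod 4) ∷ []) (V₄ ≋ con (+ 2) mod 4) refl ρ
              (Z-odd ∷ X-odd ∷ PD≡1 ∷ d≡3 ∷ [])) value M
          go (inj₁ Z-even) = case decide 8 ((x₀ ≋ con 1ℤ mod 4) ∷ (x₁ ≋ con (+ 3) mod 4) ∷ (x₀ ≋ x₁ mod 8) ∷ [])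
            [] refl (V ∷ d ∷ [])
              (V≡1 ∷ d≡3 ∷ proj₂ (match X (suc a) M (4 ℕ.+ (a ℕ.+ a)) V 0 d (trans value (cong (_* V) (sym (L-double 4 a))))
                (infer 4 ((x₀ ≋ con 1ℤ mod 4) ∷ []) (odd! x₀) refl (V ∷ []) (V≡1 ∷ []))
                (bound′ 4 a (s≤s (s≤s (s≤s (s≤s z≤n))))) d≡L₀d d-odd) ∷ []) of λ ()
            where
            V≡1 : V ≡[ + 4 ] 1ℤ
            V≡1 = infer 4 ((x₄ ≋ con 0ℤ mod 2) ∷ odd! x₃ ∷ (x₀ :* x₁ ≋ con 1ℤ mod 4) ∷ (x₂ ≋ con (+ 3) mod 4) ∷ [])
              (V₄ ≋ con 1ℤ mod 4) refl ρ
              (Z-even ∷ X-odd ∷ PD≡1 ∷ d≡3 ∷ [])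

      odd-necessary : Point → OddSoluble m P D d
      odd-necessary pt = let X , a , norm , M = point-matches prime[2] pt in
        [ inj₁ , (λ d≡3 → [ (λ PD≡1 → go X a norm M d≡3 (inj₁ PD≡1)) , (λ PD≡3 → split X a norm M d≡3 PD≡3 (3 ℕ.≤? m)) ]′
          (mod-four (P * D) PD-odd)) ]′ (mod-four d d-odd)
        where
        PD-odd : Odd (P * D)
        PD-odd = *-congₘ P-odd D-odd
        go : ∀ X a → a ≡ 0 ⊎ Unit 2 X → Matches prime[2] X a → d ≡[ + 4 ] + 3 → P * D ≡[ + 4 ] 1ℤ ⊎ m ≡ 2 → OddSoluble m P D d
        go X zero _ M _ _ = inj₁ (at-zero X M)
        go X (suc a) (inj₂ uX) M d≡3 h = by-regime (regime m (suc a)) h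
          where
          X-odd : Odd X
          X-odd = [ (λ z → contradiction z uX) , (λ o → o) ]′ (parity X)
          by-regime : Regime m (suc a) → P * D ≡[ + 4 ] 1ℤ ⊎ m ≡ 2 → OddSoluble m P D d
          by-regime (large k e) _ = inj₁ (at-large X (suc a) k e X-odd M)
          by-regime (middle e) h = inj₂ (inj₁ (at-middle d≡3 X a e X-odd M h))
          by-regime (small k e) (inj₁ PD≡1) = ⊥-elim (at-small d≡3 X a k e X-odd M PD≡1)
          by-regime (small k e) (inj₂ m≡2) = contradiction (trans (sym m≡2) (trans e (rearrange a k))) λ ()
            where
            rearrange : ∀ a k → suc a ℕ.+ 2 ℕ.+ k ≡ 3 ℕ.+ (a ℕ.+ k)
            rearrange = ℕSolver.solve-∀
        split : ∀ X a → a ≡ 0 ⊎ Unit 2 X → Matches prime[2] X a → d ≡[ + 4 ] + 3 → P * D ≡[ + 4 ] + 3 →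
          Dec (3 ℕ.≤ m) → OddSoluble m P D d
        split X a norm M d≡3 PD≡3 (yes 3≤m) = inj₂ (inj₂ (3≤m , PD≡3))
        split X zero norm M d≡3 PD≡3 (no _) = inj₁ (at-zero X M)
        split X (suc a) norm M d≡3 PD≡3 (no m≱3) = two (m ℕ.≟ 2)
          where
          two : Dec (m ≡ 2) → OddSoluble m P D d
          two (yes m≡2) = go X (suc a) norm M d≡3 (inj₂ m≡2)
          two (no m≢2) = inj₁ (at-large X (suc a) a (cong (ℕ._+ a) (sym m≡1))
            ([ (λ z → contradiction z (unit norm)) , (λ o → o) ]′ (parity X)) M)
            where
            unit : suc a ≡ 0 ⊎ Unit 2 X → Unit 2 X
            unit (inj₂ u) = u
            m≡1 : m ≡ 1
            m≡1 = ℕₚ.≤-antisym (ℕₚ.≤-pred (ℕₚ.≤∧≢⇒< (ℕₚ.≤-pred (ℕₚ.≰⇒> m≱3)) m≢2)) 1≤m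

  odd-necessary : Odd d → Point → OddSoluble m P D d
  odd-necessary = OddCase.odd-necessary

  private
    module EvenCase (d′ : ℤ) (d≡ : d ≡ + 2 * d′) (d′-odd : Odd d′) where

      d≡L₁d′ : d ≡ L 1 * d′
      d≡L₁d′ = trans d≡ (cong (_* d′) (sym (L-def 1)))

      no-even-valuation : ∀ X a v U → Matches prime[2] X a → Φ X (L a) ≡ L v * U → Odd U → v ℕ.≤ 4 ℕ.* a ℕ.+ 4 →
        oddᵇ v ≡ false → ⊥
      no-even-valuation X a v U M value U-odd v≤ v-even =
        case trans (sym v-even) (proj₁ (match X a M v U 1 d′ value U-odd v≤ d≡L₁d′ d′-odd)) of λ ()

      -- The quartic is `4 V`, and `V` must be even because `d` has odd valuation. An even `S` would
      -- make `V` odd, so `m = 1`; then `V` is 2 modulo 4 and its half is compared with `d′`.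
      at-zero : ∀ X → Matches prime[2] X 0 → EvenSoluble m P D d′
      at-zero X M = [ (λ V-even → go m′ refl V-even) ,
        (λ V-odd → ⊥-elim (no-even-valuation X 0 2 V M value V-odd (s≤s (s≤s z≤n)) refl)) ]′ (parity V)
        where
        V : ℤ
        V = d′ * d′ - + 2 * (P + S) * D * d′ * (X * X) + S * S * (D * D) * (X * X * (X * X))
        V₂ : Expr 5
        V₂ = x₂ :* x₂ :- con (+ 2) :* (x₀ :+ x₄) :* x₁ :* x₂ :* (x₃ :* x₃) :+ x₄ :* x₄ :* (x₁ :* x₁) :* (x₃ :* x₃ :* (x₃ :* x₃))
        ρ : Vec ℤ 5
        ρ = P ∷ D ∷ d′ ∷ X ∷ S ∷ []
        identity : ∀ d P S D X → ((+ 2 * d) * (+ 2 * d) * (1ℤ * 1ℤ * (1ℤ * 1ℤ)) + - (+ 2 * (P + (P + (+ 2 * S))) * D *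
          (+ 2 * d)) * (X * X) * (1ℤ * 1ℤ) + (+ 2 * S) * (+ 2 * S) * (D * D) * (X * X * (X * X))) ≡
          + 4 * (d * d - + 2 * (P + S) * D * d * (X * X) + S * S * (D * D) * (X * X * (X * X)))
        identity = solve-∀
        Φ≡4V : Φ X (L 0) ≡ + 4 * V
        Φ≡4V = trans (Φ≡poly X (L 0)) (trans (cong (poly d P T D X) L-zero)
          (trans (cong₂ (λ d T → poly d P T D X 1ℤ) d≡ T≡2S) (identity d′ P S D X)))
        value : Φ X (L 0) ≡ L 2 * V
        value = trans Φ≡4V (cong (_* V) (sym (L-def 2)))
        go : ∀ n → m′ ≡ n → V ≡[ + 2 ] 0ℤ → EvenSoluble m P D d′
        go (suc n) e V-even = case decide 2 (odd! x₂ ∷ (x₄ ≋ con 0ℤ mod 2) ∷ (V₂ ≋ con 0ℤ mod 2) ∷ []) [] refl ρ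
          (d′-odd ∷ subst (λ b → L b ≡[ + 2 ] 0ℤ) (sym e) (L-even n) ∷ V-even ∷ []) of λ ()
        -- `X²` is 1 or 9 modulo 16, and both give the same class of `V` modulo 16, so `X`
        -- disappears from the condition.
        go zero e V-even = inj₁ (trans m≡ (cong suc e) , infer 16
            (odd! x₀ ∷ odd! x₁ ∷ odd! x₂ ∷ odd! x₃ ∷ (V₁ ≋ con (+ 2) :* x₂ mod 16) ∷ [])
            (x₂ :* x₂ :+ x₁ :* x₁ :- con (+ 2) :* (x₀ :+ con 1ℤ) :* x₁ :* x₂ ≋ con (+ 2) :* x₂ mod 16) refl σ
            (P-odd ∷ D-odd ∷ d′-odd ∷ X-odd ∷ subst (λ S → d′ * d′ - + 2 * (P + S) * D * d′ * (X * X) + S * S *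
              (D * D) * (X * X * (X * X)) ≡[ + 16 ] + 2 * d′) S≡1 V≡2d′ ∷ []))
          where
          S≡1 : S ≡ 1ℤ
          S≡1 = trans (cong L e) L-zero
          σ : Vec ℤ 4
          σ = P ∷ D ∷ d′ ∷ X ∷ []
          V₁ : Expr 4
          V₁ = x₂ :* x₂ :- con (+ 2) :* (x₀ :+ con 1ℤ) :* x₁ :* x₂ :* (x₃ :* x₃) :+ con 1ℤ :* con 1ℤ :*
            (x₁ :* x₁) :* (x₃ :* x₃ :* (x₃ :* x₃))
          X-odd : Odd X
          X-odd = infer 2 (odd! x₂ ∷ odd! x₁ ∷ odd! x₄ ∷ (V₂ ≋ con 0ℤ mod 2) ∷ []) (odd! x₃) refl ρ
            (d′-odd ∷ D-odd ∷ ≡ₘ-reflexive S≡1 ∷ V-even ∷ [])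
          V≡2 : V ≡[ + 4 ] + 2
          V≡2 = infer 4 (odd! x₀ ∷ odd! x₁ ∷ odd! x₂ ∷ odd! x₃ ∷ (x₄ ≋ con 1ℤ mod 4) ∷ []) (V₂ ≋ con (+ 2) mod 4) refl ρ
            (P-odd ∷ D-odd ∷ d′-odd ∷ X-odd ∷ ≡ₘ-reflexive S≡1 ∷ [])
          V≡2d′ : V ≡[ + 16 ] + 2 * d′
          V≡2d′ = let U , V≡ , U-odd = double-odd V≡2
                      _ , h = match X 0 M 3 U 1 d′ (trans Φ≡4V (trans (cong (+ 4 *_) V≡)
                        (trans (sym (ℤₚ.*-assoc (+ 4) (+ 2) U)) (cong (_* U) (sym (L-def 3)))))) U-odd
                        (s≤s (s≤s (s≤s z≤n))) d≡L₁d′ d′-odd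
                  in ≡ₘ-trans (≡ₘ-reflexive V≡) (scaleₘ (+ 2) h)

      -- When `Z` is even and divisible by `S = T / 2`, the quartic is `4 S²` times an odd number:
      -- an even valuation.
      at-large : ∀ X a k → suc a ≡ m′ ℕ.+ k → Odd X → Matches prime[2] X (suc a) → ⊥
      at-large X a k e X-odd M = no-even-valuation X (suc a) (2 ℕ.+ (m′ ℕ.+ m′)) V M value
          (infer 2 (odd! x₁ ∷ odd! x₃ ∷ (x₄ :* x₅ ≋ con 0ℤ mod 2) ∷ []) (odd! V₂) refl
            (P ∷ D ∷ d′ ∷ X ∷ S ∷ K ∷ []) (D-odd ∷ X-odd ∷ ≡ₘ-trans (≡ₘ-reflexive (sym Z≡)) (L-even a) ∷ []))
          (subst (λ b → 2 ℕ.+ (m′ ℕ.+ m′) ℕ.≤ 4 ℕ.* b ℕ.+ 4) (sym e) (bound 2 m′ k (s≤s (s≤s z≤n)))) (oddᵇ-even 2 m′)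
        where
        K V : ℤ
        K = L k
        V = d′ * d′ * (S * S) * (K * K * (K * K)) - + 2 * (P + S) * D * d′ * (X * X) * (K * K) + D * D * (X * X * (X * X))
        V₂ : Expr 6
        V₂ = x₂ :* x₂ :* (x₄ :* x₄) :* (x₅ :* x₅ :* (x₅ :* x₅)) :- con (+ 2) :* (x₀ :+ x₄) :* x₁ :* x₂ :*
          (x₃ :* x₃) :* (x₅ :* x₅) :+ x₁ :* x₁ :* (x₃ :* x₃ :* (x₃ :* x₃))
        Z≡ : L (suc a) ≡ S * K
        Z≡ = trans (cong L e) (L-+ m′ k)
        identity : ∀ d P S D X K → ((+ 2 * d) * (+ 2 * d) * ((S * K) * (S * K) * ((S * K) * (S * K)))
          + - (+ 2 * (P + (P + (+ 2 * S))) * D * (+ 2 * d)) * (X * X) * ((S * K) * (S * K)) + (+ 2 * S) *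
          (+ 2 * S) * (D * D) * (X * X * (X * X))) ≡
          + 4 * (S * S) * (d * d * (S * S) * (K * K * (K * K)) - + 2 * (P + S) * D * d * (X * X) * (K * K) + D * D *
            (X * X * (X * X)))
        identity = solve-∀
        value : Φ X (L (suc a)) ≡ L (2 ℕ.+ (m′ ℕ.+ m′)) * V
        value = trans (Φ≡poly X (L (suc a))) (trans (cong (poly d P T D X) Z≡)
          (trans (cong₂ (λ d T → poly d P T D X (S * K)) d≡ T≡2S)
          (trans (identity d′ P S D X K) (cong (_* V) (sym (trans (L-double 2 m′) (cong (_* (S * S)) (L-def 2))))))))

      module Small (X : ℤ) (a k : ℕ) (e : m ≡ suc a ℕ.+ 2 ℕ.+ k) where

        Z K U : ℤ
        Z = L a
        K = L k
        U = + 2 * (Z * Z) * (d′ * d′) - (P + + 4 * Z * K) * D * d′ * (X * X) + + 2 * (K * K) * (D * D) * (X * X * (X * X))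

        private
          identity : ∀ d P Z K D X → ((+ 2 * d) * (+ 2 * d) * ((+ 2 * Z) * (+ 2 * Z) * ((+ 2 * Z) * (+ 2 * Z)))
            + - (+ 2 * (P + (P + (+ 8 * Z * K))) * D * (+ 2 * d)) * (X * X) * ((+ 2 * Z) * (+ 2 * Z)) + (+ 8 * Z * K) *
            (+ 8 * Z * K) * (D * D) * (X * X * (X * X))) ≡
            + 32 * (Z * Z) * (+ 2 * (Z * Z) * (d * d) - (P + + 4 * Z * K) * D * d * (X * X) + + 2 * (K * K) *
              (D * D) * (X * X * (X * X)))
          identity = solve-∀

        value : Φ X (L (suc a)) ≡ + 32 * (Z * Z) * U
        value = trans (Φ≡poly X (L (suc a))) (trans (cong (poly d P T D X) (L-suc a))
          (trans (cong₂ (λ d T → poly d P T D X (+ 2 * Z)) d≡ (Z-small a k e))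
          (identity d′ P Z K D X)))

        U-odd : Odd X → Odd U
        U-odd X-odd = infer 2 (odd! x₀ ∷ odd! x₁ ∷ odd! x₂ ∷ odd! x₃ ∷ [])
          (odd! (con (+ 2) :* (x₄ :* x₄) :* (x₂ :* x₂) :- (x₀ :+ con (+ 4) :* x₄ :* x₅) :* x₁ :* x₂ :*
            (x₃ :* x₃) :+ con (+ 2) :* (x₅ :* x₅) :* (x₁ :* x₁) :* (x₃ :* x₃ :* (x₃ :* x₃)))) refl
          (P ∷ D ∷ d′ ∷ X ∷ Z ∷ K ∷ []) (P-odd ∷ D-odd ∷ d′-odd ∷ X-odd ∷ [])

      U₅ : ∀ {n} (z k : Expr (4 ℕ.+ n)) → Expr (4 ℕ.+ n)
      U₅ z k = con (+ 2) :* (z :* z) :* (x₂ :* x₂) :- (x₀ :+ con (+ 4) :* z :* k) :* x₁ :* x₂ :* (x₃ :* x₃) :+ con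
        (+ 2) :* (k :* k) :* (x₁ :* x₁) :* (x₃ :* x₃ :* (x₃ :* x₃))

      Uz : ℤ → ℤ → ℤ → ℤ
      Uz X Z K = + 2 * (Z * Z) * (d′ * d′) - (P + + 4 * Z * K) * D * d′ * (X * X) + + 2 * (K * K) * (D * D) * (X * X * (X * X))

      even-even : ∀ X z k → Uz X (+ 2 * z) (+ 2 * k) ≡[ + 8 ] - (P * D * d′ * (X * X))
      even-even X z k = lin₀ (z * z * (d′ * d′) - + 2 * z * k * D * d′ * (X * X) + k * k * (D * D) * (X * X * (X * X)))
        (identity d′ P z k D X)
        where
        identity : ∀ d P z k D X → + 2 * (+ 2 * z * (+ 2 * z)) * (d * d) - (P + + 4 * (+ 2 * z) * (+ 2 * k))
          * D * d * (X * X) + + 2 * (+ 2 * k * (+ 2 * k)) * (D * D) * (X * X * (X * X)) - - (P * D * d * (X * X)) ≡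
          (z * z * (d * d) - + 2 * z * k * D * d * (X * X) + k * k * (D * D) * (X * X * (X * X))) * + 8
        identity = solve-∀

      -- Modulo 8 the value `U` depends on `2^a` and `2^k` only through which of them equal 1. The
      -- resulting cases are the alternatives of `EvenSoluble` with `m` at least 3.
      at-small : ∀ X a k → m ≡ suc a ℕ.+ 2 ℕ.+ k → Odd X → Matches prime[2] X (suc a) → EvenSoluble m P D d′
      at-small X a k e X-odd M = go a k refl refl U≡d′
        where
        open Small X a k e
        U≡d′ : Uz X (L a) (L k) ≡[ + 8 ] d′
        U≡d′ = proj₂ (match X (suc a) M (5 ℕ.+ (a ℕ.+ a)) U 1 d′
          (trans value (cong (_* U) (sym (trans (L-double 5 a) (cong (_* (Z * Z)) (L-def 5))))))
          (U-odd X-odd) (bound′ 5 a (s≤s (s≤s (s≤s (s≤s (s≤s z≤n)))))) d≡L₁d′ d′-odd)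
        go : ∀ a₀ k₀ → a ≡ a₀ → k ≡ k₀ → Uz X (L a₀) (L k₀) ≡[ + 8 ] d′ → EvenSoluble m P D d′
        go zero zero refl refl h = inj₂
          (inj₁ (e , infer 8 (odd! x₀ ∷ odd! x₁ ∷ odd! x₂ ∷ odd! x₃ ∷ (U₅ (con 1ℤ) (con 1ℤ) ≋ x₂ mod 8) ∷ [])
          (x₀ :* x₁ ≋ con (+ 7) mod 8) refl (P ∷ D ∷ d′ ∷ X ∷ [])
          (P-odd ∷ D-odd ∷ d′-odd ∷ X-odd ∷ subst (λ z → Uz X z z ≡[ + 8 ] d′) L-zero h ∷ [])))
        go zero (suc k₁) refl refl h = inj₂ (inj₂ (inj₁ (subst (4 ℕ.≤_) (sym e) (s≤s (s≤s (s≤s (s≤s z≤n)))) ,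
          infer 8 (odd! x₀ ∷ odd! x₁ ∷ odd! x₂ ∷ odd! x₃ ∷ (x₄ ≋ con 0ℤ mod 2) ∷ (U₅ (con 1ℤ) x₄ ≋ x₂ mod 8) ∷ [])
          (con (+ 2) :* x₂ :- x₀ :* x₁ ≋ con 1ℤ mod 8) refl (P ∷ D ∷ d′ ∷ X ∷ L (suc k₁) ∷ [])
          (P-odd ∷ D-odd ∷ d′-odd ∷ X-odd ∷ L-even k₁ ∷ subst (λ z → Uz X z (L (suc k₁)) ≡[ + 8 ] d′) L-zero h ∷ []))))
        go (suc a₁) zero refl refl h = inj₂
          (inj₂ (inj₁ (subst (4 ℕ.≤_) (sym (trans e (rearrange a₁ 0))) (s≤s (s≤s (s≤s (s≤s z≤n)))) ,
          infer 8 (odd! x₀ ∷ odd! x₁ ∷ odd! x₂ ∷ odd! x₃ ∷ (x₄ ≋ con 0ℤ mod 2) ∷ (U₅ x₄ (con 1ℤ) ≋ x₂ mod 8) ∷ [])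
          (con (+ 2) :* x₂ :- x₀ :* x₁ ≋ con 1ℤ mod 8) refl (P ∷ D ∷ d′ ∷ X ∷ L (suc a₁) ∷ [])
          (P-odd ∷ D-odd ∷ d′-odd ∷ X-odd ∷ L-even a₁ ∷ subst (λ z → Uz X (L (suc a₁)) z ≡[ + 8 ] d′) L-zero h ∷ []))))
          where
          rearrange : ∀ a k → suc (suc a) ℕ.+ 2 ℕ.+ k ≡ 4 ℕ.+ (a ℕ.+ k)
          rearrange = ℕSolver.solve-∀
        go (suc a₁) (suc k₁) refl refl h = inj₂
          (inj₂ (inj₂ (subst (5 ℕ.≤_) (sym (trans e (rearrange a₁ k₁))) (s≤s (s≤s (s≤s (s≤s (s≤s z≤n))))) ,
          infer 8 (odd! x₀ ∷ odd! x₁ ∷ odd! x₂ ∷ odd! x₃ ∷ (con 0ℤ :- x₀ :* x₁ :* x₂ :* (x₃ :* x₃) ≋ x₂ mod 8) ∷ [])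
            (x₀ :* x₁ ≋ con (+ 7) mod 8) refl
            (P ∷ D ∷ d′ ∷ X ∷ []) (P-odd ∷ D-odd ∷ d′-odd ∷ X-odd ∷
              ≡ₘ-trans (≡ₘ-reflexive (ℤₚ.+-identityˡ (- (P * D * d′ * (X * X))))) (≡ₘ-trans (≡ₘ-sym (even-even X (L a₁) (L k₁)))
                (subst₂ (λ z κ → Uz X z κ ≡[ + 8 ] d′) (L-suc a₁) (L-suc k₁) h)) ∷ []))))
          where
          rearrange : ∀ a k → suc (suc a) ℕ.+ 2 ℕ.+ suc k ≡ 5 ℕ.+ (a ℕ.+ k)
          rearrange = ℕSolver.solve-∀

      even-necessary : Point → EvenSoluble m P D d′
      even-necessary pt = let X , a , norm , M = point-matches prime[2] pt in go X a norm M
        where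
        go : ∀ X a → a ≡ 0 ⊎ Unit 2 X → Matches prime[2] X a → EvenSoluble m P D d′
        go X zero _ M = at-zero X M
        go X (suc a) (inj₂ uX) M = by-regime (regime m (suc a))
          where
          X-odd : Odd X
          X-odd = [ (λ z → contradiction z uX) , (λ o → o) ]′ (parity X)
          by-regime : Regime m (suc a) → EvenSoluble m P D d′
          by-regime (large k e) = ⊥-elim (at-large X a (suc k) (trans e (trans (cong (ℕ._+ k) m≡) (sym (ℕₚ.+-suc m′ k)))) X-odd M)
          by-regime (middle e) = ⊥-elim (at-large X a 0 (trans (ℕₚ.suc-injective (trans (sym e) m≡)) (sym (ℕₚ.+-identityʳ m′)))
            X-odd M)
          by-regime (small k e) = at-small X a k e X-odd M

      from-U : ∀ a k → m ≡ suc a ℕ.+ 2 ℕ.+ k → Uz 1ℤ (L a) (L k) ≡[ + 8 ] d′ → Point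
      from-U a k e h = point-2 1ℤ (suc a) (2 ℕ.+ a) (+ 2) d′ U d≡
        (trans value (cong (_* U) (trans (regroup (L a)) (cong (λ z → + 2 * (z * z))
          (sym (trans (L-+ 2 a) (cong (_* L a) (L-def 2)))))))) d′-odd h
        where
        open Small 1ℤ a k e
        regroup : ∀ Z → + 32 * (Z * Z) ≡ + 2 * (+ 4 * Z * (+ 4 * Z))
        regroup = solve-∀

      even-sufficient : EvenSoluble m P D d′ → Point
      even-sufficient (inj₁ (m≡1 , h)) = build h
        where
        V : ℤ
        V = d′ * d′ + D * D - + 2 * (P + 1ℤ) * D * d′
        identity : ∀ d P D → ((+ 2 * d) * (+ 2 * d) * (1ℤ * 1ℤ * (1ℤ * 1ℤ)) + - (+ 2 * (P + (P + (+ 2))) * D * (+ 2 * d)) *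
          (1ℤ * 1ℤ) * (1ℤ * 1ℤ) + (+ 2) * (+ 2) * (D * D) * (1ℤ * 1ℤ * (1ℤ * 1ℤ))) ≡ + 4 *
          (d * d + D * D - + 2 * (P + 1ℤ) * D * d)
        identity = solve-∀
        regroup : ∀ d k → + 4 * (+ 2 * d + k * + 16) ≡ + 2 * (+ 2 * + 2) * (d + k * + 8)
        regroup = solve-∀
        T≡2 : T ≡ + 2
        T≡2 = trans T≡ (trans (cong L m≡1) (L-def 1))
        build : V ≡[ + 16 ] + 2 * d′ → Point
        build (k by e) = point-2 1ℤ 0 1 (+ 2) d′ (d′ + k * + 8) d≡
          (trans (Φ≡poly 1ℤ (L 0)) (trans (cong (poly d P T D 1ℤ) L-zero)
            (trans (cong₂ (λ d T → poly d P T D 1ℤ 1ℤ) d≡ T≡2) (trans (identity d′ P D)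
            (trans (cong (+ 4 *_) e) (trans (regroup d′ k) (cong (λ z → + 2 * (z * z) * (d′ + k * + 8)) (sym (L-def 1)))))))))
          d′-odd (k by refl)
      even-sufficient (inj₂ (inj₁ (m≡3 , h))) = from-U 0 0 m≡3 (subst (λ z → Uz 1ℤ z z ≡[ + 8 ] d′) (sym L-zero)
        (infer 8 (odd! x₀ ∷ odd! x₁ ∷ odd! x₂ ∷ (x₃ ≋ con 1ℤ mod 8) ∷ (x₀ :* x₁ ≋ con (+ 7) mod 8) ∷ [])
          (U₅ (con 1ℤ) (con 1ℤ) ≋ x₂ mod 8) refl
          (P ∷ D ∷ d′ ∷ 1ℤ ∷ []) (P-odd ∷ D-odd ∷ d′-odd ∷ ≡ₘ-refl ∷ h ∷ [])))
      even-sufficient (inj₂ (inj₂ (inj₁ (4≤m , h)))) = from-U 0 (suc k) m≡4+k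
        (subst (λ z → Uz 1ℤ z (L (suc k)) ≡[ + 8 ] d′) (sym L-zero)
        (infer 8 (odd! x₀ ∷ odd! x₁ ∷ odd! x₂ ∷ (x₃ ≋ con 1ℤ mod 8) ∷ (x₄ ≋ con 0ℤ mod 2) ∷
          (con (+ 2) :* x₂ :- x₀ :* x₁ ≋ con 1ℤ mod 8) ∷ []) (U₅ (con 1ℤ) x₄ ≋ x₂ mod 8) refl
          (P ∷ D ∷ d′ ∷ 1ℤ ∷ L (suc k) ∷ []) (P-odd ∷ D-odd ∷ d′-odd ∷ ≡ₘ-refl ∷ L-even k ∷ h ∷ [])))
        where
        k : ℕ
        k = m ℕ.∸ 4
        m≡4+k : m ≡ 4 ℕ.+ k
        m≡4+k = sym (ℕₚ.m+[n∸m]≡n 4≤m)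
      -- `a = 1` together with the second exponent `m - 4`, positive because `m` is at least 5; this
      -- makes both powers even, as in `even-even`.
      even-sufficient (inj₂ (inj₂ (inj₂ (5≤m , h)))) = from-U 1 (suc k) (sym (ℕₚ.m+[n∸m]≡n 5≤m)) (≡ₘ-trans
          (subst₂ (λ z κ → Uz 1ℤ z κ ≡[ + 8 ] - (P * D * d′ * (1ℤ * 1ℤ))) (sym (L-suc 0)) (sym (L-suc k))
            (even-even 1ℤ (L 0) (L k)))
          (≡ₘ-trans (≡ₘ-reflexive (sym (ℤₚ.+-identityˡ (- (P * D * d′ * (1ℤ * 1ℤ))))))
            (infer 8 (odd! x₀ ∷ odd! x₁ ∷ odd! x₂ ∷ (x₃ ≋ con 1ℤ mod 8) ∷ (x₀ :* x₁ ≋ con (+ 7) mod 8) ∷ [])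
            (con 0ℤ :- x₀ :* x₁ :* x₂ :* (x₃ :* x₃) ≋ x₂ mod 8) refl (P ∷ D ∷ d′ ∷ 1ℤ ∷ [])
              (P-odd ∷ D-odd ∷ d′-odd ∷ ≡ₘ-refl ∷ h ∷ []))))
        where
        k : ℕ
        k = m ℕ.∸ 5

  even-necessary : ∀ {d′} → d ≡ + 2 * d′ → Odd d′ → Point → EvenSoluble m P D d′
  even-necessary {d′} = EvenCase.even-necessary d′

  even-sufficient : ∀ {d′} → d ≡ + 2 * d′ → Odd d′ → EvenSoluble m P D d′ → Point
  even-sufficient {d′} = EvenCase.even-sufficient d′

  -- For `d` congruent to 1 modulo 8, `X = 0` works. For 5 modulo 8, `X = Z = 1` works: exactly one
  -- of `P + S` and `S` is odd, so exactly one of the terms `4 (P + S) D d` and `4 S² D²`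
  -- contributes 4. The remaining alternatives use `Z = 2`.
  odd-sufficient : Odd d → OddSoluble m P D d → Point
  odd-sufficient d-odd (inj₁ d≡1) = go (decide 8 ((x₀ ≋ con 1ℤ mod 4) ∷ []) ((x₀ ≋ con 1ℤ mod 8) ∷
    (x₀ ≋ con (+ 5) mod 8) ∷ []) refl (d ∷ []) (d≡1 ∷ []))
    where
    go : Any (Holds (d ∷ [])) ((x₀ ≋ con 1ℤ mod 8) ∷ (x₀ ≋ con (+ 5) mod 8) ∷ []) → Point
    go (here h) = point-2 0ℤ 0 0 1ℤ d (d * d) (sym (ℤₚ.*-identityˡ d))
      (trans (Φ≡poly 0ℤ (L 0)) (trans (cong (poly d P T D 0ℤ) L-zero) (trans (identity d P T D)
        (cong (λ z → 1ℤ * (z * z) * (d * d)) (sym L-zero)))))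
      d-odd (infer 8 ((x₀ ≋ con 1ℤ mod 8) ∷ []) (x₀ :* x₀ ≋ x₀ mod 8) refl (d ∷ []) (h ∷ []))
      where
      identity : ∀ d P T D → (d * d * (1ℤ * 1ℤ * (1ℤ * 1ℤ)) + - (+ 2 * (P + (P + T)) * D * d) * (0ℤ * 0ℤ) *
        (1ℤ * 1ℤ) + T * T * (D * D) * (0ℤ * 0ℤ * (0ℤ * 0ℤ))) ≡ 1ℤ * (1ℤ * 1ℤ) * (d * d)
      identity = solve-∀
    go (there (here h)) = point-2 1ℤ 0 0 1ℤ d A (sym (ℤₚ.*-identityˡ d))
      (trans (Φ≡poly 1ℤ (L 0)) (trans (cong₂ (λ T Z → poly d P T D 1ℤ Z) T≡2S L-zero)
        (trans (identity d P S D) (cong (λ z → 1ℤ * (z * z) * A) (sym L-zero)))))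
      d-odd (A≡d m′ refl)
      where
      A : ℤ
      A = d * d - + 4 * (P + S) * D * d + + 4 * (S * S) * (D * D)
      identity : ∀ d P S D → (d * d * (1ℤ * 1ℤ * (1ℤ * 1ℤ)) + - (+ 2 * (P + (P + (+ 2 * S))) * D * d) *
        (1ℤ * 1ℤ) * (1ℤ * 1ℤ) + (+ 2 * S) * (+ 2 * S) * (D * D) * (1ℤ * 1ℤ * (1ℤ * 1ℤ))) ≡ 1ℤ * (1ℤ * 1ℤ) *
        (d * d - + 4 * (P + S) * D * d + + 4 * (S * S) * (D * D))
      identity = solve-∀
      A₈ : Expr 4
      A₈ = x₂ :* x₂ :- con (+ 4) :* (x₀ :+ x₃) :* x₁ :* x₂ :+ con (+ 4) :* (x₃ :* x₃) :* (x₁ :* x₁)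
      ρ : Vec ℤ 4
      ρ = P ∷ D ∷ d ∷ S ∷ []
      A≡d : ∀ n → m′ ≡ n → A ≡[ + 8 ] d
      A≡d zero e = infer 8 (odd! x₀ ∷ odd! x₁ ∷ (x₂ ≋ con (+ 5) mod 8) ∷ (x₃ ≋ con 1ℤ mod 8) ∷ []) (A₈ ≋ x₂ mod 8) refl ρ
        (P-odd ∷ D-odd ∷ h ∷ ≡ₘ-reflexive (trans (cong L e) L-zero) ∷ [])
      A≡d (suc n) e = infer 8 (odd! x₀ ∷ odd! x₁ ∷ (x₂ ≋ con (+ 5) mod 8) ∷ (x₃ ≋ con 0ℤ mod 2) ∷ []) (A₈ ≋ x₂ mod 8) refl ρ
        (P-odd ∷ D-odd ∷ h ∷ subst (λ b → L b ≡[ + 2 ] 0ℤ) (sym e) (L-even n) ∷ [])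
  odd-sufficient d-odd (inj₂ (inj₁ (m≡2 , h))) = [ (λ d≡1 → odd-sufficient d-odd (inj₁ d≡1)) , build ]′ (mod-four d d-odd)
    where
    A : ℤ
    A = d * d - (P + + 2) * D * d + D * D
    identity : ∀ d P D → (d * d * ((+ 2) * (+ 2) * ((+ 2) * (+ 2))) + - (+ 2 * (P + (P + (+ 4))) * D * d) *
      (1ℤ * 1ℤ) * ((+ 2) * (+ 2)) + (+ 4) * (+ 4) * (D * D) * (1ℤ * 1ℤ * (1ℤ * 1ℤ))) ≡ 1ℤ * (+ 4 * + 4) *
      (d * d - (P + + 2) * D * d + D * D)
    identity = solve-∀
    build : d ≡[ + 4 ] + 3 → Point
    build d≡3 = point-2 1ℤ 1 2 1ℤ d A (sym (ℤₚ.*-identityˡ d))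
      (trans (Φ≡poly 1ℤ (L 1)) (trans (cong₂ (λ T Z → poly d P T D 1ℤ Z) (trans T≡ (trans (cong L m≡2) (L-def 2))) (L-def 1))
        (trans (identity d P D) (cong (λ z → 1ℤ * (z * z) * A) (sym (L-def 2))))))
      d-odd (infer 8 (odd! x₁ ∷ (x₂ ≋ con (+ 3) mod 4) ∷ ((x₀ :+ con (+ 2)) :* x₁ ≋ con (+ 5) mod 8) ∷ [])
        (x₂ :* x₂ :- (x₀ :+ con (+ 2)) :* x₁ :* x₂ :+ x₁ :* x₁ ≋ x₂ mod 8) refl
        (P ∷ D ∷ d ∷ []) (D-odd ∷ d≡3 ∷ h ∷ []))
  odd-sufficient d-odd (inj₂ (inj₂ (3≤m , PD≡3))) = [ (λ d≡1 → odd-sufficient d-odd (inj₁ d≡1)) , build ]′ (mod-four d d-odd)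
    where
    k : ℕ
    k = m ℕ.∸ 3
    K β γ : ℤ
    K = L k
    β = (P + + 4 * K) * D * d
    γ = + 4 * (K * K) * (D * D)
    Q : ℤ → ℤ
    Q x = d * d - β * x + γ * (x * x)
    identity : ∀ d P K D X → (d * d * ((+ 2) * (+ 2) * ((+ 2) * (+ 2))) + - (+ 2 * (P + (P + (+ 8 * K))) * D * d) *
      (X * X) * ((+ 2) * (+ 2)) + (+ 8 * K) * (+ 8 * K) * (D * D) * (X * X * (X * X))) ≡ + 16 *
      (d * d - (P + + 4 * K) * D * d * (X * X) + + 4 * (K * K) * (D * D) * (X * X * (X * X)))
    identity = solve-∀
    value : ∀ X → Φ X (L 1) ≡ + 16 * Q (X * X)
    value X = trans (Φ≡poly X (L 1)) (trans (cong₂ (λ T Z → poly d P T D X Z) T≡8K (L-def 1)) (identity d P K D X))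
      where
      T≡8K : T ≡ + 8 * K
      T≡8K = trans T≡ (trans (cong L (sym (ℕₚ.m+[n∸m]≡n 3≤m))) (trans (L-+ 3 k) (cong (_* K) (L-def 3))))
    u : ℤ
    u = + 2 * γ - β
    u⁴≡1 : u * u * u * u ≡[ + 16 ] 1ℤ
    u⁴≡1 = infer 16 (odd! x₀ ∷ []) (x₀ :* x₀ :* x₀ :* x₀ ≋ con 1ℤ mod 16) refl (u ∷ [])
      (infer 2 (odd! x₀ ∷ odd! x₁ ∷ odd! x₂ ∷ []) (odd! (con (+ 2) :* (con (+ 4) :* (x₃ :* x₃) :* (x₁ :* x₁)) :-
        (x₀ :+ con (+ 4) :* x₃) :* x₁ :* x₂)) refl
        (P ∷ D ∷ d ∷ K ∷ []) (P-odd ∷ D-odd ∷ d-odd ∷ []) ∷ [])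
    -- Q (1 + 8 j) = Q 1 + 8 j u modulo 128, and u⁻¹ = u³ modulo 16.
    reach : ∀ τ → Q 1ℤ ≡[ + 8 ] τ → ∃ λ X → Q (X * X) ≡[ + 128 ] τ
    reach τ (r by e) = X , ≡ₘ-trans (lin₁ X²≡x (- β + γ * (X * X + x)) (difference (d * d) β γ (X * X) x)) (at-x u⁴≡1)
      where
      j x X : ℤ
      j = - (r * (u * u * u))
      x = 1ℤ + + 8 * j
      root : ∃ λ (y : ℕ → ℤ) → (∀ k → CongMod (y (suc k)) (y k) (2 ℕ.^ k)) × (∀ k → 1ℤ * (y k * y k) ≡[ L k ] x)
      root = Hensel₂.hensel₂ {1ℤ} {x} ≡ₘ-refl (lin₀ j (shift j))
        where
        shift : ∀ j → 1ℤ + + 8 * j - 1ℤ ≡ j * + 8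
        shift = solve-∀
      X = proj₁ root 7
      X²≡x : X * X ≡[ + 128 ] x
      X²≡x = ≡ₘ-trans (≡ₘ-reflexive (sym (ℤₚ.*-identityˡ (X * X)))) (remodulus (L-def 7) (proj₂ (proj₂ root) 7))
      difference : ∀ c β γ y x → c - β * y + γ * (y * y) - (c - β * x + γ * (x * x)) ≡ (- β + γ * (y + x)) * (y - x)
      difference = solve-∀
      at-x : u * u * u * u ≡[ + 16 ] 1ℤ → Q x ≡[ + 128 ] τ
      at-x (n by e′) = lin₀ (- (r * n) + + 2 * (K * K) * (D * D) * (j * j))
          (trans (cong (_- τ) (trans (expand (d * d) β (K * K) (D * D) j)
            (cong (λ z → z + + 8 * j * u + + 256 * (K * K) * (D * D) * (j * j)) e)))
            (trans (regroup τ r u (K * K) (D * D) (j * j))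
              (trans (cong (λ z → + 8 * r * (1ℤ - z) + + 256 * (K * K) * (D * D) * (j * j)) e′)
                (collect r n (K * K) (D * D) (j * j)))))
        where
        expand : ∀ c β k D j → c - β * (1ℤ + + 8 * j) + + 4 * k * D * ((1ℤ + + 8 * j) * (1ℤ + + 8 * j)) ≡
          c - β * 1ℤ + + 4 * k * D * (1ℤ * 1ℤ) + + 8 * j * (+ 2 * (+ 4 * k * D) - β) + + 256 * k * D * (j * j)
        expand = solve-∀
        regroup : ∀ τ r u k D j² → τ + r * + 8 + + 8 * (- (r * (u * u * u))) * u + + 256 * k * D * j² - τ ≡
          + 8 * r * (1ℤ - u * u * u * u) + + 256 * k * D * j²
        regroup = solve-∀
        collect : ∀ r n k D j² → + 8 * r * (1ℤ - (1ℤ + n * + 16)) + + 256 * k * D * j² ≡ (- (r * n) + + 2 * k * D * j²) * + 128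
        collect = solve-∀
    -- `Q 1` is 4 or 0 modulo 8, and `reach` moves it within its class to `4 d` or `16 d`; both make
    -- `16 Q` a square times `d`. The modulus 128 leaves at least the three digits needed for
    -- lifting after division by 4 or 16.
    build : d ≡[ + 4 ] + 3 → Point
    build d≡3 = choose (decide 8 ((x₀ ≋ con 0ℤ mod 4) ∷ []) ((x₀ ≋ con (+ 4) mod 8) ∷ (x₀ ≋ con 0ℤ mod 8) ∷ []) refl
      (Q 1ℤ ∷ []) (Q₁≡0 ∷ []))
      where
      Q₁≡0 : Q 1ℤ ≡[ + 4 ] 0ℤ
      Q₁≡0 = infer 4 (odd! x₁ ∷ (x₂ ≋ con (+ 3) mod 4) ∷ (x₀ :* x₁ ≋ con (+ 3) mod 4) ∷ [])
        (x₂ :* x₂ :- (x₀ :+ con (+ 4) :* x₃) :* x₁ :* x₂ :* con 1ℤ :+ con (+ 4) :* (x₃ :* x₃) :* (x₁ :* x₁) :*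
          (con 1ℤ :* con 1ℤ) ≋ con 0ℤ mod 4) refl
        (P ∷ D ∷ d ∷ K ∷ []) (D-odd ∷ d≡3 ∷ PD≡3 ∷ [])
      finish : ∀ c n γ → L γ ≡ n → + 16 * c ≡ n * n → (∃ λ t → + 128 ≡ c * (+ 8 * t)) →
        (∃ λ X → Q (X * X) ≡[ + 128 ] c * d) → Point
      finish c n γ L≡ c≡ (t , 128≡) (X , (r by e)) = point-2 X 1 γ 1ℤ d (d + r * t * + 8) (sym (ℤₚ.*-identityˡ d))
        (trans (value X) (trans (cong (+ 16 *_) (trans e (cong (λ z → c * d + r * z) 128≡)))
          (trans (regroup c d r t) (cong (_* (d + r * t * + 8))
            (trans c≡ (trans (cong (λ z → z * z) (sym L≡)) (sym (ℤₚ.*-identityˡ _))))))))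
        d-odd (r * t by refl)
        where
        regroup : ∀ c d r t → + 16 * (c * d + r * (c * (+ 8 * t))) ≡ + 16 * c * (d + r * t * + 8)
        regroup = solve-∀
      choose : Any (Holds (Q 1ℤ ∷ [])) ((x₀ ≋ con (+ 4) mod 8) ∷ (x₀ ≋ con 0ℤ mod 8) ∷ []) → Point
      choose (here h) = finish (+ 4) (+ 8) 3 (L-def 3) refl (+ 4 , refl) (reach (+ 4 * d)
        (infer 8 (odd! x₁ ∷ (x₀ ≋ con (+ 4) mod 8) ∷ []) (x₀ ≋ con (+ 4) :* x₁ mod 8) refl (Q 1ℤ ∷ d ∷ []) (d-odd ∷ h ∷ [])))
      choose (there (here h)) = finish (+ 16) (+ 16) 4 (L-def 4) refl (1ℤ , refl) (reach (+ 16 * d)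
        (infer 8 ((x₀ ≋ con 0ℤ mod 8) ∷ []) (x₀ ≋ con (+ 16) :* x₁ mod 8) refl (Q 1ℤ ∷ d ∷ []) (h ∷ [])))

-- The real place

isqrt : ∀ n → ∃ λ r → r ℕ.* r ℕ.≤ n × n ℕ.< suc r ℕ.* suc r
isqrt zero = 0 , z≤n , s≤s z≤n
isqrt (suc n) = go (isqrt n)
  where
  go : (∃ λ r → r ℕ.* r ℕ.≤ n × n ℕ.< suc r ℕ.* suc r) → ∃ λ r → r ℕ.* r ℕ.≤ suc n × suc n ℕ.< suc r ℕ.* suc r
  go (r , r²≤n , n<) with suc r ℕ.* suc r ℕ.≤? suc n
  ... | yes h = suc r , h , ℕₚ.≤-<-trans n< (ℕₚ.*-mono-< (ℕₚ.n<1+n (suc r)) (ℕₚ.n<1+n (suc r)))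
  ... | no h = r , ℕₚ.m≤n⇒m≤1+n r²≤n , ℕₚ.≰⇒> h

square-< : ∀ {x y} → x ℕ.* x ℕ.< y ℕ.* y → x ℕ.< y
square-< {x} {y} h with x ℕ.<? y
... | yes x<y = x<y
... | no x≮y = contradiction h (ℕₚ.≤⇒≯ (ℕₚ.*-mono-≤ (ℕₚ.≮⇒≥ x≮y) (ℕₚ.≮⇒≥ x≮y)))

∣+a-+b∣≤c : ∀ {a b c} → a ℕ.≤ b ℕ.+ c → b ℕ.≤ a ℕ.+ c → ∣ + a - + b ∣ ℕ.≤ c
∣+a-+b∣≤c {a} {b} {c} h h′ = subst (λ z → ∣ z ∣ ℕ.≤ c) (sym (ℤₚ.m-n≡m⊖n a b)) (go (ℕₚ.≤-total a b))
  where
  go : a ℕ.≤ b ⊎ b ℕ.≤ a → ∣ a ⊖ b ∣ ℕ.≤ c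
  go (inj₁ a≤b) = subst (ℕ._≤ c) (sym (ℤₚ.∣⊖∣-≤ a≤b)) (ℕₚ.m≤n+o⇒m∸n≤o b a h′)
  go (inj₂ b≤a) = subst (ℕ._≤ c) (sym (trans (ℤₚ.∣m⊖n∣≡∣n⊖m∣ a b) (ℤₚ.∣⊖∣-≤ b≤a))) (ℕₚ.m≤n+o⇒m∸n≤o a b h)

∣mkℚᵘ∣≤ε : ∀ n d j → ∣ n ∣ ℕ.* suc j ℕ.≤ suc d → Q.∣ mkℚᵘ n d ∣ Q.≤ ε j
∣mkℚᵘ∣≤ε n d j h = *≤* (subst₂ _≤_ (ℤₚ.pos-* ∣ n ∣ (suc j)) (sym (ℤₚ.*-identityˡ (+ suc d))) (+≤+ h))

module RealPoint (N : ℕ) (N≥1 : 1 ℕ.≤ N) where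

  private
    r : ℕ → ℕ
    r k = proj₁ (isqrt (N ℕ.* (suc k ℕ.* suc k)))

    lower : ∀ k → r k ℕ.* r k ℕ.≤ N ℕ.* (suc k ℕ.* suc k)
    lower k = proj₁ (proj₂ (isqrt (N ℕ.* (suc k ℕ.* suc k))))

    upper : ∀ k → N ℕ.* (suc k ℕ.* suc k) ℕ.< suc (r k) ℕ.* suc (r k)
    upper k = proj₂ (proj₂ (isqrt (N ℕ.* (suc k ℕ.* suc k))))

    w : ℕ → ℚᵘ
    w k = mkℚᵘ (+ r k) k

    -- r k / (k+1) ≤ √N < (r l + 1) / (l+1).
    close : ∀ k l → r k ℕ.* suc l ℕ.≤ r l ℕ.* suc k ℕ.+ suc k
    close k l = ℕₚ.<⇒≤ (subst (r k ℕ.* suc l ℕ.<_) (ℕₚ.+-comm (suc k) (r l ℕ.* suc k)) (square-< (begin-strict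
      r k ℕ.* s′ ℕ.* (r k ℕ.* s′)        ≡⟨ interchange (r k) s′ ⟩
      r k ℕ.* r k ℕ.* (s′ ℕ.* s′)        ≤⟨ ℕₚ.*-monoˡ-≤ (s′ ℕ.* s′) (lower k) ⟩
      N ℕ.* (s ℕ.* s) ℕ.* (s′ ℕ.* s′)    ≡⟨ swap N (s ℕ.* s) (s′ ℕ.* s′) ⟩
      N ℕ.* (s′ ℕ.* s′) ℕ.* (s ℕ.* s)    <⟨ ℕₚ.*-monoˡ-< (s ℕ.* s) (upper l) ⟩
      suc (r l) ℕ.* suc (r l) ℕ.* (s ℕ.* s)  ≡⟨ sym (interchange (suc (r l)) s) ⟩
      suc (r l) ℕ.* s ℕ.* (suc (r l) ℕ.* s)  ∎)))
      where
      open ℕₚ.≤-Reasoning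
      s s′ : ℕ
      s = suc k
      s′ = suc l
      interchange : ∀ a b → a ℕ.* b ℕ.* (a ℕ.* b) ≡ a ℕ.* a ℕ.* (b ℕ.* b)
      interchange = ℕSolver.solve-∀
      swap : ∀ a b c → a ℕ.* b ℕ.* c ≡ a ℕ.* c ℕ.* b
      swap = ℕSolver.solve-∀

    cauchy : ∀ j → ∃ λ M → ∀ k l → M ℕ.≤ k → M ℕ.≤ l → Q.∣ w k Q.- w l ∣ Q.≤ ε j
    cauchy j = j , λ k l j≤k j≤l → ∣mkℚᵘ∣≤ε (+ r k * + suc l + - + r l * + suc k) (l ℕ.+ k ℕ.* suc l) j (bounded k l j≤k j≤l)
      where
      bounded : ∀ k l → j ℕ.≤ k → j ℕ.≤ l → ∣ + r k * + suc l + - + r l * + suc k ∣ ℕ.* suc j ℕ.≤ suc k ℕ.* suc l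
      bounded k l j≤k j≤l = subst (λ z → ∣ z ∣ ℕ.* suc j ℕ.≤ suc k ℕ.* suc l) rewrite-num (go (ℕₚ.≤-total k l))
        where
        rewrite-num : + (r k ℕ.* suc l) - + (r l ℕ.* suc k) ≡ + r k * + suc l + - + r l * + suc k
        rewrite-num = cong₂ _+_ (ℤₚ.pos-* (r k) (suc l)) (trans (cong -_ (ℤₚ.pos-* (r l) (suc k)))
          (ℤₚ.neg-distribˡ-* (+ r l) (+ suc k)))
        widen : ∀ {x y} c c′ → c ℕ.≤ c′ → x ℕ.≤ y ℕ.+ c → x ℕ.≤ y ℕ.+ c′
        widen {y = y} c c′ c≤c′ h = ℕₚ.≤-trans h (ℕₚ.+-monoʳ-≤ y c≤c′)
        go : k ℕ.≤ l ⊎ l ℕ.≤ k → ∣ + (r k ℕ.* suc l) - + (r l ℕ.* suc k) ∣ ℕ.* suc j ℕ.≤ suc k ℕ.* suc l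
        go (inj₁ k≤l) = ℕₚ.≤-trans (ℕₚ.*-mono-≤ (∣+a-+b∣≤c (widen (suc k) (suc l) (s≤s k≤l) (close k l)) (close l k)) (s≤s j≤k))
          (ℕₚ.≤-reflexive (ℕₚ.*-comm (suc l) (suc k)))
        go (inj₂ l≤k) = ℕₚ.*-mono-≤ (∣+a-+b∣≤c (close k l) (widen (suc l) (suc k) (s≤s l≤k) (close l k))) (s≤s j≤l)

    r≤Ns : ∀ k → r k ℕ.≤ N ℕ.* suc k
    r≤Ns k = ℕₚ.≤-pred (square-< (ℕₚ.≤-<-trans (lower k)
      (ℕₚ.≤-<-trans N≤N² (ℕₚ.*-mono-< (ℕₚ.n<1+n (N ℕ.* suc k)) (ℕₚ.n<1+n (N ℕ.* suc k))))))
      where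
      N≤N² : N ℕ.* (suc k ℕ.* suc k) ℕ.≤ N ℕ.* suc k ℕ.* (N ℕ.* suc k)
      N≤N² = ℕₚ.≤-trans (ℕₚ.*-monoˡ-≤ (suc k ℕ.* suc k) (ℕₚ.m≤m*n N N {{ℕ.>-nonZero N≥1}}))
        (ℕₚ.≤-reflexive (interchange N (suc k)))
        where
        interchange : ∀ a b → a ℕ.* a ℕ.* (b ℕ.* b) ≡ a ℕ.* b ℕ.* (a ℕ.* b)
        interchange = ℕSolver.solve-∀

    residual : ∀ k → ∣ + (r k ℕ.* r k) - + (N ℕ.* (suc k ℕ.* suc k)) ∣ ℕ.≤ 2 ℕ.* N ℕ.* suc k
    residual k = ∣+a-+b∣≤c (ℕₚ.≤-trans (lower k) (ℕₚ.m≤m+n _ _))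
      (ℕₚ.≤-trans (ℕₚ.≤-pred (ℕₚ.≤-trans (upper k) (ℕₚ.≤-reflexive (expand (r k)))))
      (ℕₚ.+-monoʳ-≤ (r k ℕ.* r k) (ℕₚ.≤-trans (ℕₚ.*-monoʳ-≤ 2 (r≤Ns k)) (ℕₚ.≤-reflexive (sym (ℕₚ.*-assoc 2 N (suc k)))))))
      where
      expand : ∀ r → suc r ℕ.* suc r ≡ suc (r ℕ.* r ℕ.+ 2 ℕ.* r)
      expand = ℕSolver.solve-∀

    -- The numerator of `N (w k * w k - N)` over `(k + 1)²`, in the shape produced by rational
    -- arithmetic.
    num : ℕ → ℤ
    num k = + N * ((+ r k * + r k) * + 1 + - + N * + (suc k ℕ.* suc k))

    -- By `residual` the quotient is at most `2 N² / (k + 1)`, whence the bound required of `k`.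
    num-small : ∀ j k → 2 ℕ.* N ℕ.* N ℕ.* suc j ℕ.≤ k → ∣ num k ∣ ℕ.* suc j ℕ.≤ suc k ℕ.* suc k
    num-small j k big = begin
      ∣ num k ∣ ℕ.* suc j                          ≡⟨ cong (ℕ._* suc j) abs-num ⟩
      N ℕ.* δ ℕ.* suc j                            ≤⟨ ℕₚ.*-monoˡ-≤ (suc j) (ℕₚ.*-monoʳ-≤ N (residual k)) ⟩
      N ℕ.* (2 ℕ.* N ℕ.* suc k) ℕ.* suc j          ≡⟨ rearrange N (suc k) (suc j) ⟩
      2 ℕ.* N ℕ.* N ℕ.* suc j ℕ.* suc k            ≤⟨ ℕₚ.*-monoˡ-≤ (suc k) (ℕₚ.m≤n⇒m≤1+n big) ⟩
      suc k ℕ.* suc k                              ∎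
      where
      open ℕₚ.≤-Reasoning
      δ : ℕ
      δ = ∣ + (r k ℕ.* r k) - + (N ℕ.* (suc k ℕ.* suc k)) ∣
      rearrange : ∀ N s j → N ℕ.* (2 ℕ.* N ℕ.* s) ℕ.* j ≡ 2 ℕ.* N ℕ.* N ℕ.* j ℕ.* s
      rearrange = ℕSolver.solve-∀
      abs-num : ∣ num k ∣ ≡ N ℕ.* δ
      abs-num = trans (ℤₚ.abs-* (+ N) _) (cong (λ z → N ℕ.* ∣ z ∣) (cong₂ _+_
        (trans (ℤₚ.*-identityʳ (+ r k * + r k)) (sym (ℤₚ.pos-* (r k) (r k))))
        (trans (sym (ℤₚ.neg-distribˡ-* (+ N) (+ (suc k ℕ.* suc k)))) (cong -_ (sym (ℤₚ.pos-* N (suc k ℕ.* suc k)))))))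

  -- At `z = 0` the curve reads `d w² = d²`, so `w` is the square root of `N` approximated above.
  real-point : ∀ p q m D → HasPoint ℝ (+ N) p q m D
  real-point p q m D = (λ _ → 0ℚᵘ) , w , (λ j → 0 , λ _ _ _ _ → *≤* (+≤+ z≤n)) , cauchy , equation
    where
    n c e : ℚᵘ
    n = mkℚᵘ (+ N) 0
    c = mkℚᵘ (- (+ 2 * + (p ℕ.+ q) * + D * + N)) 0
    e = mkℚᵘ (+ (4 ℕ.^ m ℕ.* (D ℕ.* D))) 0
    simplify : ∀ n w c e → n Q.* (w Q.* w) Q.- ((n Q.* n Q.+ c Q.* (0ℚᵘ Q.* 0ℚᵘ)) Q.+ e Q.* ((0ℚᵘ Q.* 0ℚᵘ) Q.* (0ℚᵘ Q.* 0ℚᵘ)))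
      Q.≃ n Q.* (w Q.* w Q.- n)
    simplify = solve 4 (λ n w c e → n ⊠ (w ⊠ w) ⊟ ((n ⊠ n ⊞ c ⊠ (κ 0ℚᵘ ⊠ κ 0ℚᵘ)) ⊞ e ⊠ ((κ 0ℚᵘ ⊠ κ 0ℚᵘ) ⊠ (κ 0ℚᵘ ⊠ κ 0ℚᵘ)))
      := n ⊠ (w ⊠ w ⊟ n)) Qₚ.≃-refl
      where open +-*-Solver using (solve; _:=_) renaming (_:+_ to _⊞_; _:-_ to _⊟_; _:*_ to _⊠_; con to κ)
    bounded : ∀ j k → 2 ℕ.* N ℕ.* N ℕ.* suc j ℕ.≤ k → Q.∣ n Q.* (w k Q.* w k Q.- n) ∣ Q.≤ ε j
    bounded j k big = ∣mkℚᵘ∣≤ε (num k) _ j (ℕₚ.≤-trans (num-small j k big) (ℕₚ.≤-reflexive (identities (suc k ℕ.* suc k))))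
      where
      identities : ∀ s → s ≡ 1 ℕ.* (s ℕ.* 1)
      identities = ℕSolver.solve-∀
    equation : ∀ j → ∃ λ M → ∀ k → M ℕ.≤ k →
      Q.∣ n Q.* (w k Q.* w k) Q.- ((mkℚᵘ (+ N * + N) 0 Q.+ c Q.* (0ℚᵘ Q.* 0ℚᵘ)) Q.+ e Q.* ((0ℚᵘ Q.* 0ℚᵘ) Q.* (0ℚᵘ Q.* 0ℚᵘ)))
        ∣ Q.≤ ε j
    equation j = 2 ℕ.* N ℕ.* N ℕ.* suc j , λ k big →
      Qₚ.≤-respˡ-≃ (Qₚ.≃-sym (Qₚ.∣-∣-cong (simplify n (w k) c e))) (bounded j k big)

nonNeg-square : ∀ p → Q.NonNegative (p Q.* p)
nonNeg-square (mkℚᵘ (+ 0) _) = _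
nonNeg-square (mkℚᵘ (+ suc _) _) = _
nonNeg-square (mkℚᵘ -[1+ _ ] _) = _

nonNeg-ℕ : ∀ k → Q.NonNegative (mkℚᵘ (+ k) 0)
nonNeg-ℕ zero = _
nonNeg-ℕ (suc k) = _

-- For negative `d` the left side is at most 0. On the right all terms are nonnegative and `d²` is
-- at least 1, so the two sides never come within `ε 1 = 1/2`.
no-real-point : ∀ n p q m D → ¬ HasPoint ℝ -[1+ n ] p q m D
no-real-point n p q m D (z , w , _ , _ , h) = let M , close = h 1 in absurd (close M ℕₚ.≤-refl)
  where
  δ γ η : ℚᵘ
  δ = mkℚᵘ -[1+ n ] 0
  γ = mkℚᵘ (- (+ 2 * + (p ℕ.+ q) * + D * -[1+ n ])) 0
  η = mkℚᵘ (+ (4 ℕ.^ m ℕ.* (D ℕ.* D))) 0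
  -p≤∣p∣ : ∀ p → Q.- p Q.≤ Q.∣ p ∣
  -p≤∣p∣ (mkℚᵘ (+ 0) _) = Qₚ.≤-refl
  -p≤∣p∣ (mkℚᵘ (+ suc _) _) = *≤* -≤+
  -p≤∣p∣ (mkℚᵘ -[1+ _ ] _) = Qₚ.≤-refl
  γ-nonNeg : Q.NonNegative γ
  γ-nonNeg = subst (λ c → Q.NonNegative (mkℚᵘ c 0)) (trans (ℤₚ.pos-* (2 ℕ.* (p ℕ.+ q) ℕ.* D) (suc n))
    (trans (cong (_* + suc n) (trans (ℤₚ.pos-* (2 ℕ.* (p ℕ.+ q)) D) (cong (_* + D) (ℤₚ.pos-* 2 (p ℕ.+ q)))))
    (sym (ℤₚ.neg-distribʳ-* (+ 2 * + (p ℕ.+ q) * + D) -[1+ n ])))) (nonNeg-ℕ (2 ℕ.* (p ℕ.+ q) ℕ.* D ℕ.* suc n))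
  module _ (k : ℕ) where
    A B C E : ℚᵘ
    A = δ Q.* (w k Q.* w k)
    B = mkℚᵘ (-[1+ n ] * -[1+ n ]) 0
    C = γ Q.* (z k Q.* z k)
    E = η Q.* ((z k Q.* z k) Q.* (z k Q.* z k))
    A≤0 : A Q.≤ 0ℚᵘ
    A≤0 = Qₚ.≤-trans (Qₚ.*-monoˡ-≤-nonNeg (w k Q.* w k) {{nonNeg-square (w k)}} {δ} {0ℚᵘ} (*≤* -≤+))
      (Qₚ.≤-reflexive (Qₚ.*-zeroˡ (w k Q.* w k)))
    C-nonNeg : Q.NonNegative C
    C-nonNeg = Qₚ.nonNeg*nonNeg⇒nonNeg γ {{γ-nonNeg}} (z k Q.* z k) {{nonNeg-square (z k)}}
    E-nonNeg : Q.NonNegative E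
    E-nonNeg = Qₚ.nonNeg*nonNeg⇒nonNeg η {{nonNeg-ℕ (4 ℕ.^ m ℕ.* (D ℕ.* D))}} ((z k Q.* z k) Q.* (z k Q.* z k))
      {{nonNeg-square (z k Q.* z k)}}
    1≤R : 1ℚᵘ Q.≤ (B Q.+ C) Q.+ E
    1≤R = Qₚ.≤-trans (*≤* (+≤+ (s≤s z≤n))) (Qₚ.≤-trans (Qₚ.p≤p+q B C {{C-nonNeg}}) (Qₚ.p≤p+q (B Q.+ C) E {{E-nonNeg}}))
    1≤diff : 1ℚᵘ Q.≤ Q.- (A Q.- ((B Q.+ C) Q.+ E))
    1≤diff = Qₚ.neg-mono-≤ {A Q.- ((B Q.+ C) Q.+ E)} {Q.- 1ℚᵘ} (Qₚ.+-mono-≤ A≤0 (Qₚ.neg-mono-≤ 1≤R))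
  absurd : ∀ {k} → Q.∣ A k Q.- ((B k Q.+ C k) Q.+ E k) ∣ Q.≤ ε 1 → ⊥
  absurd {k} h = case Qₚ.≤-trans (Qₚ.≤-trans (1≤diff k) (-p≤∣p∣ (A k Q.- ((B k Q.+ C k) Q.+ E k)))) h of
    λ { (*≤* (+≤+ (s≤s ()))) }

-- Solubility at 2 in terms of residue classes

mod-nat : ∀ M .{{_ : NonZero M}} x y → + x ≡[ + M ] + y → x ℕ.% M ≡ y ℕ.% M
mod-nat M x y h = small-residues (ℕ%.m%n<n x M) (ℕ%.m%n<n y M)
  (≡ₘ-trans (≡ₘ-sym (residue M (+ x))) (≡ₘ-trans h (residue M (+ y))))

nat-mod : ∀ M .{{_ : NonZero M}} x r → x ℕ.% M ≡ r → + x ≡[ + M ] + r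
nat-mod M x r e = ≡ₘ-trans (residue M (+ x)) (≡ₘ-reflexive (cong +_ e))

data R₈ : Set where
  r1 r3 r5 r7 : R₈

data R₄ : Set where
  one three : R₄

val₈ : R₈ → ℕ
val₈ r1 = 1
val₈ r3 = 3
val₈ r5 = 5
val₈ r7 = 7

val₄ : R₄ → ℕ
val₄ one = 1
val₄ three = 3

class₈ : ∀ x → x ℕ.% 2 ≡ 1 → ∃ λ a → x ℕ.% 8 ≡ val₈ a
class₈ x odd = go (x ℕ.% 8) (ℕ%.m%n<n x 8) (trans (mod-nat 2 (x ℕ.% 8) x (≡ₘ-sym (coarsenₘ {+ 4} (+ 2) (residue 8 (+ x))))) odd)
  where
  go : ∀ r → r ℕ.< 8 → r ℕ.% 2 ≡ 1 → ∃ λ a → r ≡ val₈ a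
  go 1 _ _ = r1 , refl
  go 3 _ _ = r3 , refl
  go 5 _ _ = r5 , refl
  go 7 _ _ = r7 , refl
  go (suc (suc (suc (suc (suc (suc (suc (suc r)))))))) h _ = contradiction h (ℕₚ.≤⇒≯ (ℕₚ.m≤m+n 8 r))

class₄ : ∀ x → x ℕ.% 2 ≡ 1 → ∃ λ a → x ℕ.% 4 ≡ val₄ a
class₄ x odd = go (x ℕ.% 4) (ℕ%.m%n<n x 4) (trans (mod-nat 2 (x ℕ.% 4) x (≡ₘ-sym (coarsenₘ {+ 2} (+ 2) (residue 4 (+ x))))) odd)
  where
  go : ∀ r → r ℕ.< 4 → r ℕ.% 2 ≡ 1 → ∃ λ a → r ≡ val₄ a
  go 1 _ _ = one , refl
  go 3 _ _ = three , refl
  go (suc (suc (suc (suc r)))) h _ = contradiction h (ℕₚ.≤⇒≯ (ℕₚ.m≤m+n 4 r))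

mod-4-of-8 : ∀ x {r} → x ℕ.% 8 ≡ r → x ℕ.% 4 ≡ r ℕ.% 4
mod-4-of-8 x {r} e = mod-nat 4 x r (coarsenₘ {+ 2} (+ 4) (nat-mod 8 x r e))

-- The residues of p D modulo 8, D modulo 4 and d′ modulo 4 for which 2 d′ is
-- soluble at 2, when m = 1 and when m ≥ 4 (in the latter case apart from p D ≡ 7).
table₁ : R₈ → R₄ → R₄ → Bool
table₁ r1 three one = true
table₁ r5 one three = true
table₁ r7 one one = true
table₁ r7 three three = true
table₁ _ _ _ = false

table₄ : R₈ → R₄ → Bool
table₄ r1 one = true
table₄ r5 three = true
table₄ _ _ = false

module _ {P D d′ : ℤ} (P-odd : Odd P) (D-odd : Odd D) (d′-odd : Odd d′) where

  private
    residues₁ : R₈ → R₄ → R₄ → List (Claim 3)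
    residues₁ a b c = odd! x₀ ∷ odd! x₁ ∷ odd! x₂ ∷ (x₀ :* x₁ ≋ con (+ val₈ a) mod 8) ∷ (x₁ ≋ con (+ val₄ b) mod 4) ∷
      (x₂ ≋ con (+ val₄ c) mod 4) ∷ []

    E₁ : Claim 3
    E₁ = x₂ :* x₂ :+ x₁ :* x₁ :- con (+ 2) :* (x₀ :+ con 1ℤ) :* x₁ :* x₂ ≋ con (+ 2) :* x₂ mod 16

    -- An entry `true` asserts that the residues imply the congruence, an entry `false` that they
    -- exclude it.
    goal₁ : Bool → List (Claim 3) → Bool
    goal₁ true hs = check 3 16 hs (E₁ ∷ [])
    goal₁ false hs = check 3 16 (E₁ ∷ hs) []

  table₁-correct : ∀ a b c → P * D ≡[ + 8 ] + val₈ a → D ≡[ + 4 ] + val₄ b → d′ ≡[ + 4 ] + val₄ c →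
    (d′ * d′ + D * D - + 2 * (P + 1ℤ) * D * d′ ≡[ + 16 ] + 2 * d′ → table₁ a b c ≡ true) ×
    (table₁ a b c ≡ true → d′ * d′ + D * D - + 2 * (P + 1ℤ) * D * d′ ≡[ + 16 ] + 2 * d′)
  table₁-correct a b c ha hb hc = go (table₁ a b c) (checked a b c)
    where
    checked : ∀ a b c → goal₁ (table₁ a b c) (residues₁ a b c) ≡ true
    checked r1 one one = refl
    checked r1 one three = refl
    checked r1 three one = refl
    checked r1 three three = refl
    checked r3 one one = refl
    checked r3 one three = refl
    checked r3 three one = refl
    checked r3 three three = refl
    checked r5 one one = refl
    checked r5 one three = refl
    checked r5 three one = refl
    checked r5 three three = refl
    checked r7 one one = refl
    checked r7 one three = refl
    checked r7 three one = refl
    checked r7 three three = refl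
    ρ : Vec ℤ 3
    ρ = P ∷ D ∷ d′ ∷ []
    hyps : All (Holds ρ) (residues₁ a b c)
    hyps = P-odd ∷ D-odd ∷ d′-odd ∷ ha ∷ hb ∷ hc ∷ []
    go : ∀ t → goal₁ t (residues₁ a b c) ≡ true → (Holds ρ E₁ → t ≡ true) × (t ≡ true → Holds ρ E₁)
    go true e = (λ _ → refl) , (λ _ → infer 16 (residues₁ a b c) E₁ e ρ hyps)
    go false e = (λ h → case decide 16 (E₁ ∷ residues₁ a b c) [] e ρ (h ∷ hyps) of λ ()) , λ ()

  private
    residues₄ : R₈ → R₄ → List (Claim 3)
    residues₄ a c = odd! x₀ ∷ odd! x₁ ∷ odd! x₂ ∷ (x₀ :* x₁ ≋ con (+ val₈ a) mod 8) ∷ (x₂ ≋ con (+ val₄ c) mod 4) ∷ []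

    E₄ : Claim 3
    E₄ = con (+ 2) :* x₂ :- x₀ :* x₁ ≋ con 1ℤ mod 8

    goal₄ : Bool → List (Claim 3) → Bool
    goal₄ true hs = check 3 8 hs (E₄ ∷ [])
    goal₄ false hs = check 3 8 (E₄ ∷ hs) []

  table₄-correct : ∀ a c → P * D ≡[ + 8 ] + val₈ a → d′ ≡[ + 4 ] + val₄ c →
    (+ 2 * d′ - P * D ≡[ + 8 ] 1ℤ → table₄ a c ≡ true) × (table₄ a c ≡ true → + 2 * d′ - P * D ≡[ + 8 ] 1ℤ)
  table₄-correct a c ha hc = go (table₄ a c) (checked a c)
    where
    checked : ∀ a c → goal₄ (table₄ a c) (residues₄ a c) ≡ true
    checked r1 one = refl
    checked r1 three = refl
    checked r3 one = refl
    checked r3 three = refl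
    checked r5 one = refl
    checked r5 three = refl
    checked r7 one = refl
    checked r7 three = refl
    ρ : Vec ℤ 3
    ρ = P ∷ D ∷ d′ ∷ []
    hyps : All (Holds ρ) (residues₄ a c)
    hyps = P-odd ∷ D-odd ∷ d′-odd ∷ ha ∷ hc ∷ []
    go : ∀ t → goal₄ t (residues₄ a c) ≡ true → (Holds ρ E₄ → t ≡ true) × (t ≡ true → Holds ρ E₄)
    go true e = (λ _ → refl) , (λ _ → infer 8 (residues₄ a c) E₄ e ρ hyps)
    go false e = (λ h → case decide 8 (E₄ ∷ residues₄ a c) [] e ρ (h ∷ hyps) of λ ()) , λ ()

-- The nontrivial character modulo 4 of odd numbers, written additively. By `isNR-[-1]` it is
-- `isNR -[1+ 0 ]` at odd primes.
χ₄ : ℕ → Bool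
χ₄ x = x ℕ.% 4 ℕ.≡ᵇ 3

module TwoAdicBooleans (p q n : ℕ) (Dv : Fin n → ℕ) (s : ℕ) (C : ℕ)
  (p-odd : p ℕ.% 2 ≡ 1) (D-odd : Setup.D p q 1 n Dv s ℕ.% 2 ≡ 1) (C-odd : C ℕ.% 2 ≡ 1) where

  private
    D : ℕ
    D = Setup.D p q 1 n Dv s

    P∙D : + p * + D ≡ + (p ℕ.* D)
    P∙D = sym (ℤₚ.pos-* p D)

    odd-P : Odd (+ p)
    odd-P = nat-mod 2 p 1 p-odd

    odd-D : Odd (+ D)
    odd-D = nat-mod 2 D 1 D-odd

    odd-C : Odd (+ C)
    odd-C = nat-mod 2 C 1 C-odd

    pD-odd : (p ℕ.* D) ℕ.% 2 ≡ 1
    pD-odd = mod-nat 2 (p ℕ.* D) 1 (≡ₘ-trans (≡ₘ-reflexive (sym P∙D)) (*-congₘ odd-P odd-D))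

    ∨-true : ∀ a {b} → a ∨ b ≡ true → a ≡ true ⊎ b ≡ true
    ∨-true true _ = inj₁ refl
    ∨-true false e = inj₂ e

  odd⇒boolean : ∀ m → OddSoluble m (+ p) (+ D) (+ C) → Setup.case2 p q m n Dv s ≡ true ⊎ χ₄ C ≡ false
  odd⇒boolean m (inj₁ h) = inj₂ (cong (ℕ._≡ᵇ 3) (mod-nat 4 C 1 h))
  odd⇒boolean .2 (inj₂ (inj₁ (refl , h))) = inj₁ (cong (λ r → (r ℕ.≡ᵇ 5) ∨ false)
    (mod-nat 8 ((p ℕ.+ 2) ℕ.* D) 5 (≡ₘ-trans (≡ₘ-reflexive (trans (ℤₚ.pos-* (p ℕ.+ 2) D) (cong (_* + D) (ℤₚ.pos-+ p 2)))) h)))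
  odd⇒boolean (suc (suc (suc m))) (inj₂ (inj₂ (3≤m , h))) = inj₁ (cong (ℕ._≡ᵇ 3)
    (mod-nat 4 (p ℕ.* D) 3 (≡ₘ-trans (≡ₘ-reflexive (sym P∙D)) h)))
  odd⇒boolean 1 (inj₂ (inj₂ (s≤s () , _)))
  odd⇒boolean 2 (inj₂ (inj₂ (s≤s (s≤s ()) , _)))

  boolean⇒odd : ∀ m → Setup.case2 p q m n Dv s ≡ true ⊎ χ₄ C ≡ false → OddSoluble m (+ p) (+ D) (+ C)
  boolean⇒odd m (inj₂ e) = go (class₄ C C-odd)
    where
    go : (∃ λ a → C ℕ.% 4 ≡ val₄ a) → OddSoluble m (+ p) (+ D) (+ C)
    go (one , h) = inj₁ (nat-mod 4 C 1 h)
    go (three , h) = case trans (sym e) (cong (ℕ._≡ᵇ 3) h) of λ ()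
  boolean⇒odd m (inj₁ e) = [ two , three′ ]′ (∨-true ((m ℕ.≡ᵇ 2) ∧ (((p ℕ.+ 2) ℕ.* D ℕ.% 8) ℕ.≡ᵇ 5)) e)
    where
    two : (m ℕ.≡ᵇ 2) ∧ (((p ℕ.+ 2) ℕ.* D ℕ.% 8) ℕ.≡ᵇ 5) ≡ true → OddSoluble m (+ p) (+ D) (+ C)
    two h = let a , b = ∧-true (m ℕ.≡ᵇ 2) h in
      inj₂ (inj₁ (≡ᵇ-true m 2 a , ≡ₘ-trans (≡ₘ-reflexive (sym (trans (ℤₚ.pos-* (p ℕ.+ 2) D) (cong (_* + D) (ℤₚ.pos-+ p 2)))))
        (nat-mod 8 ((p ℕ.+ 2) ℕ.* D) 5 (≡ᵇ-true _ 5 b))))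
    three′ : (2 ℕ.<ᵇ m) ∧ (((p ℕ.* D) ℕ.% 4) ℕ.≡ᵇ 3) ≡ true → OddSoluble m (+ p) (+ D) (+ C)
    three′ h = let a , b = ∧-true (2 ℕ.<ᵇ m) h in
      inj₂ (inj₂ (ℕₚ.<ᵇ⇒< 2 m (subst T (sym a) tt) , ≡ₘ-trans (≡ₘ-reflexive P∙D) (nat-mod 4 (p ℕ.* D) 3 (≡ᵇ-true _ 3 b))))

  -- Under `Cond` no even `d` is soluble at 2. Otherwise the vertex -1, if present, prescribes the
  -- class of the odd part of `d` modulo 4.
  EvenBoolean : ℕ → Set
  EvenBoolean m = ¬ Setup.Cond p q m n Dv s ×
    (Setup.case2 p q m n Dv s ≡ true ⊎ χ₄ C ≡ not (Setup.twoSym p q m n Dv s Setup.v-1))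

  private
    Residues : R₈ → R₄ → R₄ → Set
    Residues a b c = (p ℕ.* D) ℕ.% 8 ≡ val₈ a × D ℕ.% 4 ≡ val₄ b × C ℕ.% 4 ≡ val₄ c

    classified : ∃ λ a → ∃ λ b → ∃ λ c → Residues a b c
    classified = let a , ha = class₈ (p ℕ.* D) pD-odd
                     b , hb = class₄ D D-odd
                     c , hc = class₄ C C-odd
                 in a , b , c , ha , hb , hc

    PD≡ : ∀ {a} → (p ℕ.* D) ℕ.% 8 ≡ a → + p * + D ≡[ + 8 ] + a
    PD≡ {a} h = ≡ₘ-trans (≡ₘ-reflexive P∙D) (nat-mod 8 (p ℕ.* D) a h)

    PD≡⁻ : ∀ a → + p * + D ≡[ + 8 ] + a → (p ℕ.* D) ℕ.% 8 ≡ a ℕ.% 8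
    PD≡⁻ a h = mod-nat 8 (p ℕ.* D) a (≡ₘ-trans (≡ₘ-reflexive (sym P∙D)) h)

    -- From here to `CondAt`: `case2`, `twoSym` at -1 and `Cond` with the residues as arguments, so
    -- that they evaluate once the classes are known.
    case2ᵇ : ℕ → ℕ → Bool
    case2ᵇ m x₄ = ((m ℕ.≡ᵇ 2) ∧ (((p ℕ.+ 2) ℕ.* D) ℕ.% 8 ℕ.≡ᵇ 5)) ∨ ((2 ℕ.<ᵇ m) ∧ (x₄ ℕ.≡ᵇ 3))

    twoSymᵇ : ℕ → ℕ → ℕ → Bool
    twoSymᵇ m x₈ y = ((m ℕ.≡ᵇ 1) ∧ (x₈ ℕ.≡ᵇ 7) ∧ (y ℕ.≡ᵇ 1)) ∨ ((m ℕ.≡ᵇ 1) ∧ (x₈ ℕ.≡ᵇ 1) ∧ (y ℕ.≡ᵇ 3)) ∨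
      ((3 ℕ.<ᵇ m) ∧ (x₈ ℕ.≡ᵇ 1))

    CondAt : ℕ → ℕ → ℕ → ℕ → Set
    CondAt m x₈ x₄ y = (m ≡ 1 × x₈ ≡ 5 × y ≡ 3) ⊎ (m ≡ 1 × x₈ ≡ 1 × y ≡ 1) ⊎ (m ≡ 2) ⊎ (x₈ ≡ 3) ⊎ (m ≡ 3 × x₄ ≡ 1) ⊎
      (m ≡ 4 × x₈ ≡ 7)

    BooleanAt : ℕ → R₈ → R₄ → R₄ → Set
    BooleanAt m a b c = ¬ CondAt m (val₈ a) (val₈ a ℕ.% 4) (val₄ b) ×
      (case2ᵇ m (val₈ a ℕ.% 4) ≡ true ⊎ (val₄ c ℕ.≡ᵇ 3) ≡ not (twoSymᵇ m (val₈ a) (val₄ b)))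

    to-residues : ∀ m {a b c} → Residues a b c → EvenBoolean m → BooleanAt m a b c
    to-residues m {a} {b} {c} (ha , hb , hc) (nc , h) =
      subst₂ (λ x y → ¬ CondAt m (proj₁ x) (proj₂ x) y) (cong₂ _,_ ha (mod-4-of-8 (p ℕ.* D) ha)) hb nc ,
      subst₂ (λ x y → case2ᵇ m (proj₂ x) ≡ true ⊎ (proj₂ y ℕ.≡ᵇ 3) ≡ not (twoSymᵇ m (proj₁ x) (proj₁ y)))
        (cong₂ _,_ ha (mod-4-of-8 (p ℕ.* D) ha)) (cong₂ _,_ hb hc) h

    from-residues : ∀ m {a b c} → Residues a b c → BooleanAt m a b c → EvenBoolean m
    from-residues m {a} {b} {c} (ha , hb , hc) (nc , h) =
      subst₂ (λ x y → ¬ CondAt m (proj₁ x) (proj₂ x) y) (sym (cong₂ _,_ ha (mod-4-of-8 (p ℕ.* D) ha))) (sym hb) nc ,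
      subst₂ (λ x y → case2ᵇ m (proj₂ x) ≡ true ⊎ (proj₂ y ℕ.≡ᵇ 3) ≡ not (twoSymᵇ m (proj₁ x) (proj₁ y)))
        (sym (cong₂ _,_ ha (mod-4-of-8 (p ℕ.* D) ha))) (sym (cong₂ _,_ hb hc)) h

    boolean₁ : ∀ a b c → table₁ a b c ≡ true → BooleanAt 1 a b c
    boolean₁ r7 one one _ = (λ { (inj₂ (inj₂ (inj₁ ()))) ; (inj₂ (inj₂ (inj₂ (inj₁ ())))) ;
      (inj₂ (inj₂ (inj₂ (inj₂ (inj₁ (() , _)))))) ; (inj₂ (inj₂ (inj₂ (inj₂ (inj₂ (() , _)))))) }) , inj₂ refl
    boolean₁ r7 three three _ = (λ { (inj₂ (inj₂ (inj₁ ()))) ; (inj₂ (inj₂ (inj₂ (inj₁ ())))) ;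
      (inj₂ (inj₂ (inj₂ (inj₂ (inj₁ (() , _)))))) ; (inj₂ (inj₂ (inj₂ (inj₂ (inj₂ (() , _)))))) }) , inj₂ refl
    boolean₁ r1 three one _ = (λ { (inj₂ (inj₁ (_ , _ , ()))) ; (inj₂ (inj₂ (inj₁ ()))) ; (inj₂ (inj₂ (inj₂ (inj₁ ())))) ;
      (inj₂ (inj₂ (inj₂ (inj₂ (inj₁ (() , _)))))) ; (inj₂ (inj₂ (inj₂ (inj₂ (inj₂ (() , _)))))) }) , inj₂ refl
    boolean₁ r5 one three _ = (λ { (inj₁ (_ , _ , ())) ; (inj₂ (inj₂ (inj₁ ()))) ; (inj₂ (inj₂ (inj₂ (inj₁ ())))) ;
      (inj₂ (inj₂ (inj₂ (inj₂ (inj₁ (() , _)))))) ; (inj₂ (inj₂ (inj₂ (inj₂ (inj₂ (() , _)))))) }) , inj₂ refl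

    table₁-complete : ∀ a b c → BooleanAt 1 a b c → table₁ a b c ≡ true
    table₁-complete r1 one _ (nc , _) = ⊥-elim (nc (inj₂ (inj₁ (refl , refl , refl))))
    table₁-complete r1 three one _ = refl
    table₁-complete r3 _ _ (nc , _) = ⊥-elim (nc (inj₂ (inj₂ (inj₂ (inj₁ refl)))))
    table₁-complete r5 three _ (nc , _) = ⊥-elim (nc (inj₁ (refl , refl , refl)))
    table₁-complete r5 one three _ = refl
    table₁-complete r7 one one _ = refl
    table₁-complete r7 three three _ = refl
    table₁-complete r1 three three (_ , inj₁ ())
    table₁-complete r1 three three (_ , inj₂ ())
    table₁-complete r5 one one (_ , inj₁ ())
    table₁-complete r5 one one (_ , inj₂ ())
    table₁-complete r7 one three (_ , inj₁ ())
    table₁-complete r7 one three (_ , inj₂ ())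
    table₁-complete r7 three one (_ , inj₁ ())
    table₁-complete r7 three one (_ , inj₂ ())

    boolean₄ : ∀ k a b c → table₄ a c ≡ true → BooleanAt (4 ℕ.+ k) a b c
    boolean₄ k r1 b one _ = (λ { (inj₂ (inj₂ (inj₂ (inj₁ ())))) ; (inj₂ (inj₂ (inj₂ (inj₂ (inj₂ (_ , ())))))) }) , inj₂ refl
    boolean₄ k r5 b three _ = (λ { (inj₂ (inj₂ (inj₂ (inj₁ ())))) ; (inj₂ (inj₂ (inj₂ (inj₂ (inj₂ (_ , ())))))) }) , inj₂ refl

    -- The class 7 of `p D` is not covered by `table₄`: it falls under `Cond` when `m = 4` and is
    -- always soluble when `m` is at least 5.
    table₄-complete : ∀ k a b c → BooleanAt (4 ℕ.+ k) a b c → table₄ a c ≡ true ⊎ (1 ℕ.≤ k × a ≡ r7)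
    table₄-complete k r1 b one _ = inj₁ refl
    table₄-complete k r5 b three _ = inj₁ refl
    table₄-complete k r3 b c (nc , _) = ⊥-elim (nc (inj₂ (inj₂ (inj₂ (inj₁ refl)))))
    table₄-complete zero r7 b c (nc , _) = ⊥-elim (nc (inj₂ (inj₂ (inj₂ (inj₂ (inj₂ (refl , refl)))))))
    table₄-complete (suc k) r7 b c _ = inj₂ (s≤s z≤n , refl)
    table₄-complete k r1 b three (_ , inj₁ ())
    table₄-complete k r1 b three (_ , inj₂ ())
    table₄-complete k r5 b one (_ , inj₁ ())
    table₄-complete k r5 b one (_ , inj₂ ())

  even⇒boolean : ∀ m → EvenSoluble m (+ p) (+ D) (+ C) → EvenBoolean m
  even⇒boolean m h = let a , b , c , R = classified in from-residues m R (go m h a b c R)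
    where
    go : ∀ m → EvenSoluble m (+ p) (+ D) (+ C) → ∀ a b c → Residues a b c → BooleanAt m a b c
    go .1 (inj₁ (refl , h)) a b c (ha , hb , hc) =
      boolean₁ a b c (proj₁ (table₁-correct odd-P odd-D odd-C a b c (PD≡ ha) (nat-mod 4 D _ hb) (nat-mod 4 C _ hc)) h)
    go .3 (inj₂ (inj₁ (refl , h))) a b c (ha , hb , hc) = seven a (trans (sym ha) (PD≡⁻ 7 h))
      where
      seven : ∀ a → val₈ a ≡ 7 → BooleanAt 3 a b c
      seven r7 _ = (λ { (inj₂ (inj₂ (inj₁ ()))) ; (inj₂ (inj₂ (inj₂ (inj₁ ())))) ;
        (inj₂ (inj₂ (inj₂ (inj₂ (inj₁ (_ , ())))))) }) , inj₁ refl
    go (suc (suc (suc (suc k)))) (inj₂ (inj₂ (inj₁ (_ , h)))) a b c (ha , hb , hc) =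
      boolean₄ k a b c (proj₁ (table₄-correct odd-P odd-D odd-C a c (PD≡ ha) (nat-mod 4 C _ hc)) h)
    go (suc (suc (suc (suc (suc k))))) (inj₂ (inj₂ (inj₂ (_ , h)))) a b c (ha , hb , hc) = seven a (trans (sym ha) (PD≡⁻ 7 h))
      where
      seven : ∀ a → val₈ a ≡ 7 → BooleanAt (5 ℕ.+ k) a b c
      seven r7 _ = (λ { (inj₂ (inj₂ (inj₂ (inj₁ ())))) ; (inj₂ (inj₂ (inj₂ (inj₂ (inj₂ (() , _)))))) }) , inj₁ refl
    go 1 (inj₂ (inj₂ (inj₁ (s≤s () , _))))
    go 2 (inj₂ (inj₂ (inj₁ (s≤s (s≤s ()) , _))))
    go 3 (inj₂ (inj₂ (inj₁ (s≤s (s≤s (s≤s ())) , _))))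
    go 1 (inj₂ (inj₂ (inj₂ (s≤s () , _))))
    go 2 (inj₂ (inj₂ (inj₂ (s≤s (s≤s ()) , _))))
    go 3 (inj₂ (inj₂ (inj₂ (s≤s (s≤s (s≤s ())) , _))))
    go 4 (inj₂ (inj₂ (inj₂ (s≤s (s≤s (s≤s (s≤s ()))) , _))))

  boolean⇒even : ∀ m → 1 ℕ.≤ m → EvenBoolean m → EvenSoluble m (+ p) (+ D) (+ C)
  boolean⇒even m 1≤m h = let a , b , c , R = classified in go m 1≤m a b c R (to-residues m R h)
    where
    go : ∀ m → 1 ℕ.≤ m → ∀ a b c → Residues a b c → BooleanAt m a b c → EvenSoluble m (+ p) (+ D) (+ C)
    go 1 _ a b c (ha , hb , hc) h = inj₁ (refl ,
      proj₂ (table₁-correct odd-P odd-D odd-C a b c (PD≡ ha) (nat-mod 4 D _ hb) (nat-mod 4 C _ hc)) (table₁-complete a b c h))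
    go 2 _ a b c _ (nc , _) = ⊥-elim (nc (inj₂ (inj₂ (inj₁ refl))))
    go 3 _ r1 b c R (nc , _) = ⊥-elim (nc (inj₂ (inj₂ (inj₂ (inj₂ (inj₁ (refl , refl)))))))
    go 3 _ r3 b c R (nc , _) = ⊥-elim (nc (inj₂ (inj₂ (inj₂ (inj₁ refl)))))
    go 3 _ r5 b c R (nc , _) = ⊥-elim (nc (inj₂ (inj₂ (inj₂ (inj₂ (inj₁ (refl , refl)))))))
    go 3 _ r7 b c (ha , _) _ = inj₂ (inj₁ (refl , PD≡ ha))
    go (suc (suc (suc (suc k)))) _ a b c (ha , hb , hc) h = [ four , five ]′ (table₄-complete k a b c h)
      where
      four : table₄ a c ≡ true → EvenSoluble (4 ℕ.+ k) (+ p) (+ D) (+ C)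
      four t = inj₂ (inj₂ (inj₁ (s≤s (s≤s (s≤s (s≤s z≤n))) , proj₂ (table₄-correct odd-P odd-D odd-C a c
        (PD≡ ha) (nat-mod 4 C _ hc)) t)))
      five : 1 ℕ.≤ k × a ≡ r7 → EvenSoluble (4 ℕ.+ k) (+ p) (+ D) (+ C)
      five (1≤k , e) = inj₂ (inj₂ (inj₂ (s≤s (s≤s (s≤s (s≤s 1≤k))) , PD≡ (trans ha (cong val₈ e)))))

-- Products of primes and parities

xorAll : {A : Set} → (A → Bool) → List A → Bool
xorAll f = foldr (λ x b → f x xor b) false

module _ {A : Set} where

  xorAll-cong : ∀ {f g : A → Bool} → (∀ x → f x ≡ g x) → ∀ xs → xorAll f xs ≡ xorAll g xs
  xorAll-cong e [] = refl
  xorAll-cong e (x ∷ xs) = cong₂ _xor_ (e x) (xorAll-cong e xs)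

  xorAll-xor : ∀ (f g : A → Bool) xs → xorAll (λ x → f x xor g x) xs ≡ xorAll f xs xor xorAll g xs
  xorAll-xor f g [] = refl
  xorAll-xor f g (x ∷ xs) = trans (cong ((f x xor g x) xor_) (xorAll-xor f g xs)) (interchange (f x) (g x)
    (xorAll f xs) (xorAll g xs))
    where
    interchange : ∀ a b c d → (a xor b) xor (c xor d) ≡ (a xor c) xor (b xor d)
    interchange false false c d = refl
    interchange false true false d = refl
    interchange false true true d = refl
    interchange true false c d = 𝔹ₚ.not-distribˡ-xor c d
    interchange true true false d = sym (𝔹ₚ.not-involutive d)
    interchange true true true d = refl

  xorAll-map : ∀ {B : Set} (f : A → Bool) (g : B → A) xs → xorAll f (map g xs) ≡ xorAll (f ∘ g) xs
  xorAll-map f g [] = refl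
  xorAll-map f g (x ∷ xs) = cong (f (g x) xor_) (xorAll-map f g xs)

  count-odd : ∀ (f : A → Bool) xs → oddᵇ (countᵇ f xs) ≡ xorAll f xs
  count-odd f [] = refl
  count-odd f (x ∷ xs) with f x
  ... | true = cong not (count-odd f xs)
  ... | false = count-odd f xs

even-oddᵇ : ∀ k → (k ℕ.% 2 ℕ.≡ᵇ 0) ≡ not (oddᵇ k)
even-oddᵇ 0 = refl
even-oddᵇ 1 = refl
even-oddᵇ (suc (suc k)) = trans (even-oddᵇ k) (cong not (sym (𝔹ₚ.not-involutive (oddᵇ k))))

χ₄-* : ∀ x y → x ℕ.% 2 ≡ 1 → y ℕ.% 2 ≡ 1 → χ₄ (x ℕ.* y) ≡ χ₄ x xor χ₄ y
χ₄-* x y hx hy = trans (cong (ℕ._≡ᵇ 3) (ℕ%.%-distribˡ-* x y 4)) (go (class₄ x hx) (class₄ y hy))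
  where
  go : (∃ λ a → x ℕ.% 4 ≡ val₄ a) → (∃ λ a → y ℕ.% 4 ≡ val₄ a) →
    (((x ℕ.% 4) ℕ.* (y ℕ.% 4)) ℕ.% 4 ℕ.≡ᵇ 3) ≡ χ₄ x xor χ₄ y
  go (one , e) (one , e′) rewrite e | e′ = refl
  go (one , e) (three , e′) rewrite e | e′ = refl
  go (three , e) (one , e′) rewrite e | e′ = refl
  go (three , e) (three , e′) rewrite e | e′ = refl

Unit-ℕ* : ∀ {ℓ} → Prime ℓ → ∀ x y → Unit ℓ (+ x) → Unit ℓ (+ y) → Unit ℓ (+ (x ℕ.* y))
Unit-ℕ* {ℓ} pr x y ux uy = subst (Unit ℓ) (sym (ℤₚ.pos-* x y)) (Unit-* pr ux uy)

distinct-unit : ∀ {ℓ r} → Prime ℓ → Prime r → ℓ ≢ r → Unit ℓ (+ r)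
distinct-unit {ℓ} {r} prℓ prr ℓ≢r z = [ (λ ℓ≡1 → ℕ.nonTrivial⇒≢1 {{prime⇒nonTrivial prℓ}} ℓ≡1) , ℓ≢r ]′
  (prime⇒irreducible prr (zero⇒∣ {+ r} z))

power-unit : ∀ {ℓ} → Prime ℓ → ∀ x k → Unit ℓ (+ x) → Unit ℓ (+ (x ℕ.^ k))
power-unit pr x zero u = Unit-1 pr
power-unit pr x (suc k) u = Unit-ℕ* pr x (x ℕ.^ k) u (power-unit pr x k u)

odd-prime : ∀ {ℓ} → Prime ℓ → ℓ ≢ 2 → ℓ ℕ.% 2 ≡ 1
odd-prime {ℓ} pr ℓ≢2 = go (ℓ ℕ.% 2) refl (ℕ%.m%n<n ℓ 2)
  where
  go : ∀ r → ℓ ℕ.% 2 ≡ r → r ℕ.< 2 → ℓ ℕ.% 2 ≡ 1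
  go 0 e _ = ⊥-elim ([ (λ ()) , (λ 2≡ℓ → ℓ≢2 (sym 2≡ℓ)) ]′ (prime⇒irreducible pr (ℕ∣.m%n≡0⇒n∣m ℓ 2 e)))
  go 1 e _ = e
  go (suc (suc _)) _ (s≤s (s≤s ()))

module _ {n : ℕ} where

  prod : (Fin n → ℕ) → List (Fin n) → ℕ
  prod f is = foldr ℕ._*_ 1 (map f is)

  -- The factor at `j` becomes `1` while `j` stays in the list of indices, so parities of the full
  -- and the reduced product are sums over the same list.
  omit : (Fin n → ℕ) → Fin n → Fin n → ℕ
  omit f j i = if does (i Finₚ.≟ j) then 1 else f i

  omit-self : ∀ f j → omit f j j ≡ 1
  omit-self f j with j Finₚ.≟ j
  ... | yes _ = refl
  ... | no j≢j = contradiction refl j≢j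

  omit-other : ∀ f {i j} → i ≢ j → omit f j i ≡ f i
  omit-other f {i} {j} i≢j with i Finₚ.≟ j
  ... | yes e = contradiction e i≢j
  ... | no _ = refl

  prod-omit-∉ : ∀ f {j is} → All (j ≢_) is → prod f is ≡ prod (omit f j) is
  prod-omit-∉ f [] = refl
  prod-omit-∉ f (j≢i ∷ ∉) = cong₂ ℕ._*_ (sym (omit-other f (j≢i ∘ sym))) (prod-omit-∉ f ∉)

  prod-omit : ∀ f {j is} → Unique is → j ∈ is → prod f is ≡ f j ℕ.* prod (omit f j) is
  prod-omit f {j} {_ ∷ js} (∉ ∷ _) (here refl) = cong (f j ℕ.*_) (trans (prod-omit-∉ f ∉)
    (sym (trans (cong (ℕ._* prod (omit f j) js) (omit-self f j)) (ℕₚ.*-identityˡ (prod (omit f j) js)))))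
  prod-omit f {j} {i ∷ is} (∉ ∷ u) (there j∈) = trans
    (cong₂ ℕ._*_ (sym (omit-other f (λ { refl → All.lookup ∉ j∈ refl }))) (prod-omit f u j∈))
    (rearrange (omit f j i) (f j) (prod (omit f j) is))
    where
    rearrange : ∀ a b c → a ℕ.* (b ℕ.* c) ≡ b ℕ.* (a ℕ.* c)
    rearrange = ℕSolver.solve-∀

  prod-positive : ∀ f → (∀ i → 1 ℕ.≤ f i) → ∀ is → 1 ℕ.≤ prod f is
  prod-positive f h [] = s≤s z≤n
  prod-positive f h (i ∷ is) = ℕₚ.*-mono-≤ (h i) (prod-positive f h is)

  prod-odd : ∀ f → (∀ i → f i ℕ.% 2 ≡ 1) → ∀ is → prod f is ℕ.% 2 ≡ 1
  prod-odd f h [] = refl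
  prod-odd f h (i ∷ is) = trans (ℕ%.%-distribˡ-* (f i) (prod f is) 2)
    (cong₂ (λ a b → (a ℕ.* b) ℕ.% 2) (h i) (prod-odd f h is))

  prod-χ₄ : ∀ f → (∀ i → f i ℕ.% 2 ≡ 1) → ∀ is → χ₄ (prod f is) ≡ xorAll (χ₄ ∘ f) is
  prod-χ₄ f h [] = refl
  prod-χ₄ f h (i ∷ is) = trans (χ₄-* (f i) (prod f is) (h i) (prod-odd f h is)) (cong (χ₄ (f i) xor_) (prod-χ₄ f h is))

  prod-unit : ∀ {ℓ} → Prime ℓ → ∀ f → (∀ i → Unit ℓ (+ f i)) → ∀ is → Unit ℓ (+ prod f is)
  prod-unit pr f h [] = Unit-1 pr
  prod-unit pr f h (i ∷ is) = Unit-ℕ* pr (f i) (prod f is) (h i) (prod-unit pr f h is)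

  module _ {ℓ : ℕ} (pr : Prime ℓ) (odd : ℓ ℕ.% 2 ≡ 1) where

    open OddPrime pr odd

    isNR-1 : isNR 1ℤ ℓ ≡ false
    isNR-1 = isNR-Sq (Unit-1 pr) (1ℤ , ≡ₘ-refl)

    isNR-ℕ* : ∀ x y → Unit ℓ (+ x) → Unit ℓ (+ y) → isNR (+ (x ℕ.* y)) ℓ ≡ isNR (+ x) ℓ xor isNR (+ y) ℓ
    isNR-ℕ* x y ux uy = trans (cong (λ z → isNR z ℓ) (ℤₚ.pos-* x y)) (isNR-* (+ x) (+ y) ux uy)

    prod-isNR : ∀ f → (∀ i → Unit ℓ (+ f i)) → ∀ is → isNR (+ prod f is) ℓ ≡ xorAll (λ i → isNR (+ f i) ℓ) is
    prod-isNR f h [] = isNR-1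
    prod-isNR f h (i ∷ is) = trans (isNR-ℕ* (f i) (prod f is) (h i) (prod-unit pr f h is))
      (cong (isNR (+ f i) ℓ xor_) (prod-isNR f h is))

-- Lets a sum over all `D_i` of symbols at `D_j` include the term `i = j`.
isNR-self : ∀ ℓ → Prime ℓ → isNR (+ ℓ) ℓ ≡ false
isNR-self ℓ pr with legendre (+ ℓ) ℓ | isNR (+ ℓ) ℓ | legendre-view (+ ℓ) ℓ {{prime⇒nonZero pr}}
... | _ | _ | isZero _ = refl
... | _ | _ | isResidue _ _ = refl
... | _ | _ | isNonresidue u _ = contradiction (lin₀ 1ℤ (trans (ℤₚ.+-identityʳ (+ ℓ)) (sym (ℤₚ.*-identityˡ (+ ℓ))))) u

-- Labelings of the graph

module Labelings (p q m n : ℕ) (Dv : Fin n → ℕ) (s : ℕ) where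

  open Setup p q m n Dv s

  is : List (Fin n)
  is = allFin n

  label : Vec Bool n → Vtx → Bool
  label c (vD i) = lookup c i
  label c _ = false

  part : Vec Bool n → List Vtx → Partition
  part c = map (λ v → v , label c v)

  labelings-keys : ∀ vs {L} → L ∈ labelings vs → map proj₁ L ≡ vs
  labelings-keys [] (here refl) = refl
  labelings-keys (v ∷ vs) L∈ = go (labelings vs) (λ h → labelings-keys vs h) L∈
    where
    go : ∀ Ls → (∀ {L} → L ∈ Ls → map proj₁ L ≡ vs) → ∀ {L} →
      L ∈ concatMap (λ L → ((v , true) ∷ L) ∷ ((v , false) ∷ L) ∷ []) Ls → map proj₁ L ≡ v ∷ vs
    go (L ∷ Ls) h (here refl) = cong (v ∷_) (h (here refl))
    go (L ∷ Ls) h (there (here refl)) = cong (v ∷_) (h (here refl))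
    go (L ∷ Ls) h (there (there r)) = go Ls (h ∘ there) r

  part-∈ : ∀ c vs → part c vs ∈ labelings vs
  part-∈ c [] = here refl
  part-∈ c (v ∷ vs) = go (label c v) (labelings vs) (part-∈ c vs)
    where
    go : ∀ b Ls {L} → L ∈ Ls → ((v , b) ∷ L) ∈ concatMap (λ L → ((v , true) ∷ L) ∷ ((v , false) ∷ L) ∷ []) Ls
    go true (_ ∷ _) (here refl) = here refl
    go false (_ ∷ _) (here refl) = there (here refl)
    go b (_ ∷ Ls) (there h) = there (there (go b Ls h))

  labelings-unique : ∀ vs → Unique (labelings vs)
  labelings-unique [] = [] ∷ []
  labelings-unique (v ∷ vs) = go (labelings vs) (labelings-unique vs)
    where
    extend : Partition → List Partition
    extend L = ((v , true) ∷ L) ∷ ((v , false) ∷ L) ∷ []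
    tail-∈ : ∀ Ls {b L} → ((v , b) ∷ L) ∈ concatMap extend Ls → L ∈ Ls
    tail-∈ (_ ∷ _) (here refl) = here refl
    tail-∈ (_ ∷ _) (there (here refl)) = here refl
    tail-∈ (_ ∷ Ls) (there (there h)) = there (tail-∈ Ls h)
    fresh : ∀ {L Ls} b → All (L ≢_) Ls → All (((v , b) ∷ L) ≢_) (concatMap extend Ls)
    fresh {L} {Ls} b ∉ = All.tabulate λ { y∈ refl → All.lookup ∉ (tail-∈ Ls y∈) refl }
    go : ∀ Ls → Unique Ls → Unique (concatMap extend Ls)
    go [] [] = []
    go (L ∷ Ls) (∉ ∷ u) = ((λ ()) ∷ fresh true ∉) ∷ (fresh false ∉ ∷ go Ls u)

  -- Junk value false when vD i does not occur.
  assoc : Partition → Fin n → Bool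
  assoc [] i = false
  assoc ((vD j , b) ∷ L) i = if does (i Finₚ.≟ j) then b else assoc L i
  assoc (_ ∷ L) i = assoc L i

  labels : Partition → Vec Bool n
  labels L = tabulate (assoc L)

  assoc-here : ∀ i b L → assoc ((vD i , b) ∷ L) i ≡ b
  assoc-here i b L with i Finₚ.≟ i
  ... | yes _ = refl
  ... | no ne = contradiction refl ne

  assoc-there : ∀ {i j} b L → i ≢ j → assoc ((vD j , b) ∷ L) i ≡ assoc L i
  assoc-there {i} {j} b L i≢j with i Finₚ.≟ j
  ... | yes e = contradiction e i≢j
  ... | no _ = refl

  assoc-recovers : ∀ js → Unique js → ∀ L → map proj₁ L ≡ map vD js → L ≡ map (λ i → vD i , assoc L i) js
  assoc-recovers [] _ [] _ = refl
  assoc-recovers (j ∷ js) (∉ ∷ u) ((v , b) ∷ L) e with Listₚ.∷-injective e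
  ... | refl , e′ = cong₂ _∷_ (cong (vD j ,_) (sym (assoc-here j b L)))
    (trans (assoc-recovers js u L e′) (Listₚ.map-cong-local
      (All.map (λ {i} j≢i → cong (vD i ,_) (sym (assoc-there b L (j≢i ∘ sym)))) ∉)))

  assoc-part : ∀ c js {i} → i ∈ js → assoc (map (λ i → vD i , lookup c i) js) i ≡ lookup c i
  assoc-part c (j ∷ js) {i} i∈ with i Finₚ.≟ j
  ... | yes refl = refl
  assoc-part c (j ∷ js) {i} (here e) | no i≢j = contradiction e i≢j
  assoc-part c (j ∷ js) {i} (there i∈) | no _ = assoc-part c js i∈

  part-vD : ∀ c js → part c (map vD js) ≡ map (λ i → vD i , lookup c i) js
  part-vD c js = sym (Listₚ.map-∘ js)

  base : List Vtx
  base = vp ∷ vq ∷ map vD is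

  labels-part : ∀ c → labels (part c vertices) ≡ c
  labels-part c = trans (Vecₚ.tabulate-cong (λ i → trans (skip case2 i) (assoc-part c is (∈ₚ.∈-allFin i))))
    (Vecₚ.tabulate∘lookup c)
    where
    skip : ∀ b i → assoc (part c (if b then base else v-1 ∷ base)) i ≡ assoc (map (λ i → vD i , lookup c i) is) i
    skip true i = cong (λ L → assoc L i) (part-vD c is)
    skip false i = cong (λ L → assoc L i) (part-vD c is)

  allᵇ-lookup : ∀ {A : Set} (f : A → Bool) {xs x} → allᵇ f xs ≡ true → x ∈ xs → f x ≡ true
  allᵇ-lookup f {y ∷ _} e (here refl) with f y
  ... | true = refl
  allᵇ-lookup f {y ∷ _} e (there h) with f y
  ... | true = allᵇ-lookup f e h

  allᵇ-build : ∀ {A : Set} (f : A → Bool) xs → (∀ {x} → x ∈ xs → f x ≡ true) → allᵇ f xs ≡ true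
  allᵇ-build f [] h = refl
  allᵇ-build f (x ∷ xs) h = cong₂ _∧_ (h (here refl)) (allᵇ-build f xs (h ∘ there))

  -- Restriction places -1, p and q in V₂, so only the labels of the `D_i` carry information.
  recover : ∀ {L} → L ∈ labelings vertices → restricted L ≡ true → L ≡ part (labels L) vertices
  recover {L} L∈ r = go case2 L (labelings-keys vertices L∈) (λ h → allᵇ-lookup _ r h)
    where
    forced : ∀ {v b} → forcedV2 v ≡ true → not (forcedV2 v ∧ b) ≡ true → b ≡ false
    forced {b = false} _ _ = refl
    forced {v} {true} e h rewrite e = case h of λ ()
    rest : ∀ L′ → map proj₁ L′ ≡ map vD is → L′ ≡ part (labels L′) (map vD is)
    rest L′ e = trans (assoc-recovers is (Uniqueₚ.allFin⁺ n) L′ e)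
      (trans (Listₚ.map-cong (λ i → cong (vD i ,_) (sym (Vecₚ.lookup∘tabulate (assoc L′) i))) is) (sym (part-vD (labels L′) is)))
    two : ∀ L → map proj₁ L ≡ base → (∀ {x} → x ∈ L → not (forcedV2 (proj₁ x) ∧ proj₂ x) ≡ true) → L ≡ part (labels L) base
    two ((v , b) ∷ (v′ , b′) ∷ L′) e h with Listₚ.∷-injective e
    ... | refl , e₁ with Listₚ.∷-injective e₁
    ...   | refl , e₂ = cong₂ _∷_ (cong (vp ,_) (forced {vp} refl (h (here refl))))
      (cong₂ _∷_ (cong (vq ,_) (forced {vq} refl (h (there (here refl))))) (rest L′ e₂))
    go : ∀ cs L → map proj₁ L ≡ (if cs then base else v-1 ∷ base) → (∀ {x} → x ∈ L → not (forcedV2 (proj₁ x) ∧ proj₂ x) ≡ true) →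
      L ≡ part (labels L) (if cs then base else v-1 ∷ base)
    go true L e h = two L e h
    go false ((v , b) ∷ L′) e h with Listₚ.∷-injective e
    ... | refl , e₁ = cong₂ _∷_ (cong (v-1 ,_) (forced {v-1} refl (h (here refl)))) (two L′ e₁ (h ∘ there))

  outParity : Vec Bool n → Vtx → Bool
  outParity c P = xorAll (λ v → (label c P xor label c v) ∧ edge P v) vertices

  cross-parity : ∀ c P → isEven (crossOut (part c vertices) P (label c P)) ≡ not (outParity c P)
  cross-parity c P = trans (even-oddᵇ (crossOut (part c vertices) P (label c P)))
    (cong not (trans (count-odd crosses (part c vertices)) (xorAll-map crosses (λ v → v , label c v) vertices)))
    where
    crosses : Vtx × Bool → Bool
    crosses (v , b) = (label c P xor b) ∧ edge P v

  -- The index is the exponent of 2 in `d`.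
  balanced : Bool → Partition → Bool
  balanced false L = even L
  balanced true L = quasiEven L

  vertexTest : ∀ b x y → (if b then x else not x) ≡ true → x ≡ not y → y ≡ not b
  vertexTest true true false _ _ = refl
  vertexTest false false true _ _ = refl
  vertexTest true true true _ ()
  vertexTest false false false _ ()

  vertexTest⁻ : ∀ b x y → y ≡ not b → x ≡ not y → (if b then x else not x) ≡ true
  vertexTest⁻ true true _ refl _ = refl
  vertexTest⁻ false false _ refl _ = refl

  balanced⇒ : ∀ t c → balanced t (part c vertices) ≡ true → ∀ {P} → P ∈ vertices → outParity c P ≡ t ∧ not (twoSym P)
  balanced⇒ false c e {P} P∈ = vertexTest true _ (outParity c P) (allᵇ-lookup _ e (∈ₚ.∈-map⁺ _ P∈)) (cross-parity c P)
  balanced⇒ true c e {P} P∈ = vertexTest (twoSym P) _ (outParity c P) (allᵇ-lookup _ e (∈ₚ.∈-map⁺ _ P∈)) (cross-parity c P)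

  ⇒balanced : ∀ t c → (∀ {P} → P ∈ vertices → outParity c P ≡ t ∧ not (twoSym P)) → balanced t (part c vertices) ≡ true
  ⇒balanced false c h = allᵇ-build _ (part c vertices) λ x∈ → case ∈ₚ.∈-map⁻ (λ v → v , label c v) x∈ of
    λ { (P , P∈ , refl) → vertexTest⁻ true _ (outParity c P) (h P∈) (cross-parity c P) }
  ⇒balanced true c h = allᵇ-build _ (part c vertices) λ x∈ → case ∈ₚ.∈-map⁻ (λ v → v , label c v) x∈ of
    λ { (P , P∈ , refl) → vertexTest⁻ (twoSym P) _ (outParity c P) (h P∈) (cross-parity c P) }

  restricted⇒ : ∀ c → restricted (part c vertices) ≡ true → ∀ i → lookup c i ≡ true → inS i ≡ true
  restricted⇒ c e i ci = test (inS i) (lookup c i) ci (allᵇ-lookup _ e (∈ₚ.∈-map⁺ (λ v → v , label c v) (vD∈ case2)))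
    where
    test : ∀ a b → b ≡ true → not (not a ∧ b) ≡ true → a ≡ true
    test true b _ _ = refl
    test false true _ ()
    vD∈ : ∀ b → vD i ∈ (if b then base else v-1 ∷ base)
    vD∈ true = there (there (∈ₚ.∈-map⁺ vD (∈ₚ.∈-allFin i)))
    vD∈ false = there (there (there (∈ₚ.∈-map⁺ vD (∈ₚ.∈-allFin i))))

  ⇒restricted : ∀ c → (∀ i → lookup c i ≡ true → inS i ≡ true) → restricted (part c vertices) ≡ true
  ⇒restricted c h = allᵇ-build _ (part c vertices) λ x∈ → case ∈ₚ.∈-map⁻ (λ v → v , label c v) x∈ of
    λ { (v , _ , refl) → test v }
    where
    test : ∀ v → not (forcedV2 v ∧ label c v) ≡ true
    test v-1 = refl
    test vp = refl
    test vq = refl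
    test (vD i) = go (inS i) (lookup c i) (h i)
      where
      go : ∀ a b → (b ≡ true → a ≡ true) → not (not a ∧ b) ≡ true
      go true b _ = refl
      go false false _ = refl
      go false true f = f refl

-- The Selmer group

legendre-one : ∀ a ℓ → Prime ℓ → legendre a ℓ ≡ + 1 → Unit ℓ a × Sq ℓ a
legendre-one a ℓ pr e with legendre a ℓ | isNR a ℓ | legendre-view a ℓ {{prime⇒nonZero pr}}
legendre-one a ℓ pr refl | _ | _ | isResidue u sq = u , sq

legendre-minus-one : ∀ a ℓ → Prime ℓ → legendre a ℓ ≡ -[1+ 0 ] → ¬ Sq ℓ a
legendre-minus-one a ℓ pr e with legendre a ℓ | isNR a ℓ | legendre-view a ℓ {{prime⇒nonZero pr}}
legendre-minus-one a ℓ pr refl | _ | _ | isNonresidue _ nsq = nsq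

xor-false : ∀ a b → a xor b ≡ false → b ≡ a
xor-false false false _ = refl
xor-false true true _ = refl

false-xor : ∀ {a b} → b ≡ a → a xor b ≡ false
false-xor {a} refl = 𝔹ₚ.xor-same a

module Selmer (p q m : ℕ) (prime-p : Prime p) (prime-q : Prime q) (p-odd : p ℕ.% 2 ≡ 1) (q-odd : q ℕ.% 2 ≡ 1)
  (1≤m : 1 ℕ.≤ m) (q≡ : q ≡ p ℕ.+ 2 ℕ.^ m) (n : ℕ) (Dv : Fin n → ℕ)
  (prime-D : ∀ i → Prime (Dv i)) (odd-D : ∀ i → Dv i ℕ.% 2 ≡ 1) (D-injective : ∀ i j → Dv i ≡ Dv j → i ≡ j)
  (D≢pq : ∀ i → Dv i ≢ p × Dv i ≢ q) (s : ℕ)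
  (inside : ∀ i → toℕ i ℕ.< s → legendre (+ (p ℕ.* q)) (Dv i) ≡ + 1)
  (outside : ∀ i → s ℕ.≤ toℕ i → legendre (+ (p ℕ.* q)) (Dv i) ≡ -[1+ 0 ]) where

  open Setup p q m n Dv s
  open Labelings p q m n Dv s

  T₂ : ℤ
  T₂ = + (2 ℕ.^ m)

  p+T≡q : + p + T₂ ≡ + q
  p+T≡q = trans (sym (ℤₚ.pos-+ p (2 ℕ.^ m))) (cong +_ (sym q≡))

  p≢q : p ≢ q
  p≢q e = ℕ.≢-nonZero⁻¹ (2 ℕ.^ m) {{ℕₚ.m^n≢0 2 m}} (ℕₚ.+-cancelˡ-≡ p (2 ℕ.^ m) 0
    (trans (sym q≡) (trans (sym e) (sym (ℕₚ.+-identityʳ p)))))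

  Φ≡poly : ∀ ℓ d X Z → LocalField.Φ ℓ d p q m D X Z ≡ poly d (+ p) T₂ (+ D) X Z
  Φ≡poly ℓ d X Z = cong₂ (λ c e → quartic d c e X Z)
    (cong (λ t → - (+ 2 * t * + D * d)) (trans (ℤₚ.pos-+ p q) (cong (λ t → + p + t) (sym p+T≡q))))
    (trans (ℤₚ.pos-* (4 ℕ.^ m) (D ℕ.* D)) (cong₂ _*_ (trans (cong +_ (four-power m)) (ℤₚ.pos-* (2 ℕ.^ m) (2 ℕ.^ m)))
      (ℤₚ.pos-* D D)))
    where
    four-power : ∀ m → 4 ℕ.^ m ≡ 2 ℕ.^ m ℕ.* 2 ℕ.^ m
    four-power m = trans (ℕₚ.^-*-assoc 2 2 m) (trans (cong (2 ℕ.^_) (double m)) (ℕₚ.^-distribˡ-+-* 2 m m))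
      where
      double : ∀ m → 2 ℕ.* m ≡ m ℕ.+ m
      double = ℕSolver.solve-∀

  factor : Vec Bool n → Fin n → ℕ
  factor c i = pw (lookup c i) (Dv i)

  C : Vec Bool n → ℕ
  C c = prod (factor c) is

  N : Bool → Vec Bool n → ℕ
  N t c = pw t 2 ℕ.* C c

  -- The symbol of `2^t` at `ℓ`, written additively; it is what separates quasi-even from even.
  twist : Bool → ℕ → Bool
  twist t ℓ = t ∧ isNR (+ 2) ℓ

  -- For `b` false this says that `d` is a square at `D_j`. For `b` true it says so of `p D′ d′`: a
  -- `D_i` dividing both `D′` and `d′` contributes a square, so the `D_i` outside `d` remain.
  AtD : Bool → Vec Bool n → Fin n → Bool → Set
  AtD t c j b = (b ∧ isNR (+ p) (Dv j)) xor xorAll (λ i → (b xor lookup c i) ∧ isNR (+ Dv i) (Dv j)) is ≡ twist t (Dv j)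

  -- The local conditions on d = ± 2^t ∏ D_i^{c_i}, written with parities.
  record Good (t : Bool) (c : Vec Bool n) : Set where
    field
      sub : ∀ i → lookup c i ≡ true → inS i ≡ true
      atp : xorAll (λ i → lookup c i ∧ isNR (+ Dv i) p) is ≡ twist t p
      atq : xorAll (λ i → lookup c i ∧ isNR (+ Dv i) q) is ≡ twist t q
      atD : ∀ j → AtD t c j (lookup c j)
      at2 : case2 ≡ true ⊎ xorAll (λ i → lookup c i ∧ isNR -[1+ 0 ] (Dv i)) is ≡ t ∧ not (twoSym v-1)

  module _ {ℓ : ℕ} (pr : Prime ℓ) where

    pw-unit : ∀ b x → (b ≡ true → Unit ℓ (+ x)) → Unit ℓ (+ pw b x)
    pw-unit true x u = u refl
    pw-unit false x u = Unit-1 pr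

    omit-unit : ∀ (f : Fin n → ℕ) j → (∀ i → i ≢ j → Unit ℓ (+ f i)) → ∀ i → Unit ℓ (+ omit f j i)
    omit-unit f j h i with i Finₚ.≟ j
    ... | yes _ = Unit-1 pr
    ... | no i≢j = h i i≢j

    D-unit : (∀ i → ℓ ≢ Dv i) → Unit ℓ (+ D)
    D-unit h = prod-unit pr Dv (λ i → distinct-unit pr (prime-D i) (h i)) is

    factor-unit : ∀ c → (∀ i → lookup c i ≡ true → ℓ ≢ Dv i) → ∀ i → Unit ℓ (+ factor c i)
    factor-unit c h i = pw-unit (lookup c i) (Dv i) (λ e → distinct-unit pr (prime-D i) (h i e))

    module _ (odd : ℓ ℕ.% 2 ≡ 1) where

      open OddPrime pr odd

      T-unit : Unit ℓ T₂
      T-unit = power-unit pr 2 m Unit-2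

      isNR-pw : ∀ b x → isNR (+ pw b x) ℓ ≡ b ∧ isNR (+ x) ℓ
      isNR-pw true x = refl
      isNR-pw false x = isNR-1 {n} pr odd

      isNR-omit : ∀ (f : Fin n → ℕ) j (g : Fin n → Bool) → g j ≡ false → (∀ i → i ≢ j → isNR (+ f i) ℓ ≡ g i) →
        ∀ i → isNR (+ omit f j i) ℓ ≡ g i
      isNR-omit f j g gj h i with i Finₚ.≟ j
      ... | yes refl = trans (isNR-1 {n} pr odd) (sym gj)
      ... | no i≢j = h i i≢j

      pw2-unit : ∀ t → Unit ℓ (+ pw t 2)
      pw2-unit t = pw-unit t 2 (λ _ → Unit-2)

      N-unit : ∀ t c → (∀ i → Unit ℓ (+ factor c i)) → Unit ℓ (+ N t c)
      N-unit t c u = Unit-ℕ* pr (pw t 2) (C c) (pw2-unit t) (prod-unit pr (factor c) u is)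

      N-isNR : ∀ t c → (∀ i → Unit ℓ (+ factor c i)) →
        isNR (+ N t c) ℓ ≡ twist t ℓ xor xorAll (λ i → lookup c i ∧ isNR (+ Dv i) ℓ) is
      N-isNR t c u = trans (isNR-ℕ* {n} pr odd (pw t 2) (C c) (pw2-unit t) (prod-unit pr (factor c) u is))
        (cong₂ _xor_ (isNR-pw t 2) (trans (prod-isNR pr odd (factor c) u is)
          (xorAll-cong (λ i → isNR-pw (lookup c i) (Dv i)) is)))

      Sq⇒parity : ∀ t c → (∀ i → Unit ℓ (+ factor c i)) → Sq ℓ (+ N t c) →
        xorAll (λ i → lookup c i ∧ isNR (+ Dv i) ℓ) is ≡ twist t ℓ
      Sq⇒parity t c u sq = xor-false _ _ (trans (sym (N-isNR t c u)) (isNR-Sq (N-unit t c u) sq))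

      parity⇒Sq : ∀ t c → (∀ i → Unit ℓ (+ factor c i)) →
        xorAll (λ i → lookup c i ∧ isNR (+ Dv i) ℓ) is ≡ twist t ℓ → Sq ℓ (+ N t c)
      parity⇒Sq t c u e = Sq-isNR (N-unit t c u) (trans (N-isNR t c u) (false-xor e))

  ℓ-point : ℕ → Bool → Vec Bool n → Set
  ℓ-point ℓ t c = HasPoint (Qℓ ℓ) (+ N t c) p q m D

  module At {ℓ : ℕ} (pr : Prime ℓ) (odd : ℓ ℕ.% 2 ≡ 1) (d : ℤ) where
    open OddConditions pr odd p q m D d (+ p) T₂ (+ D) (Φ≡poly ℓ d) public

  shape-p : ∀ d P T D X Z → poly d P T D X Z ≡
    (d * (Z * Z) + - (T * D) * (X * X)) * (d * (Z * Z) + - (T * D) * (X * X)) - P * (+ 4 * D * d * (X * X) * (Z * Z))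
  shape-p = identity
    where
    identity : ∀ d P T D X Z → (d * d * (Z * Z * (Z * Z)) + - (+ 2 * (P + (P + T)) * D * d) * (X * X) *
      (Z * Z) + T * T * (D * D) * (X * X * (X * X))) ≡
      (d * (Z * Z) + - (T * D) * (X * X)) * (d * (Z * Z) + - (T * D) * (X * X)) - P * (+ 4 * D * d * (X * X) * (Z * Z))
    identity = solve-∀

  shape-q : ∀ d P T D X Z → poly d P T D X Z ≡
    (d * (Z * Z) + T * D * (X * X)) * (d * (Z * Z) + T * D * (X * X)) - (P + T) * (+ 4 * D * d * (X * X) * (Z * Z))
  shape-q = identity
    where
    identity : ∀ d P T D X Z → (d * d * (Z * Z * (Z * Z)) + - (+ 2 * (P + (P + T)) * D * d) * (X * X) *
      (Z * Z) + T * T * (D * D) * (X * X * (X * X))) ≡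
      (d * (Z * Z) + T * D * (X * X)) * (d * (Z * Z) + T * D * (X * X)) - (P + T) * (+ 4 * D * d * (X * X) * (Z * Z))
    identity = solve-∀

  p≢D : ∀ i → p ≢ Dv i
  p≢D i e = proj₁ (D≢pq i) (sym e)

  q≢D : ∀ i → q ≢ Dv i
  q≢D i e = proj₂ (D≢pq i) (sym e)

  point-at-p : ∀ t c → ℓ-point p t c → Sq p (+ N t c)
  point-at-p t c = At.conic-residue prime-p p-odd (+ N t c) (- (T₂ * + D)) (+ 4 * + D * + N t c)
    (shape-p (+ N t c) (+ p) T₂ (+ D))
    (λ z → Unit-* prime-p (T-unit prime-p p-odd) (D-unit prime-p p≢D) (lin₁ z -1ℤ (negate (T₂ * + D))))
    (Unit-* prime-p (Unit-* prime-p (OddModulus.Unit-4 prime-p p-odd) (D-unit prime-p p≢D)) uN) uN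
    where
    uN : Unit p (+ N t c)
    uN = N-unit prime-p p-odd t c (factor-unit prime-p c (λ i _ → p≢D i))
    negate : ∀ x → x - 0ℤ ≡ -1ℤ * (- x - 0ℤ)
    negate = solve-∀

  point-at-q : ∀ t c → ℓ-point q t c → Sq q (+ N t c)
  point-at-q t c = At.conic-residue prime-q q-odd (+ N t c) (T₂ * + D) (+ 4 * + D * + N t c)
    (λ X Z → trans (shape-q (+ N t c) (+ p) T₂ (+ D) X Z)
      (cong (λ r → w X Z * w X Z - r * (+ 4 * + D * + N t c * (X * X) * (Z * Z))) p+T≡q))
    (Unit-* prime-q (T-unit prime-q q-odd) (D-unit prime-q q≢D))
    (Unit-* prime-q (Unit-* prime-q (OddModulus.Unit-4 prime-q q-odd) (D-unit prime-q q≢D)) uN) uN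
    where
    w : ℤ → ℤ → ℤ
    w X Z = + N t c * (Z * Z) + T₂ * + D * (X * X)
    uN : Unit q (+ N t c)
    uN = N-unit prime-q q-odd t c (factor-unit prime-q c (λ i _ → q≢D i))

  -- At a prime D_j, write D = D_j D′ and, if D_j divides d, also d = D_j d′.
  module AtPrime (t : Bool) (c : Vec Bool n) (j : Fin n) where

    ℓ D′ d′ : ℕ
    ℓ = Dv j
    D′ = prod (omit Dv j) is
    d′ = pw t 2 ℕ.* prod (omit (factor c) j) is

    prℓ : Prime ℓ
    prℓ = prime-D j

    oddℓ : ℓ ℕ.% 2 ≡ 1
    oddℓ = odd-D j

    open OddPrime prℓ oddℓ

    D≡ : + D ≡ + ℓ * + D′
    D≡ = trans (cong +_ (prod-omit Dv (Uniqueₚ.allFin⁺ n) (∈ₚ.∈-allFin j))) (ℤₚ.pos-* ℓ D′)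

    others : ∀ i → i ≢ j → Unit ℓ (+ Dv i)
    others i i≢j = distinct-unit prℓ (prime-D i) (λ e → i≢j (sym (D-injective j i e)))

    D′-unit : Unit ℓ (+ D′)
    D′-unit = prod-unit prℓ (omit Dv j) (omit-unit prℓ Dv j others) is

    p-unit : Unit ℓ (+ p)
    p-unit = distinct-unit prℓ prime-p (proj₁ (D≢pq j))

    q-unit : Unit ℓ (+ q)
    q-unit = distinct-unit prℓ prime-q (proj₂ (D≢pq j))

    PT-unit : Unit ℓ (+ p + T₂)
    PT-unit = subst (Unit ℓ) (sym p+T≡q) q-unit

    module Outside (cj : lookup c j ≡ false) where

      units : ∀ i → Unit ℓ (+ factor c i)
      units = factor-unit prℓ c (λ i ci e → case trans (sym ci) (trans (cong (lookup c) (sym (D-injective j i e))) cj) of λ ())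

      necessary : ℓ-point ℓ t c → AtD t c j (lookup c j)
      necessary pt = subst (AtD t c j) (sym cj) (Sq⇒parity prℓ oddℓ t c units
        (At.residue-at-D prℓ oddℓ (+ N t c) D≡ D′-unit (T-unit prℓ oddℓ) (N-unit prℓ oddℓ t c units) pt))

      sufficient : AtD t c j (lookup c j) → ℓ-point ℓ t c
      sufficient h = At.residue-point prℓ oddℓ (+ N t c) (N-unit prℓ oddℓ t c units)
        (parity⇒Sq prℓ oddℓ t c units (subst (AtD t c j) cj h))

    module Inside (cj : lookup c j ≡ true) where

      d≡ : + N t c ≡ + ℓ * + d′
      d≡ = trans (cong +_ (trans (cong (pw t 2 ℕ.*_) (trans (prod-omit (factor c) (Uniqueₚ.allFin⁺ n) (∈ₚ.∈-allFin j))
          (cong (λ b → pw b (Dv j) ℕ.* prod (omit (factor c) j) is) cj))) (rearrange (pw t 2) ℓ (prod (omit (factor c) j) is))))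
            (ℤₚ.pos-* ℓ d′)
        where
        rearrange : ∀ a b c → a ℕ.* (b ℕ.* c) ≡ b ℕ.* (a ℕ.* c)
        rearrange = ℕSolver.solve-∀

      omitted-units : ∀ i → Unit ℓ (+ omit (factor c) j i)
      omitted-units = omit-unit prℓ (factor c) j (λ i i≢j → pw-unit prℓ (lookup c i) (Dv i) (λ _ → others i i≢j))

      d′-unit : Unit ℓ (+ d′)
      d′-unit = Unit-ℕ* prℓ (pw t 2) (prod (omit (factor c) j) is) (pw2-unit prℓ oddℓ t)
        (prod-unit prℓ (omit (factor c) j) omitted-units is)

      all-NR some-NR : Bool
      all-NR = xorAll (λ i → isNR (+ Dv i) ℓ) is
      some-NR = xorAll (λ i → lookup c i ∧ isNR (+ Dv i) ℓ) is

      isNR-D′ : isNR (+ D′) ℓ ≡ all-NR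
      isNR-D′ = trans (prod-isNR prℓ oddℓ (omit Dv j) (omit-unit prℓ Dv j others) is)
        (xorAll-cong (isNR-omit prℓ oddℓ Dv j (λ i → isNR (+ Dv i) ℓ) (isNR-self ℓ prℓ) (λ i _ → refl)) is)

      isNR-d′ : isNR (+ d′) ℓ ≡ twist t ℓ xor some-NR
      isNR-d′ = trans (isNR-ℕ* {n} prℓ oddℓ (pw t 2) (prod (omit (factor c) j) is) (pw2-unit prℓ oddℓ t)
        (prod-unit prℓ (omit (factor c) j) omitted-units is))
        (cong₂ _xor_ (isNR-pw prℓ oddℓ t 2) (trans (prod-isNR prℓ oddℓ (omit (factor c) j) omitted-units is)
          (xorAll-cong (isNR-omit prℓ oddℓ (factor c) j (λ i → lookup c i ∧ isNR (+ Dv i) ℓ)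
            (trans (cong (lookup c j ∧_) (isNR-self ℓ prℓ)) (𝔹ₚ.∧-zeroʳ (lookup c j)))
              (λ i _ → isNR-pw prℓ oddℓ (lookup c i) (Dv i))) is)))

      isNR-all : ∀ x → Unit ℓ x → isNR (x * + D′ * + d′) ℓ ≡ (isNR x ℓ xor all-NR) xor (twist t ℓ xor some-NR)
      isNR-all x ux = trans (isNR-* (x * + D′) (+ d′) (Unit-* prℓ ux D′-unit) d′-unit)
        (cong₂ _xor_ (trans (isNR-* x (+ D′) ux D′-unit) (cong (isNR x ℓ xor_) isNR-D′)) isNR-d′)

      product-unit : ∀ {x} → Unit ℓ x → Unit ℓ (x * + D′ * + d′)
      product-unit ux = Unit-* prℓ (Unit-* prℓ ux D′-unit) d′-unit

      complement : xorAll (λ i → (true xor lookup c i) ∧ isNR (+ Dv i) ℓ) is ≡ all-NR xor some-NR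
      complement = trans (xorAll-cong (λ i → pointwise (lookup c i) (isNR (+ Dv i) ℓ)) is)
        (xorAll-xor (λ i → isNR (+ Dv i) ℓ) (λ i → lookup c i ∧ isNR (+ Dv i) ℓ) is)
        where
        pointwise : ∀ b x → (true xor b) ∧ x ≡ x xor (b ∧ x)
        pointwise false false = refl
        pointwise false true = refl
        pointwise true false = refl
        pointwise true true = refl

      solve⇒ : ∀ a u v w → (a xor u) xor (w xor v) ≡ false → a xor (u xor v) ≡ w
      solve⇒ false false false false _ = refl
      solve⇒ false false true true _ = refl
      solve⇒ false true false true _ = refl
      solve⇒ false true true false _ = refl
      solve⇒ true false false true _ = refl
      solve⇒ true false true false _ = refl
      solve⇒ true true false false _ = refl
      solve⇒ true true true true _ = refl

      ⇒solve : ∀ a u v w → a xor (u xor v) ≡ w → (a xor u) xor (w xor v) ≡ false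
      ⇒solve false false false _ refl = refl
      ⇒solve false false true _ refl = refl
      ⇒solve false true false _ refl = refl
      ⇒solve false true true _ refl = refl
      ⇒solve true false false _ refl = refl
      ⇒solve true false true _ refl = refl
      ⇒solve true true false _ refl = refl
      ⇒solve true true true _ refl = refl

      roots : ℓ-point ℓ t c → Sq ℓ (+ p * + D′ * + d′) × Sq ℓ ((+ p + T₂) * + D′ * + d′)
      roots = At.root-at-D prℓ oddℓ (+ N t c) d≡ D≡ d′-unit D′-unit (T-unit prℓ oddℓ) p-unit PT-unit

      necessary : ℓ-point ℓ t c → AtD t c j (lookup c j)
      necessary pt = subst (AtD t c j) (sym cj) (trans (cong (isNR (+ p) ℓ xor_) complement)
        (solve⇒ (isNR (+ p) ℓ) all-NR some-NR (twist t ℓ) (trans (sym (isNR-all (+ p) p-unit))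
          (isNR-Sq (product-unit p-unit) (proj₁ (roots pt))))))

      inS-necessary : ℓ-point ℓ t c → inS j ≡ true
      inS-necessary pt = go (inS j) refl
        where
        square : ∀ {a b x} → Unit ℓ x → Sq ℓ (a * x) → Sq ℓ (b * x) → Sq ℓ (a * b)
        square {a} {b} {x} ux sa sb = Sq-cancel (Unit-* prℓ ux ux) (x , ≡ₘ-refl)
          (Sq-cong (≡ₘ-reflexive (identity a b x)) (Sq-* sa sb))
          where
          identity : ∀ a b x → a * x * (b * x) ≡ x * x * (a * b)
          identity = solve-∀
        pq-square : Sq ℓ (+ (p ℕ.* q))
        pq-square = Sq-cong (≡ₘ-reflexive (trans (cong (+ p *_) p+T≡q) (sym (ℤₚ.pos-* p q))))
          (square {+ p} {+ p + T₂} {+ D′ * + d′} (Unit-* prℓ D′-unit d′-unit)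
            (Sq-cong (≡ₘ-reflexive (ℤₚ.*-assoc (+ p) (+ D′) (+ d′))) (proj₁ (roots pt)))
            (Sq-cong (≡ₘ-reflexive (ℤₚ.*-assoc (+ p + T₂) (+ D′) (+ d′))) (proj₂ (roots pt))))
        go : ∀ b → inS j ≡ b → inS j ≡ true
        go true e = e
        go false e = contradiction pq-square (legendre-minus-one (+ (p ℕ.* q)) ℓ prℓ
          (outside j (ℕₚ.≮⇒≥ λ j<s → case trans (sym e) (<ᵇ-true j<s) of λ ())))
          where
          <ᵇ-true : ∀ {a b} → a ℕ.< b → (a ℕ.<ᵇ b) ≡ true
          <ᵇ-true {a} {b} h with a ℕ.<ᵇ b | ℕₚ.<⇒<ᵇ h
          ... | true | _ = refl

      sufficient : inS j ≡ true → AtD t c j (lookup c j) → ℓ-point ℓ t c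
      sufficient j∈S h = At.point-at-D prℓ oddℓ (+ N t c) d≡ D≡ d′-unit D′-unit (T-unit prℓ oddℓ) p-unit PT-unit
        (Sq-isNR (product-unit p-unit) (trans (isNR-all (+ p) p-unit) parities))
        (Sq-isNR (product-unit PT-unit) (trans (isNR-all (+ p + T₂) PT-unit)
          (trans (cong (λ b → (b xor all-NR) xor (twist t ℓ xor some-NR)) same) parities)))
        where
        parities : (isNR (+ p) ℓ xor all-NR) xor (twist t ℓ xor some-NR) ≡ false
        parities = ⇒solve (isNR (+ p) ℓ) all-NR some-NR (twist t ℓ) (trans (cong (isNR (+ p) ℓ xor_) (sym complement))
          (subst (AtD t c j) cj h))
        pq : Unit ℓ (+ (p ℕ.* q)) × Sq ℓ (+ (p ℕ.* q))
        pq = legendre-one (+ (p ℕ.* q)) ℓ prℓ (inside j (ℕₚ.<ᵇ⇒< (toℕ j) s (subst T (sym j∈S) tt)))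
        -- As `p q` is a square at `D_j`, the condition with `p` implies the one with `q`.
        -- Accordingly the graph has edges from `D_j` to p but none to q.
        same : isNR (+ p + T₂) ℓ ≡ isNR (+ p) ℓ
        same = trans (cong (λ x → isNR x ℓ) p+T≡q) (xor-false (isNR (+ p) ℓ) (isNR (+ q) ℓ)
          (trans (sym (isNR-ℕ* {n} prℓ oddℓ p q p-unit q-unit)) (isNR-Sq (proj₁ pq) (proj₂ pq))))

  D-odd : D ℕ.% 2 ≡ 1
  D-odd = prod-odd Dv odd-D is

  factor-odd : ∀ c i → factor c i ℕ.% 2 ≡ 1
  factor-odd c i with lookup c i
  ... | true = odd-D i
  ... | false = refl

  C-odd : ∀ c → C c ℕ.% 2 ≡ 1
  C-odd c = prod-odd (factor c) (factor-odd c) is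

  χ₄-C : ∀ c → xorAll (λ i → lookup c i ∧ isNR -[1+ 0 ] (Dv i)) is ≡ χ₄ (C c)
  χ₄-C c = sym (trans (prod-χ₄ (factor c) (factor-odd c) is) (xorAll-cong pointwise is))
    where
    pointwise : ∀ i → χ₄ (factor c i) ≡ lookup c i ∧ isNR -[1+ 0 ] (Dv i)
    pointwise i with lookup c i
    ... | true = sym (OddPrime.isNR-[-1] (prime-D i) (odd-D i))
    ... | false = refl

  TwoAdic : Bool → Vec Bool n → Set
  TwoAdic t c = case2 ≡ true ⊎ xorAll (λ i → lookup c i ∧ isNR -[1+ 0 ] (Dv i)) is ≡ t ∧ not (twoSym v-1)

  module AtTwo (c : Vec Bool n) where

    open TwoAdicBooleans p q n Dv s (C c) p-odd D-odd (C-odd c)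

    module 2adic (d : ℤ) = Dyadic p q m D d (+ p) T₂ (+ D) (sym (Powers.L-def 2 m)) 1≤m (nat-mod 2 p 1 p-odd)
      (nat-mod 2 D 1 D-odd) (Φ≡poly 2 d)

    N-false : + N false c ≡ + C c
    N-false = cong +_ (ℕₚ.*-identityˡ (C c))

    N-true : + N true c ≡ + 2 * + C c
    N-true = ℤₚ.pos-* 2 (C c)

    odd-C : Odd (+ C c)
    odd-C = nat-mod 2 (C c) 1 (C-odd c)

    to : ∀ {b} → case2 ≡ true ⊎ χ₄ (C c) ≡ b → case2 ≡ true ⊎ xorAll (λ i → lookup c i ∧ isNR -[1+ 0 ] (Dv i)) is ≡ b
    to = [ inj₁ , (λ e → inj₂ (trans (χ₄-C c) e)) ]′

    from : ∀ {b} → case2 ≡ true ⊎ xorAll (λ i → lookup c i ∧ isNR -[1+ 0 ] (Dv i)) is ≡ b → case2 ≡ true ⊎ χ₄ (C c) ≡ b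
    from = [ inj₁ , (λ e → inj₂ (trans (sym (χ₄-C c)) e)) ]′

    necessary : ∀ t → ℓ-point 2 t c → TwoAdic t c × (t ≡ true → ¬ Cond)
    necessary false pt = to (odd⇒boolean m (2adic.odd-necessary (+ C c) odd-C
      (subst (λ d → HasPoint (Qℓ 2) d p q m D) N-false pt))) , λ ()
    necessary true pt = let nc , h = even⇒boolean m (2adic.even-necessary (+ N true c) N-true odd-C pt) in to h , λ _ → nc

    sufficient : ∀ t → TwoAdic t c → (t ≡ true → ¬ Cond) → ℓ-point 2 t c
    sufficient false h _ = subst (λ d → HasPoint (Qℓ 2) d p q m D) (sym N-false)
      (2adic.odd-sufficient (+ C c) odd-C (boolean⇒odd m (from h)))
    sufficient true h nc = 2adic.even-sufficient (+ N true c) N-true odd-C (boolean⇒even m 1≤m (nc refl , from h))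

  -- The exponents of -1, p and q are zero: the real place excludes negative `d`, and the primes p
  -- and q exclude their multiples.
  enc : Bool → Vec Bool n → Exps
  enc t c = false , t , false , false , c

  dOf-enc : ∀ t c → dOf (enc t c) ≡ + N t c
  dOf-enc t c = trans (ℤₚ.*-identityˡ _) (cong (λ x → + (x ℕ.* C c)) (trans (ℕₚ.*-identityʳ (pw t 2 ℕ.* 1))
    (ℕₚ.*-identityʳ (pw t 2))))

  good⇒selmer : ∀ t c → Good t c → (t ≡ true → ¬ Cond) → InSelmer (enc t c)
  good⇒selmer t c g nc = subst (λ d → HasPoint ℝ d p q m D) (sym (dOf-enc t c)) (RealPoint.real-point (N t c) N≥1 p q m D) ,
    λ ℓ pr → subst (λ d → HasPoint (Qℓ ℓ) d p q m D) (sym (dOf-enc t c)) (locally ℓ pr (ℓ ℕ.≟ 2) (ℓ ℕ.≟ p)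
      (ℓ ℕ.≟ q) (Finₚ.any? (λ j → ℓ ℕ.≟ Dv j)))
    where
    open Good g
    odd-positive : ∀ x → x ℕ.% 2 ≡ 1 → 1 ℕ.≤ x
    odd-positive (suc x) _ = s≤s z≤n
    N≥1 : 1 ℕ.≤ N t c
    N≥1 = ℕₚ.*-mono-≤ (two t) (odd-positive (C c) (C-odd c))
      where
      two : ∀ t → 1 ℕ.≤ pw t 2
      two true = s≤s z≤n
      two false = s≤s z≤n
    locally : ∀ ℓ → Prime ℓ → Dec (ℓ ≡ 2) → Dec (ℓ ≡ p) → Dec (ℓ ≡ q) → Dec (∃ λ j → ℓ ≡ Dv j) → ℓ-point ℓ t c
    locally .2 pr (yes refl) _ _ _ = AtTwo.sufficient c t at2 nc
    locally .p pr (no _) (yes refl) _ _ = At.residue-point pr p-odd (+ N t c) (N-unit pr p-odd t c units)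
      (parity⇒Sq pr p-odd t c units atp)
      where
      units : ∀ i → Unit p (+ factor c i)
      units = factor-unit pr c (λ i _ → p≢D i)
    locally .q pr (no _) (no _) (yes refl) _ = At.residue-point pr q-odd (+ N t c) (N-unit pr q-odd t c units)
      (parity⇒Sq pr q-odd t c units atq)
      where
      units : ∀ i → Unit q (+ factor c i)
      units = factor-unit pr c (λ i _ → q≢D i)
    locally .(Dv j) pr (no _) (no _) (no _) (yes (j , refl)) = by-label (lookup c j) refl
      where
      by-label : ∀ b → lookup c j ≡ b → ℓ-point (Dv j) t c
      by-label true cj = AtPrime.Inside.sufficient t c j cj (sub j cj) (atD j)
      by-label false cj = AtPrime.Outside.sufficient t c j cj (atD j)
    locally ℓ pr (no ℓ≢2) (no ℓ≢p) (no ℓ≢q) (no ℓ∤D) = At.good-point pr odd (+ N t c) (distinct-unit pr prime-p ℓ≢p)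
      (subst (Unit ℓ) (sym p+T≡q) (distinct-unit pr prime-q ℓ≢q)) (T-unit pr odd) (D-unit pr (λ i e → ℓ∤D (i , e)))
      (N-unit pr odd t c (factor-unit pr c (λ i _ e → ℓ∤D (i , e))))
      where
      odd : ℓ ℕ.% 2 ≡ 1
      odd = odd-prime pr ℓ≢2

  selmer⇒good : ∀ x → InSelmer x → ∃ λ t → ∃ λ c → x ≡ enc t c × Good t c × (t ≡ true → ¬ Cond)
  selmer⇒good (true , t , a , b , c) (real , _) = ⊥-elim (no-negative M refl M≥1)
    where
    M : ℕ
    M = pw t 2 ℕ.* pw a p ℕ.* pw b q ℕ.* C c
    pw-positive : ∀ e {x} → 1 ℕ.≤ x → 1 ℕ.≤ pw e x
    pw-positive true h = h
    pw-positive false _ = s≤s z≤n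
    prime-positive : ∀ {r} → Prime r → 1 ℕ.≤ r
    prime-positive {r} pr = ℕ.>-nonZero⁻¹ r {{prime⇒nonZero pr}}
    M≥1 : 1 ℕ.≤ M
    M≥1 = ℕₚ.*-mono-≤ (ℕₚ.*-mono-≤ (ℕₚ.*-mono-≤ (pw-positive t (s≤s z≤n)) (pw-positive a (prime-positive prime-p)))
      (pw-positive b (prime-positive prime-q)))
      (prod-positive (factor c) (λ i → pw-positive (lookup c i) (prime-positive (prime-D i))) is)
    no-negative : ∀ k → M ≡ k → 1 ℕ.≤ M → ⊥
    no-negative zero e h = case subst (1 ℕ.≤_) e h of λ ()
    no-negative (suc k) e _ = no-real-point k p q m D (subst (λ d → HasPoint ℝ d p q m D)
      (trans (cong (λ x → -[1+ 0 ] * + x) e) (ℤₚ.-1*i≡-i (+ suc k))) real)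
  selmer⇒good (false , t , true , b , c) (_ , local) = ⊥-elim (At.ramified-no-point prime-p p-odd d {+ rest}
    d≡ rest-unit (T-unit prime-p p-odd) (D-unit prime-p p≢D) (local p prime-p))
    where
    d : ℤ
    d = dOf (false , t , true , b , c)
    rest : ℕ
    rest = pw t 2 ℕ.* pw b q ℕ.* C c
    rearrange : ∀ x p y z → x ℕ.* p ℕ.* y ℕ.* z ≡ p ℕ.* (x ℕ.* y ℕ.* z)
    rearrange = ℕSolver.solve-∀
    d≡ : d ≡ + p * + rest
    d≡ = trans (ℤₚ.*-identityˡ _) (trans (cong +_ (rearrange (pw t 2) p (pw b q) (C c))) (ℤₚ.pos-* p rest))
    rest-unit : Unit p (+ rest)
    rest-unit = Unit-ℕ* prime-p (pw t 2 ℕ.* pw b q) (C c) (Unit-ℕ* prime-p (pw t 2) (pw b q) (pw2-unit prime-p p-odd t)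
      (pw-unit prime-p b q (λ _ → distinct-unit prime-p prime-q p≢q)))
      (prod-unit prime-p (factor c) (factor-unit prime-p c (λ i _ → p≢D i)) is)
  selmer⇒good (false , t , false , true , c) (_ , local) = ⊥-elim (At.ramified-no-point prime-q q-odd d {+ N t c} d≡
    (N-unit prime-q q-odd t c (factor-unit prime-q c (λ i _ → q≢D i))) (T-unit prime-q q-odd) (D-unit prime-q q≢D)
    (local q prime-q))
    where
    d : ℤ
    d = dOf (false , t , false , true , c)
    rearrange : ∀ x q z → x ℕ.* 1 ℕ.* q ℕ.* z ≡ q ℕ.* (x ℕ.* z)
    rearrange = ℕSolver.solve-∀
    d≡ : d ≡ + q * + N t c
    d≡ = trans (ℤₚ.*-identityˡ _) (trans (cong +_ (rearrange (pw t 2) q (C c))) (ℤₚ.pos-* q (N t c)))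
  selmer⇒good (false , t , false , false , c) (_ , local) = t , c , refl , record
      { sub = λ i ci → AtPrime.Inside.inS-necessary t c i ci (at (Dv i) (prime-D i))
      ; atp = Sq⇒parity prime-p p-odd t c (factor-unit prime-p c (λ i _ → p≢D i)) (point-at-p t c (at p prime-p))
      ; atq = Sq⇒parity prime-q q-odd t c (factor-unit prime-q c (λ i _ → q≢D i)) (point-at-q t c (at q prime-q))
      ; atD = λ j → by-label j (lookup c j) refl
      ; at2 = proj₁ two
      } , proj₂ two
    where
    at : ∀ ℓ → Prime ℓ → ℓ-point ℓ t c
    at ℓ pr = subst (λ d → HasPoint (Qℓ ℓ) d p q m D) (dOf-enc t c) (local ℓ pr)
    two : TwoAdic t c × (t ≡ true → ¬ Cond)
    two = AtTwo.necessary c t (at 2 prime[2])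
    by-label : ∀ j b → lookup c j ≡ b → AtD t c j (lookup c j)
    by-label j true cj = AtPrime.Inside.necessary t c j cj (at (Dv j) (prime-D j))
    by-label j false cj = AtPrime.Outside.necessary t c j cj (at (Dv j) (prime-D j))

  -- Comparison with the graph

  module OutParity (c : Vec Bool n) (sub : ∀ i → lookup c i ≡ true → inS i ≡ true) where

    no-edge-to--1 : ∀ P → edge P v-1 ≡ false
    no-edge-to--1 v-1 = refl
    no-edge-to--1 vp = refl
    no-edge-to--1 vq = refl
    no-edge-to--1 (vD _) = refl

    no-edge-to-q : ∀ P → edge P vq ≡ false
    no-edge-to-q v-1 = refl
    no-edge-to-q vp = refl
    no-edge-to-q vq = refl
    no-edge-to-q (vD _) = refl

    out : ∀ P → outParity c P ≡ ((label c P xor false) ∧ edge P vp) xor xorAll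
      (λ i → (label c P xor lookup c i) ∧ edge P (vD i)) is
    out P = trans (skip case2) (cong (f vp xor_) (trans (cong₂ _xor_ (vanish vq (no-edge-to-q P)) (xorAll-map f vD is)) refl))
      where
      f : Vtx → Bool
      f v = (label c P xor label c v) ∧ edge P v
      vanish : ∀ v → edge P v ≡ false → f v ≡ false
      vanish v e = trans (cong ((label c P xor label c v) ∧_) e) (𝔹ₚ.∧-zeroʳ _)
      skip : ∀ b → xorAll f (if b then base else v-1 ∷ base) ≡ xorAll f base
      skip true = refl
      skip false = cong (_xor xorAll f base) (vanish v-1 (no-edge-to--1 P))

    -- Every edge is subject to a condition `inS`. A crossing edge has an end in V₁, which consists
    -- of vertices `D_i` with `inS i`, so the condition holds by itself.
    drop-inS : ∀ {a b} x → (a ≡ true → b ≡ true) → a ∧ (b ∧ x) ≡ a ∧ x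
    drop-inS {false} x h = refl
    drop-inS {true} x h rewrite h refl = refl

    out-p : outParity c vp ≡ xorAll (λ i → lookup c i ∧ isNR (+ Dv i) p) is
    out-p = trans (out vp) (xorAll-cong (λ i → drop-inS _ (sub i)) is)

    out-q : outParity c vq ≡ xorAll (λ i → lookup c i ∧ isNR (+ Dv i) q) is
    out-q = trans (out vq) (xorAll-cong (λ i → drop-inS _ (sub i)) is)

    out--1 : outParity c v-1 ≡ xorAll (λ i → lookup c i ∧ isNR -[1+ 0 ] (Dv i)) is
    out--1 = trans (out v-1) (xorAll-cong (λ i → drop-inS _ (sub i)) is)

    out-D : ∀ j → outParity c (vD j) ≡ (lookup c j ∧ isNR (+ p) (Dv j)) xor xorAll
      (λ i → (lookup c j xor lookup c i) ∧ isNR (+ Dv i) (Dv j)) is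
    out-D j = trans (out (vD j)) (cong₂ _xor_
      (trans (cong (_∧ (inS j ∧ isNR (+ p) (Dv j))) (𝔹ₚ.xor-identityʳ (lookup c j))) (drop-inS _ (sub j)))
      (xorAll-cong (λ i → drop-inS _ (either (sub j) (sub i))) is))
      where
      either : ∀ {a b x y} → (a ≡ true → x ≡ true) → (b ≡ true → y ≡ true) → a xor b ≡ true → x ∨ y ≡ true
      either {true} {false} f _ _ rewrite f refl = refl
      either {false} {true} {x} _ g _ rewrite g refl = 𝔹ₚ.∨-zeroʳ x

  double-not : ∀ t x → t ∧ not (not x) ≡ t ∧ x
  double-not t x = cong (t ∧_) (𝔹ₚ.not-involutive x)

  base⊆ : ∀ {v} → v ∈ base → v ∈ vertices
  base⊆ v∈ = go case2
    where
    go : ∀ b → _ ∈ (if b then base else v-1 ∷ base)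
    go true = v∈
    go false = there v∈

  accepted : Bool → Partition → Bool
  accepted t L = balanced t L ∧ restricted L

  accepted⇒good : ∀ t c → accepted t (part c vertices) ≡ true → Good t c
  accepted⇒good t c e = record
      { sub = sub
      ; atp = trans (sym out-p) (trans (parities (base⊆ (here refl))) (double-not t _))
      ; atq = trans (sym out-q) (trans (parities (base⊆ (there (here refl)))) (double-not t _))
      ; atD = λ j → trans (sym (out-D j)) (trans (parities (base⊆ (there (there (∈ₚ.∈-map⁺ vD (∈ₚ.∈-allFin j))))))
        (double-not t _))
      ; at2 = minus-one case2 refl
      }
    where
    sub : ∀ i → lookup c i ≡ true → inS i ≡ true
    sub = restricted⇒ c (proj₂ (∧-true (balanced t (part c vertices)) e))
    parities : ∀ {P} → P ∈ vertices → outParity c P ≡ t ∧ not (twoSym P)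
    parities = balanced⇒ t c (proj₁ (∧-true (balanced t (part c vertices)) e))
    open OutParity c sub
    minus-one : ∀ b → case2 ≡ b → TwoAdic t c
    minus-one true e₂ = inj₁ e₂
    minus-one false e₂ = inj₂ (trans (sym out--1) (parities (subst (λ b → v-1 ∈ (if b then base else v-1 ∷ base))
      (sym e₂) (here refl))))

  good⇒accepted : ∀ t c → Good t c → accepted t (part c vertices) ≡ true
  good⇒accepted t c g = cong₂ _∧_ (⇒balanced t c (λ {P} P∈ → parities case2 refl P P∈)) (⇒restricted c sub)
    where
    open Good g
    open OutParity c sub
    parities : ∀ b → case2 ≡ b → ∀ P → P ∈ (if case2 then base else v-1 ∷ base) → outParity c P ≡ t ∧ not (twoSym P)
    parities _ _ vp _ = trans out-p (trans atp (sym (double-not t _)))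
    parities _ _ vq _ = trans out-q (trans atq (sym (double-not t _)))
    parities _ _ (vD j) _ = trans (out-D j) (trans (atD j) (sym (double-not t _)))
    parities true e v-1 P∈ = ⊥-elim (not-in is (subst (λ b → v-1 ∈ (if b then base else v-1 ∷ base)) e P∈))
      where
      not-vD : ∀ js → ¬ (v-1 ∈ map vD js)
      not-vD (_ ∷ js) (there h) = not-vD js h
      not-in : ∀ js → ¬ (v-1 ∈ vp ∷ vq ∷ map vD js)
      not-in js (there (there h)) = not-vD js h
    parities false e v-1 _ = trans out--1 ([ (λ e′ → case trans (sym e) e′ of λ ()) , (λ h → h) ]′ at2)

  -- Counting the Selmer group

  candidates : Bool → List Partition
  candidates t = filterᵇ (accepted t) (labelings vertices)

  selmerList : Bool → List Exps
  selmerList t = map (enc t ∘ labels) (candidates t)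

  candidate : ∀ t {L} → L ∈ candidates t → L ≡ part (labels L) vertices × accepted t L ≡ true
  candidate t {L} L∈ = let L∈′ , h = ∈ₚ.∈-filter⁻ (T? ∘ accepted t) L∈
                           e = T⇒≡ (accepted t L) h
                       in recover L∈′ (proj₂ (∧-true (balanced t L) e)) , e
    where
    T⇒≡ : ∀ b → T b → b ≡ true
    T⇒≡ true _ = refl

  unique-image : ∀ {A B : Set} (f : A → B) (g : B → A) {xs} → Unique xs → (∀ {x} → x ∈ xs → x ≡ g (f x)) → Unique (map f xs)
  unique-image f g [] _ = []
  unique-image f g {x ∷ xs} (∉ ∷ u) h = All.tabulate fresh ∷ unique-image f g u (h ∘ there)
    where
    fresh : ∀ {y} → y ∈ map f xs → f x ≢ y
    fresh y∈ e = let x′ , x′∈ , y≡ = ∈ₚ.∈-map⁻ f y∈ in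
      All.lookup ∉ x′∈ (trans (h (here refl)) (trans (cong g (trans e y≡)) (sym (h (there x′∈)))))

  -- The exponent vector determines the partition: `part` rebuilds an accepted one from its labels
  -- on the `D_i`.
  selmerList-unique : ∀ t → Unique (selmerList t)
  selmerList-unique t = unique-image (enc t ∘ labels) (λ { (_ , _ , _ , _ , c) → part c vertices })
    (Uniqueₚ.filter⁺ (T? ∘ accepted t) (labelings-unique vertices)) (λ L∈ → proj₁ (candidate t L∈))

  ∈selmerList⇒good : ∀ t {x} → x ∈ selmerList t → ∃ λ c → x ≡ enc t c × Good t c
  ∈selmerList⇒good t x∈ = let L , L∈ , x≡ = ∈ₚ.∈-map⁻ (enc t ∘ labels) x∈
                              L≡ , e = candidate t L∈
                          in labels L , x≡ , accepted⇒good t (labels L) (trans (cong (accepted t) (sym L≡)) e)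

  good⇒∈selmerList : ∀ t c → Good t c → enc t c ∈ selmerList t
  good⇒∈selmerList t c g = subst (λ c′ → enc t c′ ∈ selmerList t) (labels-part c)
    (∈ₚ.∈-map⁺ (enc t ∘ labels) (∈ₚ.∈-filter⁺ (T? ∘ accepted t) (part-∈ c vertices) (subst T (sym (good⇒accepted t c g)) tt)))

  card-even : Cond → Card InSelmer #even
  card-even cond = selmerList false , selmerList-unique false ,
    (λ x x∈ → let c , x≡ , g = ∈selmerList⇒good false x∈ in subst InSelmer (sym x≡) (good⇒selmer false c g (λ ()))) ,
    (λ x x∈ → complete x (selmer⇒good x x∈)) ,
    Listₚ.length-map (enc false ∘ labels) (candidates false)
    where
    complete : ∀ x → (∃ λ t → ∃ λ c → x ≡ enc t c × Good t c × (t ≡ true → ¬ Cond)) → x ∈ selmerList false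
    complete _ (false , c , refl , g , _) = good⇒∈selmerList false c g
    complete _ (true , c , refl , g , nc) = contradiction cond (nc refl)

  card-both : ¬ Cond → Card InSelmer (#even ℕ.+ #quasiEven)
  card-both nc = selmerList false ++ selmerList true ,
    Uniqueₚ.++⁺ (selmerList-unique false) (selmerList-unique true) disjoint ,
    (λ x x∈ → [ sound false , sound true ]′ (∈ₚ.∈-++⁻ (selmerList false) x∈)) ,
    (λ x x∈ → complete x (selmer⇒good x x∈)) ,
    trans (Listₚ.length-++ (selmerList false)) (cong₂ ℕ._+_ (Listₚ.length-map (enc false ∘ labels) (candidates false))
      (Listₚ.length-map (enc true ∘ labels) (candidates true)))
    where
    sound : ∀ t {x} → x ∈ selmerList t → InSelmer x
    sound t x∈ = let c , x≡ , g = ∈selmerList⇒good t x∈ in subst InSelmer (sym x≡) (good⇒selmer t c g (λ _ → nc))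
    complete : ∀ x → (∃ λ t → ∃ λ c → x ≡ enc t c × Good t c × (t ≡ true → ¬ Cond)) → x ∈ selmerList false ++ selmerList true
    complete _ (false , c , refl , g , _) = ∈ₚ.∈-++⁺ˡ (good⇒∈selmerList false c g)
    complete _ (true , c , refl , g , _) = ∈ₚ.∈-++⁺ʳ (selmerList false) (good⇒∈selmerList true c g)
    disjoint : ∀ {x} → ¬ (x ∈ selmerList false × x ∈ selmerList true)
    disjoint (x∈ , x∈′) = let _ , e , _ = ∈selmerList⇒good false x∈
                              _ , e′ , _ = ∈selmerList⇒good true x∈′
                          in case trans (sym e) e′ of λ ()

theorem1p1 :
    (p q m : ℕ) → Prime p → Prime q → p ℕ.% 2 ≡ 1 → q ℕ.% 2 ≡ 1 →
    1 ℕ.≤ m → q ≡ p ℕ.+ 2 ℕ.^ m →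
    (n : ℕ) → 1 ℕ.≤ n → (D : Fin n → ℕ) →
    ((i : Fin n) → Prime (D i)) → ((i : Fin n) → D i ℕ.% 2 ≡ 1) →
    ((i j : Fin n) → D i ≡ D j → i ≡ j) →
    ((i : Fin n) → D i ≢ p × D i ≢ q) →
    (s : ℕ) → s ℕ.≤ n →
    ((i : Fin n) → toℕ i ℕ.< s → legendre (+ (p ℕ.* q)) (D i) ≡ + 1) →
    ((i : Fin n) → s ℕ.≤ toℕ i → legendre (+ (p ℕ.* q)) (D i) ≡ -[1+ 0 ]) →
    (Setup.Cond p q m n D s →
       Card (Setup.InSelmer p q m n D s) (Setup.#even p q m n D s))
    ×
    (¬ Setup.Cond p q m n D s →
       Card (Setup.InSelmer p q m n D s)
            (Setup.#even p q m n D s ℕ.+ Setup.#quasiEven p q m n D s))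
theorem1p1 p q m prime-p prime-q p-odd q-odd 1≤m q≡ n _ D prime-D odd-D D-injective D≢pq s _ inside outside =
  card-even , card-both
  where
  open Selmer p q m prime-p prime-q p-odd q-odd 1≤m q≡ n D prime-D odd-D D-injective D≢pq s inside outside
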